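{- Let $p\in\{a,e\}^*$ and $\otimes\in\{\mathrm{del},\mathrm{add},\mathrm{edit}\}$. Then: (1) if $p\preceq e^*$, then $\textsc{RM}^{\otimes}_{\mathrm{mon}}(p)\subseteq\mathrm{AC}^0$; (2) if $a\preceq p$, then $\textsc{RM}^{\otimes}_{\mathrm{mon}}(p)\not\subseteq\mathrm{AC}^0$ but $\textsc{RM}^{\otimes}_{\mathrm{mon}}(p)\subseteq\mathrm{TC}^0$.
   Context: A monadic vocabulary $\tau=\{R_1,\dots,R_r\}$ has only unary relation symbols; a finite $\tau$-structure is $\mathcal A=(A,R_1^{\mathcal A},\dots,R_r^{\mathcal A})$ with $R_i^{\mathcal A}\subseteq A$ (ordered). A modulator is $S=(S_1,\dots,S_r)$ with $S_i\subseteq A$; deletion modulator if $S_i\subseteq R_i^{\mathcal A}$, addition modulator if $S_i\cap R_i^{\mathcal A}=\emptyset$; $\mathcal A\triangleright S=(A,R_1^{\mathcal A}\triangle S_1,\dots,R_r^{\mathcal A}\triangle S_r)$, $\|S\|=\sum_i|S_i|$. For a prenex first-order $\tau$-sentence $\phi$, $\textsc{RM}^{\mathrm{edit}}_{\mathrm{mon}}(\phi)$: given $\mathcal A$ and $k\in\mathbb N$, is there a modulator $S$ with $\|S\|\le k$ and $\mathcal A\triangleright S\models\phi$; del/add versions require a deletion/addition modulator. The pattern of $\phi$ is the word over $\{a,e\}$ recording its quantifier prefix ($a$ for $\forall$, $e$ for $\exists$); $\textsc{RM}^{\otimes}_{\mathrm{mon}}(p)$ is the class of all such problems (over any monadic vocabulary)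 for sentences with pattern $p$. $p\preceq q$: $p$ is a subsequence of $q$; $e^*$ denotes the words consisting only of $e$'s. $\mathrm{AC}^0$, $\mathrm{TC}^0$: constant-depth polynomial-size circuit classes without/with threshold gates. -}

module Defs where

open import Data.Bool.Base using (Bool; true; false; if_then_else_)
import Data.Bool.Base as Bool
open import Data.Bool.ListAction using (and; or)
open import Data.Fin.Base using (Fin)
open import Data.Fin.Subset using (Subset; _∈_; _⊆_; _∩_; _∪_; _─_; ∣_∣)
import Data.Fin.Subset as Subset
open import Data.List.Base using (List; []; _∷_; _++_; length; replicate; foldr; concatMap; filterᵇ)
import Data.List.Base as List
open import Data.List.Relation.Binary.Sublist.Propositional using () renaming (_⊆_ to _⊑_)
open import Data.Nat.Base using (ℕ; suc; _+_; _*_; _^_; _⊔_; _≤_; _≤ᵇ_)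
open import Data.Product.Base using (Σ; ∃-syntax; _×_; _,_)
open import Data.Sum.Base using (_⊎_)
open import Data.Empty using (⊥)
open import Data.Unit.Base using (⊤)
open import Data.Vec.Base using (Vec; lookup; zipWith; sum; toList)
import Data.Vec.Base as Vec
open import Function.Bundles using (_⇔_)
open import Function.Base using (id)
open import Level using (0ℓ)
open import Relation.Binary.PropositionalEquality.Core using (_≡_)
open import Relation.Nullary.Negation.Core using (¬_)
open import Relation.Unary using (Pred; _≐_)

------------------------------------------------------------------------
-- Monadic structures and modulators

-- A vocabulary is given by its number r of unary symbols; the universe
-- is Fin n in its natural order (used only by the string encoding below,
-- never by formulas).
Structure : ℕ → ℕ → Set
Structure r n = Vec (Subset n) r

Modulator : ℕ → ℕ → Set
Modulator r n = Vec (Subset n) r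

infixl 6 _△_
_△_ : {n : ℕ} → Subset n → Subset n → Subset n
p △ q = (p ─ q) ∪ (q ─ p)

infixl 5 _▷_
_▷_ : {r n : ℕ} → Structure r n → Modulator r n → Structure r n
A ▷ S = zipWith _△_ A S

‖_‖ : {r n : ℕ} → Modulator r n → ℕ
‖ S ‖ = sum (Vec.map ∣_∣ S)

data Operation : Set where
  del add edit : Operation

Allowed : {r n : ℕ} → Operation → Structure r n → Modulator r n → Set
Allowed {r} del  A S = (i : Fin r) → lookup S i ⊆ lookup A i
Allowed {r} add  A S = (i : Fin r) → lookup S i ∩ lookup A i ≡ Subset.⊥
Allowed     edit A S = ⊤

------------------------------------------------------------------------
-- Prenex first-order logic with equality

data Quantifier : Set where
  a e : Quantifier

Pattern : Set
Pattern = List Quantifier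

infix 4 _≼_
_≼_ : Pattern → Pattern → Set
p ≼ q = p ⊑ q

-- Quantifier-free formulas over r unary symbols, with de Bruijn
-- variables in Fin m.
infix  7 _≈′_
infix  6 ¬′_
infixr 5 _∧′_
infixr 4 _∨′_
data Matrix (r m : ℕ) : Set where
  true′ false′ : Matrix r m
  rel          : Fin r → Fin m → Matrix r m
  _≈′_         : Fin m → Fin m → Matrix r m
  ¬′_          : Matrix r m → Matrix r m
  _∧′_ _∨′_    : Matrix r m → Matrix r m → Matrix r m

data Prenex (r m : ℕ) : Set where
  matrix : Matrix r m → Prenex r m
  quant  : Quantifier → Prenex r (suc m) → Prenex r m

Sentence : ℕ → Set
Sentence r = Prenex r 0

pattern-of : {r m : ℕ} → Prenex r m → Pattern
pattern-of (matrix ψ)  = []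
pattern-of (quant Q φ) = Q ∷ pattern-of φ

-- Universes are finite and unary predicates decidable, so this
-- constructive reading of the connectives agrees with the classical one.
SatMatrix : {r n m : ℕ} → Structure r n → Vec (Fin n) m → Matrix r m → Set
SatMatrix A ρ true′     = ⊤
SatMatrix A ρ false′    = ⊥
SatMatrix A ρ (rel i x) = lookup ρ x ∈ lookup A i
SatMatrix A ρ (x ≈′ y)  = lookup ρ x ≡ lookup ρ y
SatMatrix A ρ (¬′ φ)    = ¬ SatMatrix A ρ φ
SatMatrix A ρ (φ ∧′ ψ)  = SatMatrix A ρ φ × SatMatrix A ρ ψ
SatMatrix A ρ (φ ∨′ ψ)  = SatMatrix A ρ φ ⊎ SatMatrix A ρ ψ

Sat : {r n m : ℕ} → Structure r n → Vec (Fin n) m → Prenex r m → Set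
Sat         A ρ (matrix ψ)  = SatMatrix A ρ ψ
Sat {n = n} A ρ (quant a φ) = (x : Fin n) → Sat A (x Vec.∷ ρ) φ
Sat {n = n} A ρ (quant e φ) = ∃[ x ] Sat A (x Vec.∷ ρ) φ

infix 4 _⊨_
_⊨_ : {r n : ℕ} → Structure r n → Sentence r → Set
A ⊨ φ = Sat A Vec.[] φ

------------------------------------------------------------------------
-- The relation modification problems, as languages

Language : Set₁
Language = Pred (List Bool) 0ℓ

YesInstance : {r n : ℕ} → Operation → Sentence r → Structure r n → ℕ → Set
YesInstance ⊗ φ A k =
  ∃[ S ] Allowed ⊗ A S × ‖ S ‖ ≤ k × (A ▷ S) ⊨ φ

-- Binary numerals, least significant bit first; redundant zeros in the
-- most significant positions are permitted.
value : List Bool → ℕ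
value []       = 0
value (b ∷ bs) = (if b then 1 else 0) + 2 * value bs

-- w encodes (A , k): 1ⁿ 0, then the characteristic string of each
-- relation, then k in binary.
Encodes : {r n : ℕ} → List Bool → Structure r n → ℕ → Set
Encodes {n = n} w A k =
  ∃[ bs ] value bs ≡ k
        × w ≡ replicate n true ++ false ∷ (concatMap toList (toList A) ++ bs)

Problem : {r : ℕ} → Operation → Sentence r → Language
Problem {r} ⊗ φ w =
  ∃[ n ] Σ (Structure r n) λ A → ∃[ k ] Encodes w A k × YesInstance ⊗ φ A k

RM : Operation → Pattern → Pred Language 0ℓ
RM ⊗ p L =
  ∃[ r ] Σ (Sentence r) λ φ → pattern-of φ ≡ p × L ≐ Problem ⊗ φ

------------------------------------------------------------------------
-- Circuits of unbounded fan-in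

data Basis : Set where
  boolean threshold : Basis

-- A gate reading from m nodes.  The gate `thr t js` fires when at least
-- t of its incoming wires carry true.
data Gate : Basis → ℕ → Set where
  neg       : {B : Basis} {m : ℕ} → Fin m → Gate B m
  conj disj : {B : Basis} {m : ℕ} → List (Fin m) → Gate B m
  thr       : {m : ℕ} → ℕ → List (Fin m) → Gate threshold m

sources : {B : Basis} {m : ℕ} → Gate B m → List (Fin m)
sources (neg j)    = j ∷ []
sources (conj js)  = js
sources (disj js)  = js
sources (thr _ js) = js

evalGate : {B : Basis} {m : ℕ} → Vec Bool m → Gate B m → Bool
evalGate v (neg j)    = Bool.not (lookup v j)
evalGate v (conj js)  = and (List.map (lookup v) js)
evalGate v (disj js)  = or (List.map (lookup v) js)
evalGate v (thr t js) = t ≤ᵇ length (filterᵇ id (List.map (lookup v) js))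

-- Acyclic circuits in topological order: `Gates B n m` has m nodes, the
-- first n being inputs.  Each new gate becomes node 0 and shifts the
-- indices of the earlier nodes by one.
infixl 5 _▸_
data Gates (B : Basis) (n : ℕ) : ℕ → Set where
  inputs : Gates B n n
  _▸_    : {m : ℕ} → Gates B n m → Gate B m → Gates B n (suc m)

values : {B : Basis} {n m : ℕ} → Gates B n m → Vec Bool n → Vec Bool m
values inputs   v = v
values (gs ▸ g) v = evalGate (values gs v) g Vec.∷ values gs v

depths : {B : Basis} {n m : ℕ} → Gates B n m → Vec ℕ m
depths inputs   = Vec.replicate _ 0
depths (gs ▸ g) =
  suc (foldr _⊔_ 0 (List.map (lookup (depths gs)) (sources g))) Vec.∷ depths gs

-- Gates plus wires.
gatesSize : {B : Basis} {n m : ℕ} → Gates B n m → ℕ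
gatesSize inputs   = 0
gatesSize (gs ▸ g) = suc (length (sources g)) + gatesSize gs

record Circuit (B : Basis) (n : ℕ) : Set where
  field
    {nodes} : ℕ
    gates   : Gates B n nodes
    output  : Fin nodes

  eval : Vec Bool n → Bool
  eval v = lookup (values gates v) output

  depth : ℕ
  depth = lookup (depths gates) output

  size : ℕ
  size = gatesSize gates

-- Non-uniform families, one circuit per input length.
ConstantDepthPolySize : Basis → Pred Language 0ℓ
ConstantDepthPolySize B L =
  ∃[ d ] ∃[ c ] ((n : ℕ) → Σ (Circuit B n) λ C →
      Circuit.depth C ≤ d
    × Circuit.size C ≤ n ^ c + c
    × ((w : Vec Bool n) → Circuit.eval C w ≡ true ⇔ L (toList w)))

AC⁰ TC⁰ : Pred Language 0ℓ
AC⁰ = ConstantDepthPolySize boolean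
TC⁰ = ConstantDepthPolySize threshold

{-# OPTIONS --safe #-}
module Submission where

-- Lower bound.  For ∀x R(x), or ∀x ¬R(x) when only deletions are allowed, the
-- least number of modifications is the number of elements violating the
-- matrix, so on 2m+1 elements with budget m the problem is majority or its
-- negation.  Following Razborov and Smolensky, the gates of a circuit are
-- replaced by polynomials over the field with two elements: an unbounded OR is
-- the complement of a product of l complemented sums of its inputs except on a
-- 2⁻ˡ fraction of the points.  So a small circuit of depth d agrees with a
-- polynomial of degree l^d outside a small set, whereas a polynomial of degree
-- D agreeing with majority on W makes every function on W a polynomial of degree
-- m + D, so that W has at most as many points as there are such monomials,
-- barely more than half of the cube.
--
-- Upper bounds.  For an existential sentence only the bits of the witnesses
-- need to be modified, so one searches over all witnesses and all modifications
-- of their boundedly many bits.  For an arbitrary sentence the answer depends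
-- only on the number of elements of each colour, so one searches over the
-- polynomially many vectors of such counts, and a table of the optimal costs is
-- built into the circuit.

open import Data.Bool.Base using (Bool; true; false; not; _∧_; _∨_; _xor_; if_then_else_)
open import Data.Bool.ListAction using (and; or)
import Data.Bool.Properties as Bool
open import Data.Bool.Properties using
  (∧-comm; ∧-identityʳ; ∧-zeroʳ; ∨-conicalˡ; ∨-conicalʳ; xor-same; xor-identityʳ;
   not-involutive; not-injective; ¬-not; T-≡)
open import Data.Fin.Base as Fin using (Fin; zero; suc)
import Data.Fin.Permutation as Perm
open Perm using (Permutation; _⟨$⟩ʳ_; _⟨$⟩ˡ_)
import Data.Fin.Properties as Fin
open import Data.Fin.Properties using (2↔Bool)
open import Data.Fin.Subset using (Subset; _∈_; _∩_; ∣_∣; ∁)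
import Data.Fin.Subset as Subset
open import Data.Fin.Subset.Properties using
  (_∈?_; _⊆?_; anySubset?; ∉⊥; x∈⁅x⁆; x∈⁅y⁆⇒x≡y; x∈p∪q⁺; x∈p∪q⁻; ∩-inverseˡ;
   ∣p∣≤n; ∣⊥∣≡0; ∣⁅x⁆∣≡1; ∣∁p∣≡n∸∣p∣; p⊆q⇒∣p∣≤∣q∣)
open import Data.List.Base as List using (List; []; _∷_; [_]; replicate)
open import Data.List.Membership.Propositional using () renaming (_∈_ to _∈ˡ_)
open import Data.List.Membership.Propositional.Properties using
  (∈-tabulate⁺; ∈-upTo⁺; ∈-cartesianProductWith⁺)
import Data.List.Properties as List
open import Data.List.Relation.Binary.Sublist.Propositional using ([]; _∷_; _∷ʳ_)
open import Data.List.Relation.Unary.All as All using (All; []; _∷_)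
import Data.List.Relation.Unary.All.Properties as All
open import Data.List.Relation.Unary.Any using (here; there)
open import Data.Nat.Base
open import Data.Nat.Combinatorics using (nC1≡n; k>n⇒nCk≡0; nCk+nC[k+1]≡[n+1]C[k+1])
  renaming (_C_ to infixl 8 _C_)
open import Data.Nat.Properties
open import Algebra.Properties.CommutativeMonoid.Sum +-0-commutativeMonoid
  using (sum-permute; sum-cong-≗) renaming (sum to Σ-sum)
open import Data.Nat.Tactic.RingSolver using (solve-∀)
open import Data.Product.Base
open import Data.Sum.Base as Sum using (_⊎_; inj₁; inj₂; [_,_]′)
open import Data.Unit.Base using (⊤; tt)
open import Data.Vec.Base as Vec using (Vec; []; _∷_; lookup)
import Data.Vec.Properties as Vec
open import Function.Base using (_∘_; id; case_of_)
open import Function.Bundles using (Inverse; Injection; _⇔_; mk⇔; Equivalence)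
open import Function.Properties.Inverse using (↔-sym; ↔⇒↣)
open import Relation.Binary.Definitions using (DecidableEquality)
open import Relation.Binary.PropositionalEquality hiding ([_])
open import Relation.Nullary.Decidable using
  (Dec; yes; no; does; map′; _×-dec_; _⊎-dec_; ¬?)
open import Relation.Nullary.Negation.Core using (¬_; contradiction)
open import Relation.Unary using (_⊆_; _⊈_)
open import Defs

-- Degree of a Boolean function as a polynomial over the field with two elements

-- The customary random choice of sums is replaced by a greedy one: `halve` finds, for any set of
-- points, a sum of the given functions that misses at most half of the points of that set where the
-- OR is 1, and it is applied again to the points still missed. Degree is a property of functions,
-- expressed by discrete derivatives; coefficient vectors appear only when polynomials are counted,
-- and the comparison of dimensions becomes a comparison of numbers of bit vectors. The parameters
-- pull against each other: l has to exceed the logarithm of the circuit size, so it grows with the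
-- logarithm of the instance length, while l^d has to stay below roughly the square root of m. In
-- the upper bounds the encoding is the obstacle. The length of the string does not reveal the size
-- of the universe, so all sizes are tried against the unary header. The budget is a binary numeral
-- of arbitrary length, so its bits have exponential weights; since it is only compared with a
-- known, small cost, each bit is replaced by a capped number of copies. For existential sentences
-- that cost is bounded by a constant, which is why no threshold gates are called for.

Cube : ℕ → Set
Cube = Vec Bool

-- In the expansion f₀ x + b f′ x of f (b ∷ x) along the first coordinate, the restriction f₀ keeps
-- the degree bound and the derivative f′ has one degree less.
Deg : (n D : ℕ) → (Cube n → Bool) → Set
Deg n       zero    f = ∀ x y → f x ≡ f y
Deg zero    (suc D) f = ⊤
Deg (suc n) (suc D) f = Deg n (suc D) (f ∘ (false ∷_))
  × Deg n D (λ x → f (true ∷ x) xor f (false ∷ x))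

Deg-cong : ∀ n D {f g} → f ≗ g → Deg n D f → Deg n D g
Deg-cong n       zero    eq df x y = trans (sym (eq x)) (trans (df x y) (eq y))
Deg-cong zero    (suc D) eq df = tt
Deg-cong (suc n) (suc D) eq (d₀ , d′) =
  Deg-cong n (suc D) (λ x → eq (false ∷ x)) d₀ ,
  Deg-cong n D (λ x → cong₂ _xor_ (eq (true ∷ x)) (eq (false ∷ x))) d′

Deg-const : ∀ n D b → Deg n D (λ _ → b)
Deg-const n       zero    b x y = refl
Deg-const zero    (suc D) b = tt
Deg-const (suc n) (suc D) b =
  Deg-const n (suc D) b , Deg-const n D (b xor b)

Deg-0⇒const : ∀ {n f} → Deg n 0 f → ∃[ b ] (λ _ → b) ≗ f
Deg-0⇒const {f = f} df = f (Vec.replicate _ false) , df _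

Deg-suc : ∀ n D {f} → Deg n D f → Deg n (suc D) f
Deg-suc n zero df with b , eq ← Deg-0⇒const df = Deg-cong n 1 eq (Deg-const n 1 b)
Deg-suc zero    (suc D) df = tt
Deg-suc (suc n) (suc D) (d₀ , d′) = Deg-suc n (suc D) d₀ , Deg-suc n D d′

Deg-mono : ∀ n {D E f} → D ≤ E → Deg n D f → Deg n E f
Deg-mono n {D} D≤E df = go (≤⇒≤′ D≤E)
  where
  go : ∀ {E} → D ≤′ E → Deg n E _
  go (≤′-reflexive refl) = df
  go (≤′-step p)         = Deg-suc n _ (go p)

xor-interchange : ∀ p q r s → (p xor q) xor (r xor s) ≡ (p xor r) xor (q xor s)
xor-interchange false false r     s = refl
xor-interchange false true  false s = refl
xor-interchange false true  true  s = refl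
xor-interchange true  false r     s = Bool-not-xor r s
  where
  Bool-not-xor : ∀ r s → not (r xor s) ≡ not r xor s
  Bool-not-xor false s = refl
  Bool-not-xor true  false = refl
  Bool-not-xor true  true = refl
xor-interchange true true  false false = refl
xor-interchange true true  false true  = refl
xor-interchange true true  true  false = refl
xor-interchange true true  true  true  = refl

Deg-xor : ∀ n D {f g} → Deg n D f → Deg n D g → Deg n D (λ x → f x xor g x)
Deg-xor n       zero    df dg x y = cong₂ _xor_ (df x y) (dg x y)
Deg-xor zero    (suc D) df dg = tt
Deg-xor (suc n) (suc D) {f} {g} (f₀ , f′) (g₀ , g′) =
  Deg-xor n (suc D) f₀ g₀ ,
  Deg-cong n D (λ x → xor-interchange (f (true ∷ x)) (f (false ∷ x)) (g (true ∷ x)) (g (false ∷ x)))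
    (Deg-xor n D f′ g′)

Deg-not : ∀ n D {f} → Deg n D f → Deg n D (not ∘ f)
Deg-not n D df = Deg-xor n D (Deg-const n D true) df

-- The product rule: with f₁ = f₀ + f′ and g₁ = g₀ + g′,
-- f₁ g₁ + f₀ g₀ = f₀ g′ + f′ g₀ + f′ g′.
product-rule : ∀ f₁ f₀ g₁ g₀ →
  (f₀ ∧ (g₁ xor g₀)) xor (((f₁ xor f₀) ∧ g₀) xor ((f₁ xor f₀) ∧ (g₁ xor g₀)))
  ≡ (f₁ ∧ g₁) xor (f₀ ∧ g₀)
product-rule false false g₁    g₀    = refl
product-rule true  false false false = refl
product-rule true  false false true  = refl
product-rule true  false true  false = refl
product-rule true  false true  true  = refl
product-rule false true  false false = refl
product-rule false true  false true  = refl
product-rule false true  true  false = refl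
product-rule false true  true  true  = refl
product-rule true  true  false false = refl
product-rule true  true  false true  = refl
product-rule true  true  true  false = refl
product-rule true  true  true  true  = refl

-- Each term of the product rule contains a differentiated factor, which pays for the degree that
-- the derivative of the product has to lose. A constant factor either leaves the other function as
-- it is or annihilates it.
Deg-∧ : ∀ n D E {f g} → Deg n D f → Deg n E g → Deg n (D + E) (λ x → f x ∧ g x)
Deg-∧ n zero E df dg with Deg-0⇒const df
... | true  , eq = Deg-cong n E (λ x → cong (_∧ _) (eq x)) dg
... | false , eq = Deg-cong n E (λ x → cong (_∧ _) (eq x)) (Deg-const n E false)
Deg-∧ n (suc D) zero {f} {g} df dg rewrite +-identityʳ D =
  Deg-cong n (suc D) (λ x → ∧-comm (g x) (f x)) (Deg-∧ n zero (suc D) dg df)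
Deg-∧ zero    (suc D) (suc E) df dg = tt
Deg-∧ (suc n) (suc D) (suc E) {f} {g} (f₀ , f′) (g₀ , g′) =
  Deg-∧ n (suc D) (suc E) f₀ g₀ ,
  Deg-cong n (D + suc E)
    (λ x → product-rule (f (true ∷ x)) (f (false ∷ x)) (g (true ∷ x)) (g (false ∷ x)))
    (Deg-xor n _ (Deg-mono n (≤-reflexive (sym (+-suc D E))) (Deg-∧ n (suc D) E f₀ g′))
      (Deg-xor n _ (Deg-∧ n D (suc E) f′ g₀)
        (Deg-mono n (+-monoʳ-≤ D (n≤1+n E)) (Deg-∧ n D E f′ g′))))

Deg-lookup : ∀ n (i : Fin n) → Deg n 1 (λ x → lookup x i)
Deg-lookup (suc n) zero    = Deg-const n 1 false , Deg-const n 0 true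
Deg-lookup (suc n) (suc i) = Deg-lookup n i ,
  Deg-cong n 0 (λ x → sym (xor-same (lookup x i))) (Deg-const n 0 false)

-- Complementing the first coordinate turns the restriction f₀ into f₀ + f′ and keeps the
-- derivative, because xor is symmetric.
Deg-∁ : ∀ n D {f} → Deg n D f → Deg n D (f ∘ Vec.map not)
Deg-∁ n       zero    df x y = df _ _
Deg-∁ zero    (suc D) df = tt
Deg-∁ (suc n) (suc D) {f} (f₀ , f′) =
  Deg-cong n (suc D) (λ x → shift (f (true ∷ Vec.map not x)) (f (false ∷ Vec.map not x)))
    (Deg-xor n (suc D) (Deg-∁ n (suc D) f₀) (Deg-suc n D (Deg-∁ n D f′))) ,
  Deg-cong n D (λ x → flip (f (true ∷ Vec.map not x)) (f (false ∷ Vec.map not x))) (Deg-∁ n D f′)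
  where
  shift : ∀ p q → q xor (p xor q) ≡ p
  shift false false = refl
  shift false true = refl
  shift true false = refl
  shift true true = refl
  flip : ∀ p q → p xor q ≡ q xor p
  flip false false = refl
  flip false true = refl
  flip true false = refl
  flip true true = refl

-- The number of monomials of degree at most D

monomials : ℕ → ℕ → ℕ
monomials n       zero    = 1
monomials zero    (suc D) = 1
monomials (suc n) (suc D) = monomials n (suc D) + monomials n D

polynomial : ∀ n D → Vec Bool (monomials n D) → Cube n → Bool
polynomial n       zero    (c ∷ []) x = c
polynomial zero    (suc D) (c ∷ []) x = c
polynomial (suc n) (suc D) cs (b ∷ x) =
  polynomial n (suc D) (Vec.take (monomials n (suc D)) cs) x
  xor (b ∧ polynomial n D (Vec.drop (monomials n (suc D)) cs) x)

take-++ : ∀ {m n} (us : Vec Bool m) (vs : Vec Bool n) → Vec.take m (us Vec.++ vs) ≡ us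
take-++ {m} us vs = Vec.++-injectiveˡ (Vec.take m (us Vec.++ vs)) us
  (Vec.take++drop≡id m (us Vec.++ vs))

drop-++ : ∀ {m n} (us : Vec Bool m) (vs : Vec Bool n) → Vec.drop m (us Vec.++ vs) ≡ vs
drop-++ {m} us vs = Vec.++-injectiveʳ (Vec.take m (us Vec.++ vs)) us
  (Vec.take++drop≡id m (us Vec.++ vs))

taylor : ∀ (f : Bool → Bool) b → f false xor (b ∧ (f true xor f false)) ≡ f b
taylor f false with f false
... | false = refl
... | true  = refl
taylor f true with f false | f true
... | false | false = refl
... | false | true  = refl
... | true  | false = refl
... | true  | true  = refl

coefficients : ∀ n D {f} → Deg n D f → ∃[ cs ] polynomial n D cs ≗ f
coefficients n zero df with b , eq ← Deg-0⇒const df = b ∷ [] , eq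
coefficients zero (suc D) {f} df = f [] ∷ [] , λ { [] → refl }
coefficients (suc n) (suc D) {f} (d₀ , d′)
  with cs₀ , eq₀ ← coefficients n (suc D) d₀ | cs′ , eq′ ← coefficients n D d′ =
  cs₀ Vec.++ cs′ , λ { (b ∷ x) → trans
    (cong₂ (λ us vs → polynomial n (suc D) us x xor (b ∧ polynomial n D vs x))
      (take-++ cs₀ cs′) (drop-++ cs₀ cs′))
    (trans (cong₂ (λ u v → u xor (b ∧ v)) (eq₀ x) (eq′ x)) (taylor (λ c → f (c ∷ x)) b)) }

-- Counting points of the cube

+-interchange : ∀ p q r s → p + q + (r + s) ≡ p + r + (q + s)
+-interchange = solve-∀

points : ∀ n → (Cube n → Bool) → ℕ
points zero    W = if W [] then 1 else 0
points (suc n) W = points n (W ∘ (false ∷_)) + points n (W ∘ (true ∷_))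

points-true : ∀ n → points n (λ _ → true) ≡ 2 ^ n
points-true zero    = refl
points-true (suc n) rewrite points-true n | +-identityʳ (2 ^ n) = refl

points-∨ : ∀ n {U V W : Cube n → Bool} → (∀ x → U x ≡ true → V x ≡ true ⊎ W x ≡ true) →
           points n U ≤ points n V + points n W
points-∨ zero {U} {V} {W} h with U [] | V [] | W [] | h []
... | false | _     | _     | _ = z≤n
... | true  | true  | _     | _ = s≤s z≤n
... | true  | false | true  | _ = s≤s z≤n
... | true  | false | false | h′ with h′ refl
...   | inj₁ ()
...   | inj₂ ()
points-∨ (suc n) {U} {V} {W} h =
  ≤-trans (+-mono-≤ (points-∨ n (h ∘ (false ∷_))) (points-∨ n (h ∘ (true ∷_))))
    (≤-reflexive (+-interchange (points n (V ∘ (false ∷_))) _ (points n (V ∘ (true ∷_))) _))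

points-false : ∀ n {U : Cube n → Bool} → (∀ x → U x ≡ false) → points n U ≡ 0
points-false zero {U} h rewrite h [] = refl
points-false (suc n) {U} h
  rewrite points-false n (h ∘ (false ∷_)) | points-false n (h ∘ (true ∷_)) = refl

points-mono : ∀ n {U V : Cube n → Bool} → (∀ x → U x ≡ true → V x ≡ true) → points n U ≤ points n V
points-mono n {U} {V} h = ≤-trans
  (points-∨ n {W = λ _ → false} (λ x Ux → inj₁ (h x Ux)))
  (≤-reflexive (trans (cong (points n V +_) (points-false n λ _ → refl)) (+-identityʳ _)))

points-split : ∀ n (U V : Cube n → Bool) → points n (λ x → U x ∧ V x) + points n
  (λ x → U x ∧ not (V x)) ≡ points n U
points-split zero U V with U [] | V []
... | false | _     = refl
... | true  | false = refl
... | true  | true  = refl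
points-split (suc n) U V = trans
  (+-interchange (points n (λ x → U (false ∷ x) ∧ V (false ∷ x)))
  (points n (λ x → U (true ∷ x) ∧ V (true ∷ x))) _ _)
  (cong₂ _+_ (points-split n (U ∘ (false ∷_)) (V ∘ (false ∷_)))
    (points-split n (U ∘ (true ∷_)) (V ∘ (true ∷_))))

-- Restriction to W as a bit vector, so that the functions on W can be counted against coefficient
-- vectors.
gather : ∀ n W → (Cube n → Bool) → Vec Bool (points n W)
gather zero W f with W []
... | true  = f [] ∷ []
... | false = []
gather (suc n) W f = gather n (W ∘ (false ∷_)) (f ∘ (false ∷_)) Vec.++ gather n (W ∘ (true ∷_))
  (f ∘ (true ∷_))

gather-cong : ∀ n W {f g} → (∀ x → W x ≡ true → f x ≡ g x) → gather n W f ≡ gather n W g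
gather-cong zero W eq with W [] | eq []
... | true  | eq′ = cong (_∷ []) (eq′ refl)
... | false | _   = refl
gather-cong (suc n) W eq =
  cong₂ Vec._++_ (gather-cong n _ (eq ∘ (false ∷_))) (gather-cong n _ (eq ∘ (true ∷_)))

scatter : ∀ n W → Vec Bool (points n W) → Cube n → Bool
scatter zero W u x with W []
scatter zero W (b ∷ []) x | true  = b
-- Outside W any value would do, since only restrictions to W are compared.
scatter zero W []       x | false = false
scatter (suc n) W u (false ∷ x) = scatter n _ (Vec.take (points n (W ∘ (false ∷_))) u) x
scatter (suc n) W u (true  ∷ x) = scatter n _ (Vec.drop (points n (W ∘ (false ∷_))) u) x

gather-scatter : ∀ n W u → gather n W (scatter n W u) ≡ u
gather-scatter zero W u with W []
gather-scatter zero W (b ∷ []) | true  = refl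
gather-scatter zero W []       | false = refl
gather-scatter (suc n) W u = trans
  (cong₂ Vec._++_ (gather-scatter n _ _) (gather-scatter n _ _))
  (Vec.take++drop≡id (points n (W ∘ (false ∷_))) u)

-- Bit vectors as numbers

open Inverse 2↔Bool using () renaming (to to toBool; from to fromBool)

index : ∀ {n} → Vec Bool n → Fin (2 ^ n)
index []      = zero
index (b ∷ u) = Fin.combine {2} (fromBool b) (index u)

index-injective : ∀ {n} (u v : Vec Bool n) → index u ≡ index v → u ≡ v
index-injective []      []      eq = refl
index-injective (b ∷ u) (c ∷ v) eq
  with eqʰ , eqᵗ ← Fin.combine-injective {2} (fromBool b) (index u) (fromBool c) (index v) eq =
  cong₂ _∷_ (Injection.injective (↔⇒↣ (↔-sym 2↔Bool)) eqʰ) (index-injective u v eqᵗ)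

unindex : ∀ n → Fin (2 ^ n) → Vec Bool n
unindex zero    i = []
unindex (suc n) i = toBool (proj₁ (Fin.remQuot {2} (2 ^ n) i)) ∷ unindex n
  (proj₂ (Fin.remQuot {2} (2 ^ n) i))

index-unindex : ∀ n i → index (unindex n i) ≡ i
index-unindex zero    zero = refl
index-unindex (suc n) i = trans
  (cong₂ (Fin.combine {2}) (Inverse.strictlyInverseʳ 2↔Bool (proj₁ (Fin.remQuot {2} (2 ^ n) i)))
    (index-unindex n (proj₂ (Fin.remQuot {2} (2 ^ n) i))))
  (Fin.combine-remQuot {2} (2 ^ n) i)

-- The section f embeds 2^m vectors into 2^n, and comparing the powers compares the exponents. This
-- takes the place of comparing the dimensions of two vector spaces over the field with two
-- elements.
Vec-Bool-retract⇒≤ : ∀ {m n} (f : Vec Bool m → Vec Bool n) (g : Vec Bool n → Vec Bool m) →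
                     (∀ u → g (f u) ≡ u) → m ≤ n
Vec-Bool-retract⇒≤ {m} {n} f g gf =
  ≮⇒≥ λ n<m → <⇒≱ (^-monoʳ-< 2 (s≤s (s≤s z≤n)) n<m)
    (Fin.injective⇒≤ {f = index ∘ f ∘ unindex m} λ {i} {j} eq → begin
      i                        ≡⟨ index-unindex m i ⟨
      index (unindex m i)      ≡⟨ cong index (gf (unindex m i)) ⟨
      index (g (f (unindex m i))) ≡⟨ cong (index ∘ g) (index-injective _ _ eq) ⟩
      index (g (f (unindex m j))) ≡⟨ cong index (gf (unindex m j)) ⟩
      index (unindex m j)      ≡⟨ index-unindex m j ⟩
      j                        ∎)
  where open ≡-Reasoning

-- If every function agrees with one of degree at most D on the points of W,
-- then restriction to W maps the polynomials of degree at most D onto the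
-- functions on W.
points≤monomials : ∀ n D W →
  (∀ f → ∃[ g ] Deg n D g × (∀ x → W x ≡ true → g x ≡ f x)) →
  points n W ≤ monomials n D
points≤monomials n D W approx = Vec-Bool-retract⇒≤
  (λ u → let _ , dg , _ = approx (scatter n W u) in proj₁ (coefficients n D dg))
  (λ cs → gather n W (polynomial n D cs))
  (λ u → let _ , dg , agree = approx (scatter n W u) ; cs , eq = coefficients n D dg in
    trans (gather-cong n W (λ x Wx → trans (eq x) (agree x Wx))) (gather-scatter n W u))

-- On the half-cube `false` the radius stays the same; a point `true ∷ x` of weight at most r + 1
-- leaves weight at most r to x, where interpolating the derivative with degree r is enough. For r =
-- 0 the ball is the zero vector alone.
interpolate : ∀ n r f → ∃[ g ] Deg n r g × (∀ x → ∣ x ∣ ≤ r → g x ≡ f x)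
interpolate n zero f = (λ _ → f (Vec.replicate n false)) , (λ _ _ → refl) ,
  λ x ∣x∣≤0 → cong f (sym (empty x ∣x∣≤0))
  where
  empty : ∀ {n} (x : Cube n) → ∣ x ∣ ≤ 0 → x ≡ Vec.replicate n false
  empty []          _ = refl
  empty (false ∷ x) h = cong (false ∷_) (empty x h)
interpolate zero (suc r) f = f , tt , λ _ _ → refl
interpolate (suc n) (suc r) f
  with g₀ , d₀ , eq₀ ← interpolate n (suc r) (f ∘ (false ∷_))
  with g′ , d′ , eq′ ← interpolate n r (λ x → f (true ∷ x) xor f (false ∷ x)) =
  g , (Deg-cong n (suc r) (λ x → sym (xor-identityʳ (g₀ x))) d₀ ,
       Deg-cong n r (λ x → sym (cancel (g₀ x) (g′ x))) d′) , agree
  where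
  g : Cube (suc n) → Bool
  g (b ∷ x) = g₀ x xor (b ∧ g′ x)
  cancel : ∀ p q → (p xor q) xor (p xor false) ≡ q
  cancel false false = refl
  cancel false true  = refl
  cancel true  false = refl
  cancel true  true  = refl
  agree : ∀ x → ∣ x ∣ ≤ suc r → g x ≡ f x
  agree (false ∷ x) h = trans (xor-identityʳ (g₀ x)) (eq₀ x h)
  agree (true  ∷ x) (s≤s h) =
    trans (cong₂ _xor_ (eq₀ x (m≤n⇒m≤1+n h)) (eq′ x h)) (taylor (λ b → f (b ∷ x)) true)

interpolate-∁ : ∀ n r f → ∃[ g ] Deg n r g × (∀ x → ∣ ∁ x ∣ ≤ r → g x ≡ f x)
interpolate-∁ n r f with g , dg , eq ← interpolate n r (f ∘ ∁) =
  g ∘ ∁ , Deg-∁ n r dg , λ x h → trans (eq (∁ x) h) (cong f (∁-involutive x))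
  where
  ∁-involutive : ∀ {n} (x : Cube n) → ∁ (∁ x) ≡ x
  ∁-involutive []      = refl
  ∁-involutive (b ∷ x) = cong₂ _∷_ (not-involutive b) (∁-involutive x)

-- Writing P for the low-degree approximation of majority, every function
-- agrees with P f₀ + (1 + P) f₁ where P is correct, for interpolants f₀ and f₁
-- on the lower and the upper half of the cube.
majority-approximation : ∀ m D P W → Deg (suc (m + m)) D P →
  (∀ x → W x ≡ true → P x ≡ (∣ x ∣ ≤ᵇ m)) →
  points (suc (m + m)) W ≤ monomials (suc (m + m)) (D + m)
majority-approximation m D P W dP correct = points≤monomials n (D + m) W λ f →
  let g₀ , d₀ , eq₀ = interpolate n m f
      g₁ , d₁ , eq₁ = interpolate-∁ n m f
  in (λ x → (P x ∧ g₀ x) xor (not (P x) ∧ g₁ x)) ,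
     Deg-xor n (D + m) (Deg-∧ n D m dP d₀) (Deg-∧ n D m (Deg-not n D dP) d₁) ,
     λ x Wx → agree f g₀ g₁ x (correct x Wx) eq₀ eq₁
  where
  n : ℕ
  n = suc (m + m)
  agree : ∀ (f g₀ g₁ : Cube n → Bool) x → P x ≡ (∣ x ∣ ≤ᵇ m) →
          (∀ x → ∣ x ∣ ≤ m → g₀ x ≡ f x) → (∀ x → ∣ ∁ x ∣ ≤ m → g₁ x ≡ f x) →
          (P x ∧ g₀ x) xor (not (P x) ∧ g₁ x) ≡ f x
  agree f g₀ g₁ x Px eq₀ eq₁ with P x | ∣ x ∣ ≤ᵇ m | Px | ≤ᵇ⇒≤ ∣ x ∣ m | ≤⇒≤ᵇ {∣ x ∣} {m}
  ... | true  | true  | _ | le | _ = trans (xor-identityʳ _) (eq₀ x (le tt))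
  -- The cube has odd dimension 2m + 1, so the balls of radius m about the two constant vectors
  -- cover it.
  ... | false | false | _ | _ | ge = eq₁ x (begin
    ∣ ∁ x ∣           ≡⟨ ∣∁p∣≡n∸∣p∣ x ⟩
    n ∸ ∣ x ∣         ≤⟨ ∸-monoʳ-≤ n (≰⇒> ge) ⟩
    n ∸ suc m         ≡⟨ m+n∸m≡n m m ⟩
    m                 ∎)
    where open ≤-Reasoning

-- Binomial coefficients near the middle of a row

C-absorption : ∀ n k → suc k * n C suc k + k * n C k ≡ n * n C k
C-absorption zero zero = refl
C-absorption zero (suc k)
  rewrite k>n⇒nCk≡0 {0} {suc k} z<s | k>n⇒nCk≡0 {0} {suc (suc k)} z<s | *-zeroʳ k = refl
C-absorption (suc n) zero = trans (cong (λ u → 1 * u + 0) (nC1≡n (suc n))) (unit (suc n))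
  where
  unit : ∀ x → 1 * x + 0 ≡ x * 1
  unit = solve-∀
C-absorption (suc n) (suc k)
  rewrite sym (nCk+nC[k+1]≡[n+1]C[k+1] n (suc k)) | sym (nCk+nC[k+1]≡[n+1]C[k+1] n k) =
  trans (rearrange k (n C k) (n C suc k) (n C suc (suc k)))
    (trans (cong₂ (λ p q → p + q + (n C k + n C suc k)) (C-absorption n (suc k)) (C-absorption n k))
      (collect n (n C k) (n C suc k)))
  where
  rearrange : ∀ k x y z → (2 + k) * (y + z) + (1 + k) * (x + y)
            ≡ ((2 + k) * z + (1 + k) * y) + ((1 + k) * y + k * x) + (x + y)
  rearrange = solve-∀
  collect : ∀ n x y → n * y + n * x + (x + y) ≡ suc n * (x + y)
  collect = solve-∀

-- Consecutive coefficients have the ratio (n - k)/(k + 1), which `C-absorption` states without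
-- subtraction; it is at most 1 from the middle of the row on.
C-decreasing : ∀ n k → n ≤ suc (k + k) → n C suc k ≤ n C k
C-decreasing n k h = *-cancelˡ-≤ (suc k) (+-cancelʳ-≤ (k * n C k) _ _ (begin
  suc k * n C suc k + k * n C k   ≡⟨ C-absorption n k ⟩
  n * n C k                       ≤⟨ *-monoˡ-≤ (n C k) h ⟩
  suc (k + k) * n C k             ≡⟨ *-distribʳ-+ (n C k) (suc k) k ⟩
  suc k * n C k + k * n C k       ∎))
  where open ≤-Reasoning

central : ℕ → ℕ
central m = suc (m + m) C m

central-max : ∀ m j → suc (m + m) C (j + m) ≤ central m
central-max m zero    = ≤-refl
central-max m (suc j) = ≤-trans
  (C-decreasing (suc (m + m)) (j + m) (s≤s (+-mono-≤ (m≤n+m m j) (m≤n+m m j))))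
  (central-max m j)

-- Applying Pascal's rule twice leads back to row n = 2m + 1. There the two middle coefficients
-- agree, and absorption expresses their lower neighbour through them.
central-suc : ∀ m → (2 + m) * central (suc m) ≡ (6 + 4 * m) * central m
central-suc zero = refl
central-suc (suc k) = begin
  (2 + m) * (suc (suc m + suc m) C suc m)
    ≡⟨ cong (λ i → (2 + m) * (suc (suc i) C suc m)) (+-suc m m) ⟩
  (2 + m) * (suc (suc n) C suc m)
    ≡⟨ cong ((2 + m) *_) (nCk+nC[k+1]≡[n+1]C[k+1] (suc n) m) ⟨
  (2 + m) * (suc n C m + suc n C suc m)
    ≡⟨ cong₂ (λ u v → (2 + m) * (u + v)) (nCk+nC[k+1]≡[n+1]C[k+1] n k)
      (nCk+nC[k+1]≡[n+1]C[k+1] n m) ⟨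
  (2 + m) * ((n C k + n C m) + (n C m + n C suc m))
    ≡⟨ cong (λ u → (2 + m) * ((n C k + n C m) + (n C m + u))) upper ⟩
  (2 + m) * ((n C k + n C m) + (n C m + n C m)) ≡⟨ expand m (n C k) (n C m) ⟩
  (2 + m) * n C k + 3 * (2 + m) * n C m     ≡⟨ cong (_+ 3 * (2 + m) * n C m) lower ⟩
  m * n C m + 3 * (2 + m) * n C m           ≡⟨ collect m (n C m) ⟩
  (6 + 4 * m) * n C m                       ∎
  where
  open ≡-Reasoning
  m n : ℕ
  m = suc k
  n = suc (m + m)
  upper : n C suc m ≡ n C m
  upper = *-cancelˡ-≡ _ _ (suc m) (+-cancelʳ-≡ (m * n C m) _ _
    (trans (C-absorption n m) (*-distribʳ-+ (n C m) (suc m) m)))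
  lower : (2 + m) * n C k ≡ m * n C m
  lower = sym (+-cancelʳ-≡ (k * n C k) _ _ (trans (C-absorption n k) (regroup k (n C k))))
    where
    regroup : ∀ k x → suc (suc k + suc k) * x ≡ (3 + k) * x + k * x
    regroup = solve-∀
  expand : ∀ m x y → (2 + m) * ((x + y) + (y + y)) ≡ (2 + m) * x + 3 * (2 + m) * y
  expand = solve-∀
  collect : ∀ m y → m * y + 3 * (2 + m) * y ≡ (6 + 4 * m) * y
  collect = solve-∀

-- The estimate that `central m` is O(4^m / √m), squared to avoid the root. By `central-suc` the
-- induction step asks for (4m + 6)²(m + 3) ≤ 16(m + 2)³; the difference of the two sides is 12m +
-- 20, the summand added below. For m = 0 both sides of the bound are 2.
central-bound : ∀ m → central m * central m * (2 + m) ≤ 2 * 16 ^ m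
central-bound zero = ≤-refl
central-bound (suc m) = *-cancelˡ-≤ ((2 + m) * (2 + m)) (begin
  (2 + m) * (2 + m) * (c′ * c′ * (3 + m))            ≡⟨ regroup m c′ ⟩
  ((2 + m) * c′) * ((2 + m) * c′) * (3 + m)
    ≡⟨ cong (λ u → u * u * (3 + m)) (central-suc m) ⟩
  ((6 + 4 * m) * c) * ((6 + 4 * m) * c) * (3 + m)    ≤⟨ m≤m+n _ ((20 + 12 * m) * (c * c)) ⟩
  ((6 + 4 * m) * c) * ((6 + 4 * m) * c) * (3 + m) + (20 + 12 * m) * (c * c) ≡⟨ cube m c ⟩
  16 * ((2 + m) * (2 + m)) * (c * c * (2 + m))
    ≤⟨ *-monoʳ-≤ (16 * ((2 + m) * (2 + m))) (central-bound m) ⟩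
  16 * ((2 + m) * (2 + m)) * (2 * 16 ^ m)            ≡⟨ power ((2 + m) * (2 + m)) (16 ^ m) ⟩
  (2 + m) * (2 + m) * (2 * (16 * 16 ^ m))            ∎)
  where
  open ≤-Reasoning
  c c′ : ℕ
  c = central m
  c′ = central (suc m)
  regroup : ∀ m x → (2 + m) * (2 + m) * (x * x * (3 + m)) ≡ ((2 + m) * x) * ((2 + m) * x) * (3 + m)
  regroup = solve-∀
  cube : ∀ m x → ((6 + 4 * m) * x) * ((6 + 4 * m) * x) * (3 + m) + (20 + 12 * m) * (x * x)
       ≡ 16 * ((2 + m) * (2 + m)) * (x * x * (2 + m))
  cube = solve-∀
  power : ∀ p q → 16 * p * (2 * q) ≡ p * (2 * (16 * q))
  power = solve-∀

-- Numbers of monomials around half the dimension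

monomials-suc : ∀ n D → monomials n (suc D) ≡ monomials n D + n C suc D
monomials-suc zero zero = refl
monomials-suc zero (suc D) = refl
monomials-suc (suc n) zero = trans (cong (_+ 1) (monomials-suc n 0))
  (trans (+-comm (1 + n C 1) 1) (cong suc (nCk+nC[k+1]≡[n+1]C[k+1] n 0)))
monomials-suc (suc n) (suc D) = trans (cong₂ _+_ (monomials-suc n (suc D)) (monomials-suc n D))
  (trans (rearrange (monomials n (suc D)) (monomials n D) (n C suc D) (n C suc (suc D)))
    (cong (monomials n (suc D) + monomials n D +_) (nCk+nC[k+1]≡[n+1]C[k+1] n (suc D))))
  where
  rearrange : ∀ p q x y → p + y + (q + x) ≡ p + q + (x + y)
  rearrange = solve-∀

monomials-full : ∀ {n D} → n ≤ D → monomials n D ≡ 2 ^ n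
monomials-full {zero}  {zero}  _ = refl
monomials-full {zero}  {suc D} _ = refl
monomials-full {suc n} {suc D} (s≤s n≤D) =
  cong₂ _+_ (monomials-full (m≤n⇒m≤1+n n≤D)) (trans (monomials-full n≤D) (sym (+-identityʳ _)))

monomials-all-but-one : ∀ n → suc (monomials (suc n) n) ≡ 2 ^ suc n
monomials-all-but-one zero    = refl
monomials-all-but-one (suc n) = trans (sym (+-suc (monomials (suc n) (suc n)) _))
  (cong₂ _+_ (monomials-full {suc n} ≤-refl)
    (trans (monomials-all-but-one n) (sym (+-identityʳ _))))

-- Among n = D + E + 1 variables, complementing the set of variables exchanges the monomials of
-- degree above D with those of degree at most E.
monomials-complement : ∀ D E → monomials (suc (D + E)) D + monomials (suc (D + E)) E ≡ 2 ^ suc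
  (D + E)
monomials-complement zero E = monomials-all-but-one E
monomials-complement (suc D) zero rewrite +-identityʳ D =
  trans (+-comm (monomials (suc (suc D)) (suc D)) 1) (monomials-all-but-one (suc D))
monomials-complement (suc D) (suc E) = begin
  (M (suc D) + M D) + (M (suc E) + M E)    ≡⟨ rearrange (M (suc D)) (M D) (M (suc E)) (M E) ⟩
  (M D + M (suc E)) + (M (suc D) + M E)    ≡⟨ cong₂ _+_ (monomials-complement D (suc E)) ih ⟩
  2 ^ suc (D + suc E) + 2 ^ suc (D + suc E) ≡⟨ cong (2 ^ suc (D + suc E) +_) (+-identityʳ _) ⟨
  2 ^ suc (suc (D + suc E))                ∎
  where
  open ≡-Reasoning
  M : ℕ → ℕ
  M = monomials (suc (D + suc E))
  ih : M (suc D) + M E ≡ 2 ^ suc (D + suc E)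
  ih rewrite +-suc D E = monomials-complement (suc D) E
  rearrange : ∀ p q r s → p + q + (r + s) ≡ q + r + (p + s)
  rearrange = solve-∀

monomials-half : ∀ m → monomials (suc (m + m)) m ≡ 2 ^ (m + m)
monomials-half m = *-cancelˡ-≡ _ _ 2
  (trans (cong (monomials (suc (m + m)) m +_) (+-identityʳ _)) (monomials-complement m m))

-- The monomials of degree at most m are exactly half of all, and each of the D further degrees adds
-- one binomial coefficient, which the central one bounds.
monomials-near-half : ∀ m D → monomials (suc (m + m)) (D + m) ≤ 2 ^ (m + m) + D * central m
monomials-near-half m zero    = ≤-reflexive (trans (monomials-half m) (sym (+-identityʳ _)))
monomials-near-half m (suc D) = begin
  monomials n (suc (D + m))                       ≡⟨ monomials-suc n (D + m) ⟩
  monomials n (D + m) + n C suc (D + m)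
    ≤⟨ +-mono-≤ (monomials-near-half m D) (central-max m (suc D)) ⟩
  2 ^ (m + m) + D * central m + central m
    ≡⟨ rearrange (2 ^ (m + m)) (D * central m) (central m) ⟩
  2 ^ (m + m) + (central m + D * central m)       ∎
  where
  open ≤-Reasoning
  n : ℕ
  n = suc (m + m)
  rearrange : ∀ p q r → p + q + r ≡ p + (r + q)
  rearrange = solve-∀

square-cancel-≤ : ∀ {m n} → m * m ≤ n * n → m ≤ n
square-cancel-≤ h = ≮⇒≥ λ n<m → <⇒≱ (*-mono-< n<m n<m) h

16^m≡[2^2m]² : ∀ m → 16 ^ m ≡ 2 ^ (m + m) * 2 ^ (m + m)
16^m≡[2^2m]² m = begin
  16 ^ m                      ≡⟨ ^-*-assoc 2 4 m ⟩
  2 ^ (4 * m)                 ≡⟨ cong (2 ^_) (double m) ⟩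
  2 ^ ((m + m) + (m + m))     ≡⟨ ^-distribˡ-+-* 2 (m + m) (m + m) ⟩
  2 ^ (m + m) * 2 ^ (m + m)   ∎
  where
  open ≡-Reasoning
  double : ∀ m → 4 * m ≡ (m + m) + (m + m)
  double = solve-∀

-- After squaring, the 4 becomes 16, and `central-bound` contributes another factor 2; together they
-- are the 32 of the hypothesis, and D² is paid for by 2 + m.
few-middle-monomials : ∀ m D → 32 * (D * D) ≤ 2 + m → 4 * (D * central m) ≤ 2 ^ (m + m)
few-middle-monomials m D h = square-cancel-≤ (*-cancelʳ-≤ _ _ (2 + m) (begin
  4 * (D * c) * (4 * (D * c)) * (2 + m)   ≡⟨ regroup D c (2 + m) ⟩
  16 * (D * D) * (c * c * (2 + m))        ≤⟨ *-monoʳ-≤ (16 * (D * D)) (central-bound m) ⟩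
  16 * (D * D) * (2 * 16 ^ m)             ≡⟨ regroup′ (D * D) (16 ^ m) ⟩
  16 ^ m * (32 * (D * D))                 ≤⟨ *-monoʳ-≤ (16 ^ m) h ⟩
  16 ^ m * (2 + m)                        ≡⟨ cong (_* (2 + m)) (16^m≡[2^2m]² m) ⟩
  2 ^ (m + m) * 2 ^ (m + m) * (2 + m)     ∎))
  where
  open ≤-Reasoning
  c : ℕ
  c = central m
  regroup : ∀ d x y → 4 * (d * x) * (4 * (d * x)) * y ≡ 16 * (d * d) * (x * x * y)
  regroup = solve-∀
  regroup′ : ∀ d x → 16 * d * (2 * x) ≡ x * (32 * d)
  regroup′ = solve-∀

-- Let H = 2^(2m) be half of the cube. The points where P is right number at most H + H/4, and the
-- exceptions at most H/4, which falls short of the 2H points in total. The factor 8 clears the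
-- denominators.
majority-not-approximable : ∀ m D P (bad : Cube (suc (m + m)) → Bool) → 32 * (D * D) ≤ 2 + m →
  Deg (suc (m + m)) D P →
  (∀ x → bad x ≡ false → P x ≡ (∣ x ∣ ≤ᵇ m)) →
  ¬ (8 * points (suc (m + m)) bad ≤ 2 ^ suc (m + m))
majority-not-approximable m D P bad small dP correct few =
  <⇒≱ (*-monoˡ-< H {{m^n≢0 2 (m + m)}} {12} {16} (s≤s (m≤m+n 12 3))) (begin
    16 * H                                   ≡⟨ double 8 H ⟩
    8 * 2 ^ n                                ≤⟨ *-monoʳ-≤ 8 cover ⟩
    8 * (H + D * c + points n bad)           ≡⟨ expand H (D * c) (points n bad) ⟩
    8 * H + 2 * (4 * (D * c)) + 8 * points n bad
      ≤⟨ +-mono-≤ (+-monoʳ-≤ (8 * H) (*-monoʳ-≤ 2 (few-middle-monomials m D small))) few ⟩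
    8 * H + 2 * H + 2 * H                    ≡⟨ collect H ⟩
    12 * H                                   ∎)
  where
  open ≤-Reasoning
  n H c : ℕ
  n = suc (m + m)
  H = 2 ^ (m + m)
  c = central m
  good : Cube n → Bool
  good = not ∘ bad
  correct′ : ∀ x → good x ≡ true → P x ≡ (∣ x ∣ ≤ᵇ m)
  correct′ x g = correct x (trans (sym (not-involutive (bad x))) (cong not g))
  either : ∀ x → true ≡ true → good x ≡ true ⊎ bad x ≡ true
  either x _ with bad x
  ... | true  = inj₂ refl
  ... | false = inj₁ refl
  cover : 2 ^ n ≤ H + D * c + points n bad
  cover = begin
    2 ^ n                            ≡⟨ points-true n ⟨
    points n (λ _ → true)            ≤⟨ points-∨ n either ⟩
    points n good + points n bad
      ≤⟨ +-monoˡ-≤ _ (majority-approximation m D P good dP correct′) ⟩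
    monomials n (D + m) + points n bad ≤⟨ +-monoˡ-≤ _ (monomials-near-half m D) ⟩
    H + D * c + points n bad         ∎
  double : ∀ k x → (k + k) * x ≡ k * (2 * x)
  double = solve-∀
  expand : ∀ x y z → 8 * (x + y + z) ≡ 8 * x + 2 * (4 * y) + 8 * z
  expand = solve-∀
  collect : ∀ x → 8 * x + 2 * x + 2 * x ≡ 12 * x
  collect = solve-∀

-- Approximating bounded-depth circuits

any : ∀ {n} → List (Cube n → Bool) → Cube n → Bool
any fs x = or (List.map (λ f → f x) fs)

-- Here h⁺ is the candidate, either h or h + f. Where f is 1 the OR is 1 as well, and the first
-- bound applies; where f is 0 the candidate equals h, and the bound for the shorter list applies.
-- The two regions partition the points of B at which the OR is 1.
halve-cases : ∀ n (B f q h h⁺ : Cube n → Bool) → (∀ x → f x ≡ false → h⁺ x ≡ h x) →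
  2 * points n (λ x → (B x ∧ f x) ∧ not (h⁺ x)) ≤ points n (λ x → B x ∧ f x) →
  2 * points n (λ x → (B x ∧ not (f x)) ∧ q x ∧ not (h x))
    ≤ points n (λ x → (B x ∧ not (f x)) ∧ q x) →
  2 * points n (λ x → B x ∧ (f x ∨ q x) ∧ not (h⁺ x)) ≤ points n (λ x → B x ∧ (f x ∨ q x))
halve-cases n B f q h h⁺ same half₁ half₀ = begin
  2 * points n (λ x → B x ∧ (f x ∨ q x) ∧ not (h⁺ x)) ≤⟨ *-monoʳ-≤ 2 (points-∨ n cases) ⟩
  2 * (points n V₁ + points n V₀)                  ≡⟨ *-distribˡ-+ 2 (points n V₁) _ ⟩
  2 * points n V₁ + 2 * points n V₀                ≤⟨ +-mono-≤ half₁ half₀ ⟩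
  points n (λ x → B x ∧ f x) + points n (λ x → (B x ∧ not (f x)) ∧ q x)
    ≤⟨ +-mono-≤ (points-mono n λ x → inside₁ (B x) (f x) (q x))
      (points-mono n λ x → inside₀ (B x) (f x) (q x)) ⟩
  points n (λ x → W x ∧ f x) + points n (λ x → W x ∧ not (f x)) ≡⟨ points-split n W f ⟩
  points n W                                       ∎
  where
  open ≤-Reasoning
  V₀ V₁ W : Cube n → Bool
  V₀ x = (B x ∧ not (f x)) ∧ q x ∧ not (h x)
  V₁ x = (B x ∧ f x) ∧ not (h⁺ x)
  W x  = B x ∧ (f x ∨ q x)
  cases : ∀ x → B x ∧ (f x ∨ q x) ∧ not (h⁺ x) ≡ true → V₁ x ≡ true ⊎ V₀ x ≡ true
  cases x eq with B x | f x | same x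
  ... | true | true  | _  = inj₁ eq
  ... | true | false | eq′ = inj₂ (trans (cong (λ b → q x ∧ not b) (sym (eq′ refl))) eq)
  inside₁ : ∀ b p q → b ∧ p ≡ true → (b ∧ (p ∨ q)) ∧ p ≡ true
  inside₁ true true q _ = refl
  inside₀ : ∀ b p q → (b ∧ not p) ∧ q ≡ true → (b ∧ (p ∨ q)) ∧ not p ≡ true
  inside₀ true false true _ = refl

∨-introˡ : ∀ {p} q → p ≡ true → p ∨ q ≡ true
∨-introˡ q refl = refl

∨-introʳ : ∀ p {q} → q ≡ true → p ∨ q ≡ true
∨-introʳ false eq = eq
∨-introʳ true  eq = refl

-- Where f vanishes, a good combination h of the remaining functions is left
-- alone by adding f; where f is 1, adding f complements h, and one of h and
-- h + f is right on at least half of the points.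
halve : ∀ n D fs → All (Deg n D) fs → (B : Cube n → Bool) →
  ∃[ h ] Deg n D h × (∀ x → h x ≡ true → any fs x ≡ true) ×
    2 * points n (λ x → B x ∧ any fs x ∧ not (h x)) ≤ points n (λ x → B x ∧ any fs x)
halve n D [] [] B = (λ _ → false) , Deg-const n D false , (λ _ ()) ,
  ≤-trans (≤-reflexive (cong (2 *_) (points-false n λ x → ∧-zeroʳ (B x)))) z≤n
halve n D (f ∷ fs) (df ∷ dfs) B
  with h , dh , h⇒any , half ← halve n D fs dfs (λ x → B x ∧ not (f x))
  with 2 * points n (λ x → (B x ∧ f x) ∧ not (h x)) ≤? points n (λ x → B x ∧ f x)
... | yes keep = h , dh , (λ x hx → ∨-introʳ (f x) (h⇒any x hx)) ,
  halve-cases n B f (any fs) h h (λ _ _ → refl) keep half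
... | no ¬keep = (λ x → h x xor f x) , Deg-xor n D dh df ,
  (λ x → implied x (h⇒any x)) ,
  halve-cases n B f (any fs) h (λ x → h x xor f x)
    (λ x fx → trans (cong (h x xor_) fx) (xor-identityʳ (h x)))
    (≤-trans (*-monoʳ-≤ 2 (points-mono n λ x → flipped (B x) (f x) (h x)))
      (less-half {points n (λ x → (B x ∧ f x) ∧ h x)} (points-split n (λ x → B x ∧ f x) h)
        (≰⇒> ¬keep))) half
  where
  implied : ∀ x → (h x ≡ true → any fs x ≡ true) → h x xor f x ≡ true → f x ∨ any fs x ≡ true
  implied x imp eq with h x | f x
  ... | _    | true  = refl
  ... | true | false = imp refl
  flipped : ∀ b p q → (b ∧ p) ∧ not (q xor p) ≡ true → (b ∧ p) ∧ q ≡ true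
  flipped true true true _ = refl
  less-half : ∀ {k l m} → k + l ≡ m → m < 2 * l → 2 * k ≤ m
  less-half {k} {l} refl h = +-monoʳ-≤ k (≤-trans (≤-reflexive (+-identityʳ k))
    (<⇒≤ (+-cancelʳ-< l k l (≤-trans h (≤-reflexive (cong (l +_) (+-identityʳ l)))))))

-- Taking for B in `halve` the set where g is still 0 makes each new sum work on the points missed
-- so far, so their number halves. The error stays one-sided: g never exceeds the OR.
amplify : ∀ n D fs → All (Deg n D) fs → ∀ l →
  ∃[ g ] Deg n (l * D) g × (∀ x → g x ≡ true → any fs x ≡ true) ×
    2 ^ l * points n (λ x → not (g x) ∧ any fs x) ≤ 2 ^ n
amplify n D fs dfs zero = (λ _ → false) , Deg-const n 0 false , (λ _ ()) ,
  ≤-trans (≤-reflexive (+-identityʳ _))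
    (≤-trans (points-mono n (λ _ _ → refl)) (≤-reflexive (points-true n)))
amplify n D fs dfs (suc l)
  with g , dg , g⇒any , few ← amplify n D fs dfs l
  with h , dh , h⇒any , half ← halve n D fs dfs (not ∘ g) =
  (λ x → not (not (h x) ∧ not (g x))) ,
  Deg-not n _ (Deg-∧ n D (l * D) (Deg-not n D dh) (Deg-not n _ dg)) ,
  (λ x → either x (h⇒any x) (g⇒any x)) , (begin
    2 ^ suc l * points n (λ x → not (not (not (h x) ∧ not (g x))) ∧ any fs x)
      ≤⟨ *-monoʳ-≤ (2 ^ suc l) (points-mono n λ x → shuffle (h x) (g x) (any fs x)) ⟩
    2 ^ suc l * points n (λ x → not (g x) ∧ any fs x ∧ not (h x))
      ≡⟨ regroup (2 ^ l) _ ⟩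
    2 ^ l * (2 * points n (λ x → not (g x) ∧ any fs x ∧ not (h x)))
      ≤⟨ *-monoʳ-≤ (2 ^ l) half ⟩
    2 ^ l * points n (λ x → not (g x) ∧ any fs x)
      ≤⟨ few ⟩
    2 ^ n ∎)
  where
  open ≤-Reasoning
  regroup : ∀ p q → 2 * p * q ≡ p * (2 * q)
  regroup = solve-∀
  either : ∀ x → (h x ≡ true → any fs x ≡ true) → (g x ≡ true → any fs x ≡ true) →
           not (not (h x) ∧ not (g x)) ≡ true → any fs x ≡ true
  either x imp imp′ eq with h x | g x
  ... | true  | _    = imp refl
  ... | false | true = imp′ refl
  shuffle : ∀ p q r → not (not (not p ∧ not q)) ∧ r ≡ true → not q ∧ r ∧ not p ≡ true
  shuffle false false true _ = refl

-- The parameter w measures the error in units of a 2⁻ˡ fraction of the cube.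
record Approximates (n D l w : ℕ) (f : Cube n → Bool) : Set where
  field
    approximant  : Cube n → Bool
    degree       : Deg n D approximant
    exceptions   : Cube n → Bool
    few          : 2 ^ l * points n exceptions ≤ w * 2 ^ n
    agreement    : ∀ x → exceptions x ≡ false → approximant x ≡ f x

approximate-or : ∀ n D fs → All (Deg n D) fs → ∀ l → Approximates n (l * D) l 1 (any fs)
approximate-or n D fs dfs l with g , dg , g⇒any , few ← amplify n D fs dfs l = record
  { approximant = g
  ; degree      = dg
  ; exceptions  = λ x → not (g x) ∧ any fs x
  ; few         = ≤-trans few (≤-reflexive (sym (+-identityʳ _)))
  ; agreement   = λ x → agree x (g⇒any x)
  }
  where
  agree : ∀ x → (g x ≡ true → any fs x ≡ true) → not (g x) ∧ any fs x ≡ false → g x ≡ any fs x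
  agree x imp eq with g x
  ... | true  = sym (imp refl)
  ... | false = sym eq

approximate-and : ∀ n D fs → All (Deg n D) fs → ∀ l →
  Approximates n (l * D) l 1 (λ x → and (List.map (λ f → f x) fs))
approximate-and n D fs dfs l = record
  { approximant = not ∘ approximant
  ; degree      = Deg-not n _ degree
  ; exceptions  = exceptions
  ; few         = few
  ; agreement   = λ x ok → trans (cong not (agreement x ok)) (de-morgan x fs)
  }
  where
  open Approximates (approximate-or n D (List.map (not ∘_) fs)
    (All.map⁺ (All.map (Deg-not n D) dfs)) l)
  de-morgan : ∀ x fs → not (any (List.map (not ∘_) fs) x) ≡ and (List.map (λ f → f x) fs)
  de-morgan x []       = refl
  de-morgan x (f ∷ fs) with f x
  ... | true  = de-morgan x fs
  ... | false = refl

sources-depth : ∀ {B N M} → Gates B N M → List (Fin M) → ℕ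
sources-depth gs js = List.foldr _⊔_ 0 (List.map (lookup (depths gs)) js)

-- The degree is bounded node by node, because the depth of a circuit is that of its output and
-- other nodes may lie deeper; the exceptional set is common to all nodes. The map ι presents a
-- point of the cube as an input string of the circuit.
record ApproximatesNodes (n l : ℕ) {N M : ℕ} (gs : Gates boolean N M)
  (ι : Cube n → Vec Bool N) : Set where
  field
    approximant : Fin M → Cube n → Bool
    degree      : ∀ j → Deg n (l ^ lookup (depths gs) j) (approximant j)
    exceptions  : Cube n → Bool
    few         : 2 ^ l * points n exceptions ≤ gatesSize gs * 2 ^ n
    agreement   : ∀ x → exceptions x ≡ false → ∀ j → approximant j x ≡ lookup (values gs (ι x)) j

module _ (n l : ℕ) .{{_ : NonZero l}} {N : ℕ} (ι : Cube n → Vec Bool N) where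

  extend-by-gate : ∀ {M} (gs : Gates boolean N M) (g : Gate boolean M)
    (A : ApproximatesNodes n l gs ι) →
    let open ApproximatesNodes A in ∀ {f : Cube n → Bool} →
    Approximates n (l * l ^ sources-depth gs (sources g)) l 1 f →
    (∀ x → (∀ j → approximant j x ≡ lookup (values gs (ι x)) j) →
      f x ≡ evalGate (values gs (ι x)) g) →
    ApproximatesNodes n l (gs ▸ g) ι
  extend-by-gate gs g A F f≡g = record
    { approximant = λ { zero → F.approximant ; (suc j) → A.approximant j }
    ; degree      = λ { zero → F.degree ; (suc j) → A.degree j }
    ; exceptions  = λ x → A.exceptions x ∨ F.exceptions x
    ; few         = begin
        2 ^ l * points n (λ x → A.exceptions x ∨ F.exceptions x)
          ≤⟨ *-monoʳ-≤ (2 ^ l) (points-∨ n λ x → ∨-elim (A.exceptions x) (F.exceptions x)) ⟩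
        2 ^ l * (points n A.exceptions + points n F.exceptions)
          ≡⟨ *-distribˡ-+ (2 ^ l) (points n A.exceptions) _ ⟩
        2 ^ l * points n A.exceptions + 2 ^ l * points n F.exceptions
          ≤⟨ +-mono-≤ A.few F.few ⟩
        gatesSize gs * 2 ^ n + 1 * 2 ^ n
          ≡⟨ *-distribʳ-+ (2 ^ n) (gatesSize gs) 1 ⟨
        (gatesSize gs + 1) * 2 ^ n
          ≡⟨ cong (_* 2 ^ n) (+-comm (gatesSize gs) 1) ⟩
        suc (gatesSize gs) * 2 ^ n
          ≤⟨ *-monoˡ-≤ (2 ^ n) (s≤s (m≤n+m (gatesSize gs) (List.length (sources g)))) ⟩
        gatesSize (gs ▸ g) * 2 ^ n ∎
    ; agreement   = λ x ok →
        let ok-A = ∨-conicalˡ (A.exceptions x) (F.exceptions x) ok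
            ok-F = ∨-conicalʳ (A.exceptions x) (F.exceptions x) ok
            correct = A.agreement x ok-A
        in λ { zero → trans (F.agreement x ok-F) (f≡g x correct) ; (suc j) → correct j }
    }
    where
    open ≤-Reasoning
    module A = ApproximatesNodes A
    module F = Approximates F
    ∨-elim : ∀ p q → p ∨ q ≡ true → p ≡ true ⊎ q ≡ true
    ∨-elim true  q eq = inj₁ refl
    ∨-elim false q eq = inj₂ eq

  approximate-nodes : (∀ i → Deg n 1 (λ x → lookup (ι x) i)) →
    ∀ {M} (gs : Gates boolean N M) → ApproximatesNodes n l gs ι
  approximate-nodes dι inputs = record
    { approximant = λ j x → lookup (ι x) j
    ; degree      = λ j → subst (λ k → Deg n (l ^ k) (λ x → lookup (ι x) j))
      (sym (Vec.lookup-replicate j 0)) (dι j)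
    ; exceptions  = λ _ → false
    ; few         = ≤-reflexive
      (trans (cong (2 ^ l *_) (points-false n λ _ → refl)) (*-zeroʳ (2 ^ l)))
    ; agreement   = λ _ _ _ → refl
    }
  approximate-nodes dι (gs ▸ g) = step g
    where
    A : ApproximatesNodes n l gs ι
    A = approximate-nodes dι gs
    module A = ApproximatesNodes A
    exponents : ∀ js → All (λ j → lookup (depths gs) j ≤ sources-depth gs js) js
    exponents []       = []
    exponents (j ∷ js) = m≤m⊔n _ _ ∷ All.map (λ h → ≤-trans h (m≤n⊔m _ _)) (exponents js)
    degrees : ∀ js → All (Deg n (l ^ sources-depth gs js)) (List.map A.approximant js)
    degrees js = All.map⁺
      (All.map (λ {j} h → Deg-mono n (^-monoʳ-≤ l h) (A.degree j)) (exponents js))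
    values-agree : ∀ x → (∀ j → A.approximant j x ≡ lookup (values gs (ι x)) j) → ∀ js →
      List.map (λ f → f x) (List.map A.approximant js) ≡ List.map (lookup (values gs (ι x))) js
    values-agree x eq js = trans (sym (List.map-∘ js)) (List.map-cong eq js)
    step : ∀ g → ApproximatesNodes n l (gs ▸ g) ι
    step g@(neg j) = extend-by-gate gs g A
      (record { approximant = not ∘ A.approximant j
              ; degree = Deg-not n _
                (Deg-mono n (≤-trans (^-monoʳ-≤ l (m≤m⊔n (lookup (depths gs) j) 0)) (m≤n*m _ l))
                (A.degree j))
              ; exceptions = λ _ → false
              ; few = ≤-trans (≤-reflexive
                (trans (cong (2 ^ l *_) (points-false n λ _ → refl)) (*-zeroʳ (2 ^ l)))) z≤n
              ; agreement = λ _ _ → refl })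
      (λ x eq → cong not (eq j))
    step g@(conj js) = extend-by-gate gs g A (approximate-and n _ _ (degrees js) l)
      (λ x eq → cong and (values-agree x eq js))
    step g@(disj js) = extend-by-gate gs g A (approximate-or n _ _ (degrees js) l)
      (λ x eq → cong or (values-agree x eq js))

-- Parameters of the lower bound

n<2^n : ∀ n → n < 2 ^ n
n<2^n zero    = s≤s z≤n
n<2^n (suc n) = begin-strict
  suc n           ≤⟨ n<2^n n ⟩
  2 ^ n           <⟨ m<m+n (2 ^ n) (m^n>0 2 n) ⟩
  2 ^ n + 2 ^ n   ≡⟨ cong (2 ^ n +_) (+-identityʳ _) ⟨
  2 ^ suc n       ∎
  where open ≤-Reasoning

-- With v = 2p + q the exponent 2v gives 2^(2v) ≥ (v + 1)², whose leading term v² already contains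
-- the 2pv on the left.
linear≤exponential : ∀ p q → ∃[ w ] p * w + q ≤ 2 ^ w
linear≤exponential p q = v + v , (begin
  p * (v + v) + q         ≤⟨ m≤m+n _ (2 * p + q * v + v + 1) ⟩
  p * (v + v) + q + (2 * p + q * v + v + 1) ≡⟨ square p q ⟩
  suc v * suc v           ≤⟨ *-mono-≤ (n<2^n v) (n<2^n v) ⟩
  2 ^ v * 2 ^ v           ≡⟨ ^-distribˡ-+-* 2 v v ⟨
  2 ^ (v + v)             ∎)
  where
  open ≤-Reasoning
  v : ℕ
  v = 2 * p + q
  square : ∀ p q → p * ((2 * p + q) + (2 * p + q)) + q + (2 * p + q * (2 * p + q) + (2 * p + q) + 1)
         ≡ suc (2 * p + q) * suc (2 * p + q)
  square = solve-∀

-- For m = 2^t and N ≤ 2^(4 + t), the error bound asks for 8(N^c + c) ≤ 2^l, which l = 4 + (4 + t)c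
-- achieves, and the degree bound asks for 32 l^(2d) ≤ 2 + 2^t, which t = 5 + 2dw achieves as soon
-- as l ≤ 2^w. Substituting t makes l linear in w, so a large enough w breaks the circle.
module Parameters (d c : ℕ) where

  private
    w : ℕ
    w = proj₁ (linear≤exponential (d * 2 * c) (9 * c + 4))

  t l : ℕ
  t = 5 + d * 2 * w
  l = 4 + (4 + t) * c

  l≤2^w : l ≤ 2 ^ w
  l≤2^w = ≤-trans (≤-reflexive (linear d c w)) (proj₂ (linear≤exponential (d * 2 * c) (9 * c + 4)))
    where
    linear : ∀ d c w → 4 + (4 + (5 + d * 2 * w)) * c ≡ d * 2 * c * w + (9 * c + 4)
    linear = solve-∀

  degree-small : 32 * (l ^ d * l ^ d) ≤ 2 + 2 ^ t
  degree-small = begin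
    32 * (l ^ d * l ^ d)
      ≤⟨ *-monoʳ-≤ 32 (*-mono-≤ (^-monoˡ-≤ d l≤2^w) (^-monoˡ-≤ d l≤2^w)) ⟩
    2 ^ 5 * ((2 ^ w) ^ d * (2 ^ w) ^ d) ≡⟨ cong (λ u → 32 * (u * u)) (^-*-assoc 2 w d) ⟩
    2 ^ 5 * (2 ^ (w * d) * 2 ^ (w * d)) ≡⟨ cong (32 *_) (^-distribˡ-+-* 2 (w * d) (w * d)) ⟨
    2 ^ 5 * 2 ^ (w * d + w * d)         ≡⟨ ^-distribˡ-+-* 2 5 (w * d + w * d) ⟨
    2 ^ (5 + (w * d + w * d))           ≡⟨ cong (λ u → 2 ^ (5 + u)) (twice w d) ⟩
    2 ^ t                               ≤⟨ m≤n+m (2 ^ t) 2 ⟩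
    2 + 2 ^ t                           ∎
    where
    open ≤-Reasoning
    twice : ∀ w d → w * d + w * d ≡ d * 2 * w
    twice = solve-∀

  size-small : ∀ {N} → N ≤ 2 ^ (4 + t) → 8 * (N ^ c + c) ≤ 2 ^ l
  size-small {N} h = begin
    8 * (N ^ c + c)
      ≤⟨ *-monoʳ-≤ 8 (+-mono-≤ (^-monoˡ-≤ c h)
        (≤-trans (<⇒≤ (n<2^n c)) (^-monoˡ-≤ c (^-monoʳ-≤ 2 (s≤s (z≤n {3 + t})))))) ⟩
    8 * ((2 ^ (4 + t)) ^ c + (2 ^ (4 + t)) ^ c)
      ≡⟨ cong (λ u → 8 * (u + u)) (^-*-assoc 2 (4 + t) c) ⟩
    8 * (2 ^ ((4 + t) * c) + 2 ^ ((4 + t) * c)) ≡⟨ double (2 ^ ((4 + t) * c)) ⟩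
    2 ^ 4 * 2 ^ ((4 + t) * c) ≡⟨ ^-distribˡ-+-* 2 4 ((4 + t) * c) ⟨
    2 ^ l ∎
    where
    open ≤-Reasoning
    double : ∀ x → 8 * (x + x) ≡ 16 * x
    double = solve-∀

abstract
  -- The bit s covers majority and its negation at once. Since ι has degree at most 1 in each
  -- position, the circuit may read an encoded instance in place of the bare point x.
  majority-hard : ∀ d c → ∃[ t ] let m = 2 ^ t ; n = suc (m + m) in
    ∀ {N} (K : Circuit boolean N) (ι : Cube n → Vec Bool N) →
      (∀ i → Deg n 1 (λ x → lookup (ι x) i)) →
    N ≤ 2 ^ (4 + t) → Circuit.depth K ≤ d → Circuit.size K ≤ N ^ c + c →
    ∀ s → ¬ (∀ x → Circuit.eval K (ι x) ≡ s xor (∣ x ∣ ≤ᵇ m))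
  majority-hard d c = t , λ {N} K ι dι N-small depth-small size≤ s computes →
    let open Circuit K
        open ApproximatesNodes (approximate-nodes n l ι dι gates)
        S = N ^ c + c
    in majority-not-approximable m (l ^ d) (λ x → s xor approximant output x) exceptions degree-small
      (Deg-xor n _ (Deg-const n _ s) (Deg-mono n (^-monoʳ-≤ l depth-small) (degree output)))
      (λ x ok → trans (cong (s xor_) (trans (agreement x ok output) (computes x)))
        (cancel s (∣ x ∣ ≤ᵇ m)))
      (*-cancelˡ-≤ (2 ^ l) {{m^n≢0 2 l}} (begin
        2 ^ l * (8 * points n exceptions)   ≡⟨ regroup (2 ^ l) (points n exceptions) ⟩
        8 * (2 ^ l * points n exceptions)   ≤⟨ *-monoʳ-≤ 8 (≤-trans few (*-monoˡ-≤ (2 ^ n) size≤)) ⟩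
        8 * (S * 2 ^ n)                     ≡⟨ *-assoc 8 S (2 ^ n) ⟨
        8 * S * 2 ^ n                       ≤⟨ *-monoˡ-≤ (2 ^ n) (size-small N-small) ⟩
        2 ^ l * 2 ^ n                       ∎))
    where
    open ≤-Reasoning
    open Parameters d c
    m n : ℕ
    m = 2 ^ t
    n = suc (m + m)
    regroup : ∀ x y → x * (8 * y) ≡ 8 * (x * y)
    regroup = solve-∀
    cancel : ∀ s b → s xor (s xor b) ≡ b
    cancel false b = refl
    cancel true  b = not-involutive b

-- Instances as strings

infixr 6 _⇔∘_
_⇔∘_ : ∀ {P Q R : Set} → P ⇔ Q → Q ⇔ R → P ⇔ R
f ⇔∘ g = mk⇔ (Equivalence.to g ∘ Equivalence.to f) (Equivalence.from f ∘ Equivalence.from g)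

⇔-sym : ∀ {P Q : Set} → P ⇔ Q → Q ⇔ P
⇔-sym f = mk⇔ (Equivalence.from f) (Equivalence.to f)

encode : ∀ {r n} → Structure r n → List Bool → List Bool
encode {n = n} A bs = List.replicate n true List.++ false ∷
  (List.concatMap Vec.toList (Vec.toList A) List.++ bs)

unary-injective : ∀ m n {us vs : List Bool} →
  List.replicate m true List.++ false ∷ us ≡ List.replicate n true List.++ false ∷ vs →
    m ≡ n × us ≡ vs
unary-injective zero    zero    eq = refl , List.∷-injectiveʳ eq
unary-injective (suc m) (suc n) eq =
  map₁ (cong suc) (unary-injective m n (List.∷-injectiveʳ eq))

toList-++-injective : ∀ {X : Set} {n} (u v : Vec X n) {us vs} →
  Vec.toList u List.++ us ≡ Vec.toList v List.++ vs → u ≡ v × us ≡ vs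
toList-++-injective []      []      eq = refl , eq
toList-++-injective (x ∷ u) (y ∷ v) eq =
  map₁ (cong₂ _∷_ (List.∷-injectiveˡ eq)) (toList-++-injective u v (List.∷-injectiveʳ eq))

concat-++-injective : ∀ {X : Set} {r n} (A B : Vec (Vec X n) r) {us vs} →
  List.concatMap Vec.toList (Vec.toList A) List.++ us ≡ List.concatMap Vec.toList
    (Vec.toList B) List.++ vs →
  A ≡ B × us ≡ vs
concat-++-injective []      []      eq = refl , eq
concat-++-injective (u ∷ A) (v ∷ B) {us} {vs} eq
  with refl , eq′ ← toList-++-injective u v
    (trans (sym (List.++-assoc (Vec.toList u) _ us)) (trans eq (List.++-assoc (Vec.toList v) _ vs)))
  with refl , eq″ ← concat-++-injective A B eq′ = refl , eq″

-- The unary header delimits itself and φ fixes r, so a string determines n, then the structure, and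
-- leaves the numeral as the remainder.
problem-encode : ∀ {r n} ⊗ (φ : Sentence r) (A : Structure r n) bs →
  Problem ⊗ φ (encode A bs) ⇔ YesInstance ⊗ φ A (value bs)
problem-encode {n = n} ⊗ φ A bs = mk⇔ to (λ sat → n , A , value bs , (bs , refl , refl) , sat)
  where
  to : Problem ⊗ φ (encode A bs) → YesInstance ⊗ φ A (value bs)
  to (n′ , A′ , _ , (bs′ , refl , eq) , sat)
    with refl , eq′ ← unary-injective n n′ eq
    with refl , refl ← concat-++-injective A A′ eq′ = sat

lookup-△ : ∀ {n} (p q : Subset n) x → lookup (p △ q) x ≡ lookup p x xor lookup q x
lookup-△ (b ∷ p)     (c ∷ q)     (suc x) = lookup-△ p q x
lookup-△ (true  ∷ p) (true  ∷ q) zero    = refl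
lookup-△ (true  ∷ p) (false ∷ q) zero    = refl
lookup-△ (false ∷ p) (true  ∷ q) zero    = refl
lookup-△ (false ∷ p) (false ∷ q) zero    = refl

∈⇔lookup : ∀ {n} {p : Subset n} {x} → x ∈ p ⇔ lookup p x ≡ true
∈⇔lookup = mk⇔ Vec.[]=⇒lookup (Vec.lookup⇒[]= _ _)

-- The hard sentences

-- The quantifiers of the pattern other than one chosen `a` are vacuous. They lengthen the context,
-- hence ψ is given for every number of variables and x is shifted.
padded : ∀ {m} → (∀ m → Fin m → Matrix 1 m) → Pattern → Fin m → Prenex 1 m
padded ψ []      x = matrix (ψ _ x)
padded ψ (Q ∷ q) x = quant Q (padded ψ q (suc x))

universal : ∀ {m} → (∀ m → Fin m → Matrix 1 m) → {p : Pattern} → List.[ a ] ≼ p → Prenex 1 m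
universal ψ (Q ∷ʳ a≼p)             = quant Q (universal ψ a≼p)
universal ψ (_∷_ {ys = q} refl _)  = quant a (padded ψ q zero)

pattern-padded : ∀ {m} ψ q (x : Fin m) → pattern-of (padded ψ q x) ≡ q
pattern-padded ψ []      x = refl
pattern-padded ψ (Q ∷ q) x = cong (Q ∷_) (pattern-padded ψ q (suc x))

pattern-universal : ∀ {m} (ψ : ∀ m → Fin m → Matrix 1 m) {p} (a≼p : List.[ a ] ≼ p) →
                    pattern-of (universal {m} ψ a≼p) ≡ p
pattern-universal ψ (Q ∷ʳ a≼p)            = cong (Q ∷_) (pattern-universal ψ a≼p)
pattern-universal ψ (_∷_ {ys = q} refl _) = cong (a ∷_) (pattern-padded ψ q zero)

-- Vacuous quantifiers preserve truth only over a nonempty universe, which explains `suc n`; the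
-- element `zero` serves both as witness and as instance.
module _ {n : ℕ} (A : Structure 1 (suc n)) (ψ : ∀ m → Fin m → Matrix 1 m) (P : Fin (suc n) → Set)
  (ψ⇔P : ∀ {m} (ρ : Vec (Fin (suc n)) m) x → SatMatrix A ρ (ψ m x) ⇔ P (lookup ρ x)) where

  sat-padded : ∀ {m} (ρ : Vec (Fin (suc n)) m) q x → Sat A ρ (padded ψ q x) ⇔ P (lookup ρ x)
  sat-padded ρ []      x = ψ⇔P ρ x
  sat-padded ρ (a ∷ q) x = mk⇔
    (λ sat → Equivalence.to (sat-padded (zero ∷ ρ) q (suc x)) (sat zero))
    (λ Px y → Equivalence.from (sat-padded (y ∷ ρ) q (suc x)) Px)
  sat-padded ρ (e ∷ q) x = mk⇔
    (λ { (y , sat) → Equivalence.to (sat-padded (y ∷ ρ) q (suc x)) sat })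
    (λ Px → zero , Equivalence.from (sat-padded (zero ∷ ρ) q (suc x)) Px)

  sat-universal : ∀ {m} (ρ : Vec (Fin (suc n)) m) {p} (a≼p : List.[ a ] ≼ p) →
                  Sat A ρ (universal ψ a≼p) ⇔ (∀ x → P x)
  sat-universal ρ (a ∷ʳ a≼p) = mk⇔
    (λ sat → Equivalence.to (sat-universal (zero ∷ ρ) a≼p) (sat zero))
    (λ P x → Equivalence.from (sat-universal (x ∷ ρ) a≼p) P)
  sat-universal ρ (e ∷ʳ a≼p) = mk⇔
    (λ { (y , sat) → Equivalence.to (sat-universal (y ∷ ρ) a≼p) sat })
    (λ P → zero , Equivalence.from (sat-universal (zero ∷ ρ) a≼p) P)
  sat-universal ρ (_∷_ {ys = q} refl _) = mk⇔
    (λ sat x → Equivalence.to (sat-padded (x ∷ ρ) q zero) (sat x))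
    (λ P x → Equivalence.from (sat-padded (x ∷ ρ) q zero) (P x))

hard-literal : Operation → ∀ m → Fin m → Matrix 1 m
hard-literal del  m x = ¬′ rel zero x
hard-literal add  m x = rel zero x
hard-literal edit m x = rel zero x

goal : Operation → Bool
goal del  = false
goal add  = true
goal edit = true

hard-literal-sat : ∀ ⊗ {n m} (A : Structure 1 n) (ρ : Vec (Fin n) m) x →
  SatMatrix A ρ (hard-literal ⊗ m x) ⇔ lookup (lookup A zero) (lookup ρ x) ≡ goal ⊗
hard-literal-sat del  A ρ x = mk⇔
  (λ x∉ → ¬-not (x∉ ∘ Equivalence.from ∈⇔lookup))
  (λ eq x∈ → case trans (sym eq) (Equivalence.to ∈⇔lookup x∈) of λ ())
hard-literal-sat add  A ρ x = ∈⇔lookup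
hard-literal-sat edit A ρ x = ∈⇔lookup

hard-sentence : Operation → ∀ {p} → List.[ a ] ≼ p → Sentence 1
hard-sentence ⊗ = universal (hard-literal ⊗)

defects : Operation → ∀ {n} → Subset n → Subset n
defects del  u = u
defects add  u = ∁ u
defects edit u = ∁ u

lookup-defects : ∀ ⊗ {n} (u : Subset n) x → lookup (defects ⊗ u) x ≡ goal ⊗ xor lookup u x
lookup-defects del  u x = refl
lookup-defects add  u x = Vec.lookup-map x not u
lookup-defects edit u x = Vec.lookup-map x not u

defects-allowed : ∀ ⊗ {n} (u : Subset n) → Allowed ⊗ (u ∷ []) (defects ⊗ u ∷ [])
defects-allowed del  u zero = id
defects-allowed add  u zero = ∩-inverseˡ u
defects-allowed edit u      = tt

-- The sentence prescribes u △ s at every element and so forces s to contain `defects ⊗ u`, which is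
-- itself an allowed solution.
hard-instance : ∀ ⊗ {p} (a≼p : List.[ a ] ≼ p) {n} (u : Subset (suc n)) k →
  YesInstance ⊗ (hard-sentence ⊗ a≼p) (u ∷ []) k ⇔ ∣ defects ⊗ u ∣ ≤ k
hard-instance ⊗ a≼p {n} u k = mk⇔ to from
  where
  sat : ∀ s → ((u ∷ []) ▷ (s ∷ [])) ⊨ hard-sentence ⊗ a≼p ⇔ (∀ x → lookup (u △ s) x ≡ goal ⊗)
  sat s = sat-universal ((u △ s) ∷ []) (hard-literal ⊗) _ (hard-literal-sat ⊗ ((u △ s) ∷ [])) [] a≼p
  solve-xor : ∀ {p q r} → p xor q ≡ r → r xor p ≡ q
  solve-xor {false} {r = r} refl = xor-identityʳ r
  solve-xor {true}  {false} refl = refl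
  solve-xor {true}  {true}  refl = refl
  to : YesInstance ⊗ (hard-sentence ⊗ a≼p) (u ∷ []) k → ∣ defects ⊗ u ∣ ≤ k
  to (s ∷ [] , _ , cost , holds) = ≤-trans
    (p⊆q⇒∣p∣≤∣q∣ {p = defects ⊗ u} {q = s} λ {x} x∈ → Equivalence.from ∈⇔lookup (trans
      (sym (trans (lookup-defects ⊗ u x)
        (solve-xor {lookup u x} (trans (sym (lookup-△ u s x)) (Equivalence.to (sat s) holds x)))))
      (Equivalence.to ∈⇔lookup x∈)))
    (≤-trans (m≤m+n ∣ s ∣ 0) cost)
  from : ∣ defects ⊗ u ∣ ≤ k → YesInstance ⊗ (hard-sentence ⊗ a≼p) (u ∷ []) k
  from cost = defects ⊗ u ∷ [] , defects-allowed ⊗ u , ≤-trans (≤-reflexive (+-identityʳ _)) cost ,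
    Equivalence.from (sat (defects ⊗ u)) λ x →
      trans (lookup-△ u (defects ⊗ u) x)
        (trans (cong (lookup u x xor_) (lookup-defects ⊗ u x)) (cancel (lookup u x) (goal ⊗)))
    where
    cancel : ∀ p q → p xor (q xor p) ≡ q
    cancel false q = xor-identityʳ q
    cancel true false = refl
    cancel true true  = refl

-- On 2m + 1 elements, at most m zeros means more than m ones, so the complement turns the
-- comparison exactly into its negation.
defects-majority : ∀ ⊗ m (u : Subset (suc (m + m))) → ∣ defects ⊗ u ∣ ≤ m ⇔ goal ⊗ xor
  (∣ u ∣ ≤ᵇ m) ≡ true
defects-majority del m u = mk⇔ (λ h → Equivalence.to T-≡ (≤⇒≤ᵇ h))
  (λ eq → ≤ᵇ⇒≤ _ _ (Equivalence.from T-≡ eq))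
defects-majority add m u = mk⇔ to from
  where
  to : ∣ ∁ u ∣ ≤ m → not (∣ u ∣ ≤ᵇ m) ≡ true
  to h with ∣ u ∣ ≤ᵇ m | ≤ᵇ⇒≤ ∣ u ∣ m
  ... | false | _  = refl
  ... | true  | le = contradiction (begin
    suc (m + m)          ≡⟨ m+[n∸m]≡n (≤-trans (le tt) (m≤n⇒m≤1+n (m≤m+n m m))) ⟨
    ∣ u ∣ + (suc (m + m) ∸ ∣ u ∣) ≡⟨ cong (∣ u ∣ +_) (∣∁p∣≡n∸∣p∣ u) ⟨
    ∣ u ∣ + ∣ ∁ u ∣      ≤⟨ +-mono-≤ (le tt) h ⟩
    m + m                ∎) 1+n≰n
    where open ≤-Reasoning
  from : not (∣ u ∣ ≤ᵇ m) ≡ true → ∣ ∁ u ∣ ≤ m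
  from eq with ∣ u ∣ ≤ᵇ m | ≤⇒≤ᵇ {∣ u ∣} {m}
  ... | false | ge = begin
    ∣ ∁ u ∣               ≡⟨ ∣∁p∣≡n∸∣p∣ u ⟩
    suc (m + m) ∸ ∣ u ∣   ≤⟨ ∸-monoʳ-≤ (suc (m + m)) (≰⇒> ge) ⟩
    suc (m + m) ∸ suc m   ≡⟨ m+n∸m≡n m m ⟩
    m                     ∎
    where open ≤-Reasoning
defects-majority edit m u = defects-majority add m u

-- The budget is a power of two so that its numeral is explicit and contributes only t + 1
-- positions.
power-numeral : ∀ t → Vec Bool (suc t)
power-numeral zero    = true ∷ []
power-numeral (suc t) = false ∷ power-numeral t

value-power-numeral : ∀ t → value (Vec.toList (power-numeral t)) ≡ 2 ^ t
value-power-numeral zero    = refl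
value-power-numeral (suc t) = cong (2 *_) (value-power-numeral t)

toList-++ : ∀ {X : Set} {m n} (u : Vec X m) (v : Vec X n) → Vec.toList
  (u Vec.++ v) ≡ Vec.toList u List.++ Vec.toList v
toList-++ []      v = refl
toList-++ (x ∷ u) v = cong (x ∷_) (toList-++ u v)

toList-replicate : ∀ {X : Set} n (x : X) → Vec.toList (Vec.replicate n x) ≡ List.replicate n x
toList-replicate zero    x = refl
toList-replicate (suc n) x = cong (x ∷_) (toList-replicate n x)

Deg-lookup-++ : ∀ n D {p q} (u : Cube n → Vec Bool p) (v : Cube n → Vec Bool q) →
  (∀ i → Deg n D (λ x → lookup (u x) i)) → (∀ i → Deg n D (λ x → lookup (v x) i)) →
  ∀ i → Deg n D (λ x → lookup (u x Vec.++ v x) i)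
Deg-lookup-++ n D {p} u v du dv i = Deg-cong n D
  (λ x → sym (Vec.lookup-splitAt p (u x) (v x) i)) cases
  where
  cases : Deg n D (λ x → [ lookup (u x) , lookup (v x) ]′ (Fin.splitAt p i))
  cases with Fin.splitAt p i
  ... | inj₁ j = du j
  ... | inj₂ j = dv j

module HardInstances (t : ℕ) where

  m n N : ℕ
  m = 2 ^ t
  n = suc (m + m)
  N = n + suc (n + suc t)

  -- Only the characteristic string of the relation depends on x, so each position is a constant or
  -- a coordinate of x.
  input : Cube n → Vec Bool N
  input x = Vec.replicate n true Vec.++ false ∷ (x Vec.++ power-numeral t)

  toList-input : ∀ x → Vec.toList (input x) ≡ encode (x ∷ []) (Vec.toList (power-numeral t))
  toList-input x = trans (toList-++ (Vec.replicate n true) _)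
    (cong₂ (λ us vs → us List.++ false ∷ vs)
    (toList-replicate n true)
    (trans (toList-++ x _) (cong (List._++ _) (sym (List.++-identityʳ (Vec.toList x))))))

  input-linear : ∀ i → Deg n 1 (λ x → lookup (input x) i)
  input-linear = Deg-lookup-++ n 1 (λ _ → Vec.replicate n true)
    (λ x → false ∷ (x Vec.++ power-numeral t))
    (λ i → Deg-const n 1 (lookup (Vec.replicate n true) i))
    λ { zero    → Deg-const n 1 false
      ; (suc i) → Deg-lookup-++ n 1 id (λ _ → power-numeral t) (Deg-lookup n)
                    (λ i → Deg-const n 1 (lookup (power-numeral t) i)) i }

  N-small : N ≤ 2 ^ (4 + t)
  N-small = begin
    N                     ≡⟨ collect m t ⟩
    4 * m + (t + 4)
      ≤⟨ +-monoʳ-≤ (4 * m) (+-mono-≤ (<⇒≤ (n<2^n t)) (*-monoʳ-≤ 4 (m^n>0 2 t))) ⟩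
    4 * m + (m + 4 * m)   ≤⟨ m≤m+n _ (7 * m) ⟩
    4 * m + (m + 4 * m) + 7 * m ≡⟨ total m ⟩
    16 * m                ≡⟨ ^-distribˡ-+-* 2 4 t ⟨
    2 ^ (4 + t)           ∎
    where
    open ≤-Reasoning
    collect : ∀ m t → suc (m + m) + suc (suc (m + m) + suc t) ≡ 4 * m + (t + 4)
    collect = solve-∀
    total : ∀ m → 4 * m + (m + 4 * m) + 7 * m ≡ 16 * m
    total = solve-∀

not-in-AC⁰ : ∀ ⊗ {p} (a≼p : List.[ a ] ≼ p) → ¬ AC⁰ (Problem ⊗ (hard-sentence ⊗ a≼p))
not-in-AC⁰ ⊗ a≼p (d , c , circuits) with t , hard ← majority-hard d c =
  let K , depth≤ , size≤ , correct = circuits N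
  in hard K input input-linear N-small depth≤ size≤ (goal ⊗) λ x →
    ⇔⇒≡ (correct (input x) ⇔∘ answer x)
  where
  open HardInstances t
  ⇔⇒≡ : ∀ {b c} → b ≡ true ⇔ c ≡ true → b ≡ c
  ⇔⇒≡ {false} {false} _ = refl
  ⇔⇒≡ {false} {true}  f = Equivalence.from f refl
  ⇔⇒≡ {true}  {false} f = sym (Equivalence.to f refl)
  ⇔⇒≡ {true}  {true}  _ = refl
  answer : ∀ x → Problem ⊗ (hard-sentence ⊗ a≼p) (Vec.toList (input x)) ⇔ goal ⊗ xor
    (∣ x ∣ ≤ᵇ m) ≡ true
  answer x rewrite toList-input x =
    problem-encode ⊗ (hard-sentence ⊗ a≼p) (x ∷ []) (Vec.toList (power-numeral t)) ⇔∘
    subst (λ k → YesInstance ⊗ (hard-sentence ⊗ a≼p) (x ∷ []) k ⇔ goal ⊗ xor (∣ x ∣ ≤ᵇ m) ≡ true)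
      (sym (value-power-numeral t))
      (hard-instance ⊗ a≼p x m ⇔∘ defects-majority ⊗ m x)

-- Formulas and their circuits

data Connective : Basis → Set where
  AND OR : ∀ {B} → Connective B
  THR    : ℕ → Connective threshold

gate : ∀ {B M} → Connective B → List (Fin M) → Gate B M
gate AND     = conj
gate OR      = disj
gate (THR t) = thr t

ones : List Bool → ℕ
ones bs = List.length (List.filterᵇ id bs)

combine : ∀ {B} → Connective B → List Bool → Bool
combine AND     bs = and bs
combine OR      bs = or bs
combine (THR t) bs = t ≤ᵇ ones bs

evalGate-gate : ∀ {B M} (k : Connective B) (v : Vec Bool M) js →
                evalGate v (gate k js) ≡ combine k (List.map (lookup v) js)
evalGate-gate AND     v js = refl
evalGate-gate OR      v js = refl
evalGate-gate (THR t) v js = refl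

sources-gate : ∀ {B M} (k : Connective B) (js : List (Fin M)) → sources (gate k js) ≡ js
sources-gate AND     js = refl
sources-gate OR      js = refl
sources-gate (THR t) js = refl

-- Trees without sharing: at bounded depth and polynomial fan-in they remain of polynomial size, and
-- height and weight are computed by structural recursion.
data Formula (B : Basis) (N : ℕ) : Set where
  var   : Fin N → Formula B N
  not′  : Formula B N → Formula B N
  node  : Connective B → List (Formula B N) → Formula B N

module _ {B : Basis} {N : ℕ} where

  ⟦_⟧ : Formula B N → Vec Bool N → Bool
  ⟦_⟧* : List (Formula B N) → Vec Bool N → List Bool
  ⟦ var i ⟧ v     = lookup v i
  ⟦ not′ F ⟧ v    = not (⟦ F ⟧ v)
  ⟦ node k Fs ⟧ v = combine k (⟦ Fs ⟧* v)
  ⟦ [] ⟧* v       = []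
  ⟦ F ∷ Fs ⟧* v   = ⟦ F ⟧ v ∷ ⟦ Fs ⟧* v

  height : Formula B N → ℕ
  heights : List (Formula B N) → List ℕ
  height (var i)     = 0
  -- The `⊔ 0` is what the fold over the single source of a negation gate produces.
  height (not′ F)    = suc (height F ⊔ 0)
  height (node k Fs) = suc (List.foldr _⊔_ 0 (heights Fs))
  heights []         = []
  heights (F ∷ Fs)   = height F ∷ heights Fs

  weight : Formula B N → ℕ
  weights : List (Formula B N) → ℕ
  weight (var i)     = 0
  weight (not′ F)    = 2 + weight F
  weight (node k Fs) = suc (List.length Fs) + weights Fs
  weights []         = 0
  weights (F ∷ Fs)   = weight F + weights Fs

  -- Each new gate shifts the numbers of the earlier nodes, so nodes that are still needed are
  -- carried along an embedding that preserves their values and depths.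
  record _⟶_ {M M′} (gs : Gates B N M) (gs′ : Gates B N M′) : Set where
    field
      embed    : Fin M → Fin M′
      values-ok : ∀ v j → lookup (values gs′ v) (embed j) ≡ lookup (values gs v) j
      depths-ok : ∀ j → lookup (depths gs′) (embed j) ≡ lookup (depths gs) j
  open _⟶_

  ⟶-refl : ∀ {M} {gs : Gates B N M} → gs ⟶ gs
  ⟶-refl = record { embed = id ; values-ok = λ _ _ → refl ; depths-ok = λ _ → refl }

  ⟶-trans : ∀ {M M′ M″} {gs : Gates B N M} {gs′ : Gates B N M′} {gs″ : Gates B N M″} →
            gs ⟶ gs′ → gs′ ⟶ gs″ → gs ⟶ gs″
  ⟶-trans f g = record
    { embed     = embed g ∘ embed f
    ; values-ok = λ v j → trans (values-ok g v (embed f j)) (values-ok f v j)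
    ; depths-ok = λ j → trans (depths-ok g (embed f j)) (depths-ok f j)
    }

  ⟶-gate : ∀ {M} {gs : Gates B N M} g → gs ⟶ (gs ▸ g)
  ⟶-gate g = record { embed = suc ; values-ok = λ _ _ → refl ; depths-ok = λ _ → refl }

  record Compiled {M} (gs : Gates B N M) (F : Formula B N) : Set where
    field
      {M′}      : ℕ
      gs′       : Gates B N M′
      extends   : gs ⟶ gs′
      size≡     : gatesSize gs′ ≡ weight F + gatesSize gs
      output    : Fin M′
      value≡    : ∀ v → lookup (values gs′ v) output ≡ ⟦ F ⟧ v
      depth≡    : lookup (depths gs′) output ≡ height F

  record Compiled* {M} (gs : Gates B N M) (Fs : List (Formula B N)) : Set where
    field
      {M′}      : ℕ
      gs′       : Gates B N M′
      extends   : gs ⟶ gs′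
      size≡     : gatesSize gs′ ≡ weights Fs + gatesSize gs
      outputs   : List (Fin M′)
      length≡   : List.length outputs ≡ List.length Fs
      values≡   : ∀ v → List.map (lookup (values gs′ v)) outputs ≡ ⟦ Fs ⟧* v
      depths≡   : List.map (lookup (depths gs′)) outputs ≡ heights Fs

  -- Compiling on top of any extension of the inputs lets the operands of a gate be built one after
  -- another, the earlier outputs being transported into the later circuits.
  compile : ∀ F {M} (gs : Gates B N M) → inputs ⟶ gs → Compiled gs F
  compile* : ∀ Fs {M} (gs : Gates B N M) → inputs ⟶ gs → Compiled* gs Fs
  compile (var i) gs ι = record
    { gs′ = gs ; extends = ⟶-refl ; size≡ = refl ; output = embed ι i
    ; value≡ = λ v → values-ok ι v i
    ; depth≡ = trans (depths-ok ι i) (Vec.lookup-replicate i 0)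
    }
  compile (not′ F) gs ι = record
    { gs′ = C.gs′ ▸ neg C.output ; extends = ⟶-trans C.extends (⟶-gate _)
    ; size≡ = cong (2 +_) C.size≡ ; output = zero
    ; value≡ = λ v → cong not (C.value≡ v)
    ; depth≡ = cong (λ d → suc (d ⊔ 0)) C.depth≡
    }
    where module C = Compiled (compile F gs ι)
  compile (node k Fs) gs ι = record
    { gs′ = C.gs′ ▸ gate k C.outputs ; extends = ⟶-trans C.extends (⟶-gate _)
    ; size≡ = trans
        (cong₂ (λ m s → suc m + s)
          (trans (cong List.length (sources-gate k C.outputs)) C.length≡) C.size≡)
        (sym (+-assoc (suc (List.length Fs)) (weights Fs) (gatesSize gs)))
    ; output = zero
    ; value≡ = λ v → trans (evalGate-gate k (values C.gs′ v) C.outputs)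
      (cong (combine k) (C.values≡ v))
    ; depth≡ = cong (λ ds → suc (List.foldr _⊔_ 0 ds))
        (trans (cong (List.map (lookup (depths C.gs′))) (sources-gate k C.outputs)) C.depths≡)
    }
    where module C = Compiled* (compile* Fs gs ι)
  compile* [] gs ι = record
    { gs′ = gs ; extends = ⟶-refl ; size≡ = refl ; outputs = [] ; length≡ = refl
    ; values≡ = λ _ → refl ; depths≡ = refl }
  compile* (F ∷ Fs) gs ι = record
    { gs′ = D.gs′ ; extends = ⟶-trans C.extends D.extends
    ; size≡ = trans D.size≡
      (trans (cong (weights Fs +_) C.size≡) (rearrange (weights Fs) (weight F) (gatesSize gs)))
    ; outputs = embed D.extends C.output ∷ D.outputs
    ; length≡ = cong suc D.length≡
    ; values≡ = λ v → cong₂ _∷_ (trans (values-ok D.extends v C.output) (C.value≡ v)) (D.values≡ v)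
    ; depths≡ = cong₂ _∷_ (trans (depths-ok D.extends C.output) C.depth≡) D.depths≡
    }
    where
    module C = Compiled (compile F gs ι)
    module D = Compiled* (compile* Fs C.gs′ (⟶-trans ι C.extends))
    rearrange : ∀ p q r → p + (q + r) ≡ q + p + r
    rearrange = solve-∀

  circuit : Formula B N → Circuit B N
  circuit F = record { gates = gs′ ; output = output }
    where open Compiled (compile F inputs ⟶-refl)

  circuit-depth : ∀ F → Circuit.depth (circuit F) ≡ height F
  circuit-depth F = Compiled.depth≡ (compile F inputs ⟶-refl)

  circuit-size : ∀ F → Circuit.size (circuit F) ≡ weight F
  circuit-size F = trans (Compiled.size≡ (compile F inputs ⟶-refl)) (+-identityʳ _)

  circuit-eval : ∀ F v → Circuit.eval (circuit F) v ≡ ⟦ F ⟧ v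
  circuit-eval F = Compiled.value≡ (compile F inputs ⟶-refl)

  ⟦map⟧ : ∀ {X : Set} (F : X → Formula B N) xs v → ⟦ List.map F xs ⟧* v ≡ List.map
    (λ x → ⟦ F x ⟧ v) xs
  ⟦map⟧ F []       v = refl
  ⟦map⟧ F (x ∷ xs) v = cong (⟦ F x ⟧ v ∷_) (⟦map⟧ F xs v)

  ⋁ ⋀ : ∀ {X : Set} → List X → (X → Formula B N) → Formula B N
  ⋁ xs F = node OR (List.map F xs)
  ⋀ xs F = node AND (List.map F xs)

  ⊤′ ⊥′ : Formula B N
  ⊤′ = node AND []
  ⊥′ = node OR []

  infixr 6 _∧″_
  infixr 5 _∨″_
  _∧″_ _∨″_ : Formula B N → Formula B N → Formula B N
  F ∧″ G = node AND (F ∷ G ∷ [])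
  F ∨″ G = node OR (F ∷ G ∷ [])

  Holds : Formula B N → Vec Bool N → Set
  Holds F v = ⟦ F ⟧ v ≡ true

  ∧″-holds : ∀ F G v → Holds (F ∧″ G) v ⇔ (Holds F v × Holds G v)
  ∧″-holds F G v with ⟦ F ⟧ v | ⟦ G ⟧ v
  ... | true  | true  = mk⇔ (λ _ → refl , refl) (λ _ → refl)
  ... | true  | false = mk⇔ (λ ()) (λ ())
  ... | false | _     = mk⇔ (λ ()) (λ ())

  ∨″-holds : ∀ F G v → Holds (F ∨″ G) v ⇔ (Holds F v ⊎ Holds G v)
  ∨″-holds F G v with ⟦ F ⟧ v | ⟦ G ⟧ v
  ... | true  | _     = mk⇔ (λ _ → inj₁ refl) (λ _ → refl)
  ... | false | true  = mk⇔ (λ _ → inj₂ refl) (λ _ → refl)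
  ... | false | false = mk⇔ (λ ()) λ { (inj₁ ()) ; (inj₂ ()) }

  ⋁-holds : ∀ {X : Set} (xs : List X) F v → Holds (⋁ xs F) v ⇔ (∃[ x ] x ∈ˡ xs × Holds (F x) v)
  ⋁-holds {X} xs F v = mk⇔ (to xs) (λ { (x , x∈ , h) → from x∈ h })
    where
    to : ∀ xs → Holds (⋁ xs F) v → ∃[ x ] x ∈ˡ xs × Holds (F x) v
    to (x ∷ xs) h with ⟦ F x ⟧ v in eq
    ... | true  = x , here refl , eq
    ... | false = map₂ (map₁ there) (to xs h)
    from : ∀ {x xs} → x ∈ˡ xs → Holds (F x) v → Holds (⋁ xs F) v
    from (here refl) h = ∨-introˡ _ h
    from {xs = x ∷ _} (there x∈) h = ∨-introʳ (⟦ F x ⟧ v) (from x∈ h)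

  ⋀-holds : ∀ {X : Set} (xs : List X) F v → Holds (⋀ xs F) v ⇔ (∀ {x} → x ∈ˡ xs → Holds (F x) v)
  ⋀-holds {X} xs F v = mk⇔ to (from xs)
    where
    to : ∀ {xs} → Holds (⋀ xs F) v → ∀ {x} → x ∈ˡ xs → Holds (F x) v
    to {x ∷ xs} h (here refl) = proj₁
      (Equivalence.to (∧″-holds (F x) (⋀ xs F) v) (trans (cong (⟦ F x ⟧ v ∧_) (∧-identityʳ _)) h))
    to {x ∷ xs} h (there x∈)  = to
      (proj₂ (Equivalence.to (∧″-holds (F x) (⋀ xs F) v)
      (trans (cong (⟦ F x ⟧ v ∧_) (∧-identityʳ _)) h))) x∈
    from : ∀ xs → (∀ {x} → x ∈ˡ xs → Holds (F x) v) → Holds (⋀ xs F) v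
    from []       h = refl
    from (x ∷ xs) h = cong₂ _∧_ (h (here refl)) (from xs (h ∘ there))

-- Bounded depth and polynomial size, measured by the powers of a number X ≥ 2

module _ {B : Basis} {N : ℕ} where

  record Small (X d k : ℕ) (F : Formula B N) : Set where
    constructor bounded
    field
      height≤ : height F ≤ d
      weight≤ : weight F ≤ X ^ k

  module _ {X : ℕ} (2≤X : 2 ≤ X) where

    private instance
      X≢0 : NonZero X
      X≢0 = >-nonZero (≤-trans (s≤s z≤n) 2≤X)

    1≤X^ : ∀ k → 1 ≤ X ^ k
    1≤X^ k = m^n>0 X k

    4≤X² : 4 ≤ X ^ 2
    4≤X² = ^-monoˡ-≤ 2 2≤X

    Small-mono : ∀ {d d′ k k′ F} → d ≤ d′ → k ≤ k′ → Small X d k F → Small X d′ k′ F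
    Small-mono d≤ k≤ (bounded h w) = bounded (≤-trans h d≤) (≤-trans w (^-monoʳ-≤ X k≤))

    Small-var : ∀ {d k} i → Small X d k (var i)
    Small-var i = bounded z≤n z≤n

    Small-not : ∀ {d k F} → Small X d k F → Small X (suc d) (2 + k) (not′ F)
    Small-not {d} {k} {F} (bounded h w) = bounded (s≤s (⊔-lub h z≤n)) (begin
      2 + weight F        ≤⟨ +-mono-≤ (*-monoʳ-≤ 2 (1≤X^ k)) w ⟩
      2 * X ^ k + X ^ k   ≤⟨ m≤m+n _ (X ^ k) ⟩
      2 * X ^ k + X ^ k + X ^ k ≡⟨ four (X ^ k) ⟩
      4 * X ^ k           ≤⟨ *-monoˡ-≤ (X ^ k) 4≤X² ⟩
      X ^ 2 * X ^ k       ≡⟨ ^-distribˡ-+-* X 2 k ⟨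
      X ^ (2 + k)         ∎)
      where
      open ≤-Reasoning
      four : ∀ x → 2 * x + x + x ≡ 4 * x
      four = solve-∀

    -- The gate, its wires and its operands each weigh at most X^i X^k; the 2 added to the exponent
    -- absorbs the number of these terms, since 4 ≤ X².
    Small-node : ∀ {d k} c Fs i → List.length Fs ≤ X ^ i → All (Small X d k) Fs →
                 Small X (suc d) (2 + (i + k)) (node c Fs)
    Small-node {d} {k} c Fs i len small = bounded (s≤s (max small)) (begin
      suc (List.length Fs) + weights Fs
        ≤⟨ +-mono-≤ (s≤s len) (≤-trans (total small) (*-monoˡ-≤ (X ^ k) len)) ⟩
      1 + X ^ i + X ^ i * X ^ k
        ≤⟨ +-monoˡ-≤ (X ^ i * X ^ k)
          (+-mono-≤ (*-mono-≤ (1≤X^ i) (1≤X^ k))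
          (≤-trans (≤-reflexive (sym (*-identityʳ (X ^ i)))) (*-monoʳ-≤ (X ^ i) (1≤X^ k)))) ⟩
      p + p + p                            ≤⟨ m≤m+n _ p ⟩
      p + p + p + p                        ≡⟨ four p ⟩
      4 * p                                ≤⟨ *-monoˡ-≤ p 4≤X² ⟩
      X ^ 2 * p                            ≡⟨ cong (X ^ 2 *_) (^-distribˡ-+-* X i k) ⟨
      X ^ 2 * X ^ (i + k)                  ≡⟨ ^-distribˡ-+-* X 2 (i + k) ⟨
      X ^ (2 + (i + k))                    ∎)
      where
      open ≤-Reasoning
      p : ℕ
      p = X ^ i * X ^ k
      max : ∀ {Fs} → All (Small X d k) Fs → List.foldr _⊔_ 0 (heights Fs) ≤ d
      max []              = z≤n
      max (bounded h _ ∷ rest) = ⊔-lub h (max rest)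
      total : ∀ {Fs} → All (Small X d k) Fs → weights Fs ≤ List.length Fs * X ^ k
      total []              = z≤n
      total (bounded _ w ∷ rest) = +-mono-≤ w (total rest)
      four : ∀ x → x + x + x + x ≡ 4 * x
      four = solve-∀

    Small-map : ∀ {Y : Set} {d k} c (xs : List Y) F i → List.length xs ≤ X ^ i →
      (∀ x → Small X d k (F x)) →
                Small X (suc d) (2 + (i + k)) (node c (List.map F xs))
    Small-map {d = d} {k} c xs F i len small = Small-node {d} {k} c _ i
      (≤-trans (≤-reflexive (List.length-map F xs)) len)
      (All.map⁺ (All.universal small xs))

    Small-const : ∀ c → Small X 1 2 (node c [])
    Small-const c = Small-node {0} {0} c [] 0 z≤n []

    Small-pair : ∀ {d k F G} c → Small X d k F → Small X d k G → Small X (suc d) (3 + k)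
      (node c (F ∷ G ∷ []))
    Small-pair c f g = Small-node c _ 1 (≤-trans 2≤X (≤-reflexive (sym (*-identityʳ X))))
      (f ∷ g ∷ [])

-- For N ≥ 2 the estimate 2 + N ≤ N² leads to the exponent 2k; for N ≤ 1 the left side is at most
-- 3^k, which the additive constant covers.
polynomial-bound : ∀ N k → (2 + N) ^ k ≤ N ^ (3 ^ k + 2 * k) + (3 ^ k + 2 * k)
polynomial-bound zero k = ≤-trans (^-monoˡ-≤ k (n≤1+n 2))
  (≤-trans (m≤m+n (3 ^ k) (2 * k)) (m≤n+m _ (0 ^ (3 ^ k + 2 * k))))
polynomial-bound (suc zero) k = ≤-trans (m≤m+n (3 ^ k) (2 * k)) (m≤n+m _ (1 ^ (3 ^ k + 2 * k)))
polynomial-bound N@(suc (suc j)) k = begin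
  (2 + N) ^ k
    ≤⟨ ^-monoˡ-≤ k (≤-trans (m≤m+n (2 + N) (3 * j + j * j)) (≤-reflexive (square j))) ⟩
  (N ^ 2) ^ k              ≡⟨ ^-*-assoc N 2 k ⟩
  N ^ (2 * k)              ≤⟨ ^-monoʳ-≤ N (m≤n+m (2 * k) (3 ^ k)) ⟩
  N ^ (3 ^ k + 2 * k)      ≤⟨ m≤m+n _ (3 ^ k + 2 * k) ⟩
  N ^ (3 ^ k + 2 * k) + (3 ^ k + 2 * k) ∎
  where
  open ≤-Reasoning
  square : ∀ j → 2 + (2 + j) + (3 * j + j * j) ≡ (2 + j) * ((2 + j) * 1)
  square = solve-∀

2≤2+ : ∀ {N} → 2 ≤ 2 + N
2≤2+ = s≤s (s≤s z≤n)

from-formulas : ∀ {B L} d k (F : ∀ N → Formula B N) → (∀ N → Small (2 + N) d k (F N)) →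
  (∀ N v → Holds (F N) v ⇔ L (Vec.toList v)) → ConstantDepthPolySize B L
from-formulas d k F small correct = d , 3 ^ k + 2 * k , λ N → circuit (F N) ,
  ≤-trans (≤-reflexive (circuit-depth (F N))) (Small.height≤ (small N)) ,
  ≤-trans (≤-reflexive (circuit-size (F N)))
    (≤-trans (Small.weight≤ (small N)) (polynomial-bound N k)) ,
  λ v → subst (λ b → b ≡ true ⇔ _) (sym (circuit-eval (F N) v)) (correct N v)

-- Decoding instances

split : ∀ {X : Set} n (xs : List X) → n ≤ List.length xs →
        Σ (Vec X n) λ u → ∃[ rest ] xs ≡ Vec.toList u List.++ rest
split zero    xs       _       = [] , xs , refl
split (suc n) (x ∷ xs) (s≤s h) with u , rest , eq ← split n xs h = x ∷ u , rest , cong (x ∷_) eq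

split-length : ∀ {X : Set} {n} {xs rest : List X} (u : Vec X n) → xs ≡ Vec.toList u List.++ rest →
               List.length xs ≡ n + List.length rest
split-length []      refl = refl
split-length (x ∷ u) refl = cong suc (split-length u refl)

split-rows : ∀ {X : Set} r n (xs : List X) → r * n ≤ List.length xs →
  Σ (Vec (Vec X n) r) λ A → ∃[ rest ] xs ≡ List.concatMap Vec.toList (Vec.toList A) List.++ rest
split-rows zero    n xs _ = [] , xs , refl
split-rows (suc r) n xs h
  with u , rest , eq ← split n xs (≤-trans (m≤m+n n (r * n)) h)
  with A , rest′ , eq′ ← split-rows r n rest
    (+-cancelˡ-≤ n _ _ (≤-trans h (≤-reflexive (split-length u eq)))) =
  u ∷ A , rest′ , trans eq
    (trans (cong (Vec.toList u List.++_) eq′) (sym (List.++-assoc (Vec.toList u) _ rest′)))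

-- The entries are left general because the formula is built from the layout of the positions
-- `allFin N`; mapping `lookup v` over it gives the layout of the string.
record Layout {X : Set} (r n : ℕ) (xs : List X) : Set where
  field
    header  : Vec X n
    marker  : X
    rows    : Vec (Vec X n) r
    numeral : List X
    layout≡ : xs ≡ Vec.toList header List.++ marker ∷
      (List.concatMap Vec.toList (Vec.toList rows) List.++ numeral)

layout : ∀ {X : Set} r n (xs : List X) → n + suc (r * n) ≤ List.length xs → Layout r n xs
layout r n xs h with u , rest , eq ← split n xs (≤-trans (m≤m+n n _) h)
  with rest | eq | +-cancelˡ-≤ n _ _ (≤-trans h (≤-reflexive (split-length u eq)))
... | c ∷ rest′ | eq | s≤s h′ with A , bs , eq′ ← split-rows r n rest′ h′ = record
  { header = u ; marker = c ; rows = A ; numeral = bs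
  ; layout≡ = trans eq (cong (λ ys → Vec.toList u List.++ c ∷ ys) eq′) }

length-rows : ∀ {X : Set} {r n} (A : Vec (Vec X n) r) → List.length
  (List.concatMap Vec.toList (Vec.toList A)) ≡ r * n
length-rows []      = refl
length-rows (u ∷ A) = trans (split-length u refl) (cong (_ +_) (length-rows A))

length-encode : ∀ {r n} (A : Structure r n) bs → List.length (encode A bs) ≡ n + suc
  (r * n + List.length bs)
length-encode {n = n} A bs = trans (List.length-++ (List.replicate n true))
  (cong₂ (λ p q → p + suc q) (List.length-replicate n)
    (trans (List.length-++ (List.concatMap Vec.toList (Vec.toList A)))
      (cong (_+ List.length bs) (length-rows A))))

map-rows : ∀ {X Y : Set} (f : X → Y) {r n} (A : Vec (Vec X n) r) →
  List.map f (List.concatMap Vec.toList (Vec.toList A)) ≡ List.concatMap Vec.toList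
    (Vec.toList (Vec.map (Vec.map f) A))
map-rows f []      = refl
map-rows f (u ∷ A) = trans (List.map-++ f (Vec.toList u) _)
  (cong₂ List._++_ (sym (Vec.toList-map f u)) (map-rows f A))

map-layout : ∀ {X Y : Set} (f : X → Y) {r n} {xs : List X} (l : Layout r n xs) → let open Layout l in
  List.map f xs ≡ Vec.toList (Vec.map f header) List.++
    f marker ∷ (List.concatMap Vec.toList
      (Vec.toList (Vec.map (Vec.map f) rows)) List.++ List.map f numeral)
map-layout f l = trans (cong (List.map f) layout≡)
  (trans (List.map-++ f (Vec.toList header) _)
    (cong₂ (λ us vs → us List.++ f marker ∷ vs) (sym (Vec.toList-map f header))
      (trans (List.map-++ f (List.concatMap Vec.toList (Vec.toList rows)) numeral)
        (cong (List._++ List.map f numeral) (map-rows f rows)))))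
  where open Layout l

lookup-allFin : ∀ {X : Set} {N} (v : Vec X N) → Vec.toList v ≡ List.map (lookup v) (List.allFin N)
lookup-allFin []      = refl
lookup-allFin (x ∷ v) = cong (x ∷_) (trans (lookup-allFin v)
  (trans (List.map-tabulate id (lookup v)) (sym (List.map-tabulate suc (lookup (x ∷ v))))))

length-allFin : ∀ n → List.length (List.allFin n) ≡ n
length-allFin n = List.length-tabulate {n = n} id

∈-allFin : ∀ {n} (i : Fin n) → i ∈ˡ List.allFin n
∈-allFin = ∈-tabulate⁺

-- Positions in the input string of the entries of a structure
Positions : ℕ → ℕ → ℕ → Set
Positions N r n = Vec (Vec (Fin N) n) r

read : ∀ {N r n} → Vec Bool N → Positions N r n → Structure r n
read v = Vec.map (Vec.map (lookup v))

Solver : Basis → ℕ → Set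
Solver B r = ∀ {N n} → Positions N r n → List (Fin N) → Formula B N

module _ {B : Basis} {r : ℕ} (⊗ : Operation) (φ : Sentence r) (solver : Solver B r) (d k : ℕ)
  (correct : ∀ {N n} (A : Positions N r n) bs v →
    Holds (solver A bs) v ⇔ YesInstance ⊗ φ (read v A) (value (List.map (lookup v) bs)))
  (small : ∀ {N n} (A : Positions N r n) bs → n ≤ N → List.length bs ≤ N → Small (2 + N) d k
    (solver A bs)) where

  private

    all-true : ∀ {N n} → Vec (Fin N) n → Formula B N
    all-true u = ⋀ (Vec.toList u) var

    parse : ∀ {N n} → Layout {Fin N} r n (List.allFin N) → Formula B N
    parse l = all-true header ∧″ not′ (var marker) ∧″ solver rows numeral
      where open Layout l

    attempt : ∀ N n → Dec (n + suc (r * n) ≤ List.length (List.allFin N)) → Formula B N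
    attempt N n (yes h) = parse (layout r n (List.allFin N) h)
    attempt N n (no _)  = ⊥′

    fits? : ∀ N n → Dec (n + suc (r * n) ≤ List.length (List.allFin N))
    fits? N n = n + suc (r * n) ≤? List.length (List.allFin N)

    -- The numeral may have any length, so N does not determine n. Every n ≤ N is tried, and the
    -- test for a header of n ones followed by a zero singles out the right one.
    formula : ∀ N → Formula B N
    formula N = ⋁ (List.upTo (suc N)) (λ n → attempt N n (fits? N n))

    header-true : ∀ {N n} (u : Vec (Fin N) n) v → Holds (all-true u) v ⇔ Vec.map
      (lookup v) u ≡ Vec.replicate n true
    header-true u v = mk⇔ (to u ∘ Equivalence.to (⋀-holds {B} (Vec.toList u) var v))
      (λ eq → Equivalence.from (⋀-holds {B} (Vec.toList u) var v) (from u eq))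
      where
      to : ∀ {n} (u : Vec (Fin _) n) → (∀ {x} → x ∈ˡ Vec.toList u → lookup v x ≡ true) → Vec.map
        (lookup v) u ≡ Vec.replicate n true
      to []      h = refl
      to (x ∷ u) h = cong₂ _∷_ (h (here refl)) (to u (h ∘ there))
      from : ∀ {n} (u : Vec (Fin _) n) → Vec.map (lookup v) u ≡ Vec.replicate n true → ∀ {x} →
        x ∈ˡ Vec.toList u → lookup v x ≡ true
      from (x ∷ u) eq (here refl) = Vec.∷-injectiveˡ eq
      from (x ∷ u) eq (there x∈)  = from u (Vec.∷-injectiveʳ eq) x∈

    parse-correct : ∀ {N n} (l : Layout {Fin N} r n (List.allFin N)) v →
      Holds (parse l) v ⇔ (∃[ A ] ∃[ bs ] Vec.toList v ≡ encode {r} {n} A bs × YesInstance ⊗ φ A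
        (value bs))
    parse-correct {N} {n} l v = mk⇔ to from
      where
      open Layout l
      F G H : Formula B N
      F = all-true header
      G = not′ (var marker)
      H = solver rows numeral
      decoded : Vec.toList v ≡ Vec.toList (Vec.map (lookup v) header) List.++
        lookup v marker ∷ (List.concatMap Vec.toList (Vec.toList (read v rows)) List.++ List.map
          (lookup v) numeral)
      decoded = trans (lookup-allFin v) (map-layout (lookup v) l)
      to : Holds (parse l) v →
        ∃[ A ] ∃[ bs ] Vec.toList v ≡ encode {r} {n} A bs × YesInstance ⊗ φ A (value bs)
      to h with hF , h′ ← Equivalence.to (∧″-holds F (G ∧″ H) v) h
        with hG , h″ ← Equivalence.to (∧″-holds G H v) h′ =
        read v rows , List.map (lookup v) numeral ,
        trans decoded (cong₂
          (λ us c → us List.++ c ∷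
          (List.concatMap Vec.toList (Vec.toList (read v rows)) List.++ List.map
          (lookup v) numeral))
          (trans (cong Vec.toList (Equivalence.to (header-true header v) hF))
            (toList-replicate n true))
          (not-injective hG)) ,
        Equivalence.to (correct rows numeral v) h″
      from : (∃[ A ] ∃[ bs ] Vec.toList v ≡ encode {r} {n} A bs × YesInstance ⊗ φ A (value bs)) →
        Holds (parse l) v
      from (A , bs , eq , sat)
        with eqʰ , eqᵗ ← toList-++-injective (Vec.map (lookup v) header) (Vec.replicate n true)
          (trans (sym decoded)
            (trans eq (cong (List._++ false ∷
            (List.concatMap Vec.toList (Vec.toList A) List.++ bs))
            (sym (toList-replicate n true)))))
        with eqᴬ , eqᵇ ← concat-++-injective (read v rows) A (List.∷-injectiveʳ eqᵗ) =
        Equivalence.from (∧″-holds F (G ∧″ H) v) (Equivalence.from (header-true header v) eqʰ ,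
          Equivalence.from (∧″-holds G H v) (cong not (List.∷-injectiveˡ eqᵗ) ,
            Equivalence.from (correct rows numeral v)
              (subst₂ (λ A bs → YesInstance ⊗ φ A (value bs)) (sym eqᴬ) (sym eqᵇ) sat)))

    formula-correct : ∀ N v → Holds (formula N) v ⇔ Problem ⊗ φ (Vec.toList v)
    formula-correct N v = mk⇔ to from
      where
      to : Holds (formula N) v → Problem ⊗ φ (Vec.toList v)
      to h with n , _ , h′ ← Equivalence.to (⋁-holds (List.upTo (suc N)) _ v) h with fits? N n
      ... | no _ = case h′ of λ ()
      ... | yes fit with A , bs , eq , sat ← Equivalence.to
        (parse-correct (layout r n _ fit) v) h′ =
        n , A , value bs , (bs , refl , eq) , sat
      from : Problem ⊗ φ (Vec.toList v) → Holds (formula N) v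
      from (n , A , _ , (bs , refl , eq) , sat) =
        Equivalence.from (⋁-holds (List.upTo (suc N)) _ v)
          (n , ∈-upTo⁺ (s≤s n≤N) , holds (fits? N n))
        where
        length≡ : N ≡ n + suc (r * n + List.length bs)
        length≡ = trans (sym (Vec.length-toList v))
          (trans (cong List.length eq) (length-encode A bs))
        n≤N : n ≤ N
        n≤N = ≤-trans (m≤m+n n _) (≤-reflexive (sym length≡))
        holds : ∀ dec → Holds (attempt N n dec) v
        holds (yes fit) = Equivalence.from (parse-correct (layout r n _ fit) v) (A , bs , eq , sat)
        holds (no ¬fit) = contradiction (≤-trans (+-monoʳ-≤ n (s≤s (m≤m+n (r * n) _)))
          (≤-reflexive (trans (sym length≡) (sym (length-allFin N))))) ¬fit

    attempt-small : ∀ N n dec → Small (2 + N) (3 + d) (8 + k) (attempt N n dec)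
    attempt-small N n (no _) = Small-mono 2≤2+ {F = ⊥′} (s≤s z≤n) (s≤s (s≤s z≤n))
      (Small-const 2≤2+ OR)
    attempt-small N n (yes fit) = Small-mono 2≤2+ {d = 3 + d} {k = 8 + k} {F = parse l} ≤-refl ≤-refl
      (Small-pair 2≤2+ {d = 2 + d} {k = 5 + k} {F = all-true header} {G = not′
        (var marker) ∧″ solver rows numeral} AND
        (Small-mono 2≤2+ {F = all-true header} (s≤s z≤n) (m≤m+n 3 (2 + k))
          (Small-map 2≤2+ {d = 0} {k = 0} AND (Vec.toList header) var 1
            (≤-trans (≤-reflexive (Vec.length-toList header))
            (≤-trans n≤N (≤-trans (m≤n+m N 2) (≤-reflexive (sym (*-identityʳ (2 + N)))))))
            (Small-var 2≤2+)))
        (Small-pair 2≤2+ {d = suc d} {k = 2 + k} {F = not′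
          (var marker)} {G = solver rows numeral} AND
          (Small-not 2≤2+ {d = d} {k = k} {F = var marker} (Small-var 2≤2+ marker))
          (Small-mono 2≤2+ {F = solver rows numeral} (n≤1+n d) (m≤n+m k 2)
            (small rows numeral n≤N numeral≤N))))
      where
      l : Layout r n (List.allFin N)
      l = layout r n (List.allFin N) fit
      open Layout l
      fit′ : n + suc (r * n) ≤ N
      fit′ = ≤-trans fit (≤-reflexive (length-allFin N))
      n≤N : n ≤ N
      n≤N = ≤-trans (m≤m+n n _) fit′
      numeral≤N : List.length numeral ≤ N
      numeral≤N = begin
        List.length numeral
          ≤⟨ m≤n+m _ (List.length (List.concatMap Vec.toList (Vec.toList rows))) ⟩
        List.length (List.concatMap Vec.toList (Vec.toList rows)) + List.length numeral
          ≡⟨ List.length-++ (List.concatMap Vec.toList (Vec.toList rows)) ⟨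
        List.length (List.concatMap Vec.toList (Vec.toList rows) List.++ numeral) ≤⟨ n≤1+n _ ⟩
        List.length (marker ∷ (List.concatMap Vec.toList (Vec.toList rows) List.++ numeral))
          ≤⟨ m≤n+m _ n ⟩
        n + List.length (marker ∷ (List.concatMap Vec.toList (Vec.toList rows) List.++ numeral))
          ≡⟨ split-length header layout≡ ⟨
        List.length (List.allFin N) ≡⟨ length-allFin N ⟩
        N ∎
        where open ≤-Reasoning

  solvable : ConstantDepthPolySize B (Problem ⊗ φ)
  solvable = from-formulas {L = Problem ⊗ φ} (4 + d) (11 + k) formula
    (λ N → Small-map 2≤2+ {d = 3 + d} {k = 8 + k} OR (List.upTo (suc N))
      (λ n → attempt N n (fits? N n)) 1
      (≤-trans (≤-reflexive (List.length-upTo (suc N)))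
        (≤-trans (n≤1+n (suc N)) (≤-reflexive (sym (*-identityʳ (2 + N))))))
      (λ n → attempt-small N n (fits? N n)))
    formula-correct

solvable-class : ∀ {B ⊗ p} →
  (∀ {r} (φ : Sentence r) → pattern-of φ ≡ p → ConstantDepthPolySize B (Problem ⊗ φ)) →
  ∀ {L} → RM ⊗ p L → ConstantDepthPolySize B L
solvable-class solve (r , φ , eq , L⊆ , ⊆L) with d , c , circuits ← solve φ eq =
  d , c , λ n → let K , depth≤ , size≤ , correct = circuits n in
    K , depth≤ , size≤ , λ w → correct w ⇔∘ mk⇔ ⊆L L⊆

-- Comparing a numeral with a constant

ones-replicate-++ : ∀ k b bs → ones (List.replicate k b List.++ bs) ≡ (if b then k else 0) + ones bs
ones-replicate-++ zero    true  bs = refl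
ones-replicate-++ zero    false bs = refl
ones-replicate-++ (suc k) true  bs = cong suc (ones-replicate-++ k true bs)
ones-replicate-++ (suc k) false bs = ones-replicate-++ k false bs

-- The i-th bit of a numeral has weight 2^i w, which may be capped at c when
-- only thresholds up to c matter.
wires : ∀ {X : Set} → ℕ → ℕ → List X → List X
wires c w []       = []
wires c w (b ∷ bs) = List.replicate (w ⊓ c) b List.++ wires c (2 * w) bs

length-wires : ∀ {X : Set} c w (bs : List X) → List.length (wires c w bs) ≤ List.length bs * c
length-wires c w []       = z≤n
length-wires c w (b ∷ bs) = begin
  List.length (List.replicate (w ⊓ c) b List.++ wires c (2 * w) bs)
    ≡⟨ List.length-++ (List.replicate (w ⊓ c) b) ⟩
  List.length (List.replicate (w ⊓ c) b) + List.length (wires c (2 * w) bs)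
    ≤⟨ +-mono-≤ (≤-trans (≤-reflexive (List.length-replicate (w ⊓ c))) (m⊓n≤n w c))
      (length-wires c (2 * w) bs) ⟩
  c + List.length bs * c ∎
  where open ≤-Reasoning

map-wires : ∀ {X Y : Set} (f : X → Y) c w bs → List.map f (wires c w bs) ≡ wires c w (List.map f bs)
map-wires f c w []       = refl
map-wires f c w (b ∷ bs) = trans (List.map-++ f (List.replicate (w ⊓ c) b) _)
  (cong₂ List._++_ (List.map-replicate f (w ⊓ c) b) (map-wires f c (2 * w) bs))

-- A set bit of weight w ≤ c lowers the remaining threshold to q ∸ w, which is why the induction is
-- over all q ≤ c; a set bit of weight at least c reaches q by itself on both sides.
wires-value : ∀ c w bs {q} → q ≤ c → q ≤ ones (wires c w bs) ⇔ q ≤ w * value bs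
wires-value c w [] q≤c = mk⇔ (λ h → ≤-trans h z≤n) (λ h → ≤-trans h (≤-reflexive (*-zeroʳ w)))
wires-value c w (false ∷ bs) q≤c
  rewrite ones-replicate-++ (w ⊓ c) false (wires c (2 * w) bs) | sym
    (*-assoc w 2 (value bs)) | *-comm w 2 =
  wires-value c (2 * w) bs q≤c
wires-value c w (true ∷ bs) {q} q≤c
  rewrite ones-replicate-++ (w ⊓ c) true (wires c (2 * w) bs) | *-suc w (2 * value bs)
  | sym (*-assoc w 2 (value bs)) | *-comm w 2 with ≤-total w c
... | inj₂ c≤w rewrite m≥n⇒m⊓n≡n c≤w = mk⇔
  (λ _ → ≤-trans q≤c (≤-trans c≤w (m≤m+n w _))) (λ _ → ≤-trans q≤c (m≤m+n c _))
... | inj₁ w≤c rewrite m≤n⇒m⊓n≡m w≤c = mk⇔ (shift (Equivalence.to ih)) (shift (Equivalence.from ih))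
  where
  ih : q ∸ w ≤ ones (wires c (2 * w) bs) ⇔ q ∸ w ≤ 2 * w * value bs
  ih = wires-value c (2 * w) bs (≤-trans (m∸n≤m q w) q≤c)
  shift : ∀ {x y} → (q ∸ w ≤ x → q ∸ w ≤ y) → q ≤ w + x → q ≤ w + y
  shift f h = ≤-trans (m≤n+m∸n q w) (+-monoʳ-≤ w (f (m≤n+o⇒m∸n≤o q w h)))

numeral-≥ : ∀ {N} (v : Vec Bool N) c bs →
  c ≤ ones (List.map (lookup v) (wires c 1 bs)) ⇔ c ≤ value (List.map (lookup v) bs)
numeral-≥ v c bs rewrite map-wires (lookup v) c 1 bs =
  subst (λ x → c ≤ ones (wires c 1 (List.map (lookup v) bs)) ⇔ c ≤ x) (*-identityˡ _)
    (wires-value c 1 (List.map (lookup v) bs) ≤-refl)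

length-wires-bound : ∀ {N} c w (bs : List (Fin N)) {q} → c ≤ q → List.length bs ≤ N →
                     List.length (wires c w bs) ≤ (2 + N) ^ suc q
length-wires-bound {N} c w bs {q} c≤q len = begin
  List.length (wires c w bs)   ≤⟨ length-wires c w bs ⟩
  List.length bs * c           ≤⟨ *-mono-≤ (≤-trans len (m≤n+m N 2)) (≤-trans c≤q (<⇒≤ (n<2^n q))) ⟩
  (2 + N) * 2 ^ q              ≤⟨ *-monoʳ-≤ (2 + N) (^-monoˡ-≤ q (m≤m+n 2 N)) ⟩
  (2 + N) ^ suc q              ∎
  where open ≤-Reasoning

-- Constant thresholds over the Boolean basis

module _ {B : Basis} {N : ℕ} where

  -- The positions of c true formulas are guessed in increasing order, one OR for each. The depth
  -- grows with c, so this serves only for thresholds independent of the input length.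
  atLeast : ℕ → List (Formula B N) → Formula B N
  choices : ℕ → List (Formula B N) → List (Formula B N)
  atLeast zero    Fs = ⊤′
  atLeast (suc c) Fs = node OR (choices c Fs)
  choices c []       = []
  choices c (F ∷ Fs) = F ∧″ atLeast c Fs ∷ choices c Fs

  atLeast-holds : ∀ c Fs v → Holds (atLeast c Fs) v ⇔ c ≤ ones (⟦ Fs ⟧* v)
  choices-hold : ∀ c Fs v → or (⟦ choices c Fs ⟧* v) ≡ true ⇔ suc c ≤ ones (⟦ Fs ⟧* v)
  atLeast-holds zero    Fs v = mk⇔ (λ _ → z≤n) (λ _ → refl)
  atLeast-holds (suc c) Fs v = choices-hold c Fs v
  choices-hold c []       v = mk⇔ (λ ()) (λ ())
  choices-hold c (F ∷ Fs) v with ⟦ F ⟧ v | ⟦ atLeast c Fs ⟧ v | atLeast-holds c Fs v | choices-hold c Fs v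
  ... | false | _     | _  | rest = rest
  ... | true  | true  | at | _    = mk⇔ (λ _ → s≤s (Equivalence.to at refl)) (λ _ → refl)
  ... | true  | false | at | rest = mk⇔
    (λ h → m≤n⇒m≤1+n (Equivalence.to rest h))
    (λ { (s≤s h) → case Equivalence.from at h of λ () })

  module _ {X : ℕ} (2≤X : 2 ≤ X) where

    atLeast-small : ∀ c Fs i → List.length Fs ≤ X ^ i → All (Small X 0 0) Fs →
                    Small X (suc (2 * c)) (2 + c * (5 + i)) (atLeast c Fs)
    choices-small : ∀ c Fs i → List.length Fs ≤ X ^ i → All (Small X 0 0) Fs →
                    All (Small X (suc (suc (2 * c))) (3 + (2 + c * (5 + i)))) (choices c Fs)
    atLeast-small zero    Fs i len small = Small-const 2≤X AND
    atLeast-small (suc c) Fs i len small = Small-mono 2≤X (≤-reflexive (depth c))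
      (≤-reflexive (power c i))
      (Small-node 2≤X OR (choices c Fs) i (≤-trans (≤-reflexive (length-choices Fs)) len)
        (choices-small c Fs i len small))
      where
      length-choices : ∀ Fs → List.length (choices c Fs) ≡ List.length Fs
      length-choices []       = refl
      length-choices (F ∷ Fs) = cong suc (length-choices Fs)
      depth : ∀ c → 3 + 2 * c ≡ 1 + 2 * (1 + c)
      depth = solve-∀
      power : ∀ c i → 2 + (i + (3 + (2 + c * (5 + i)))) ≡ 2 + (1 + c) * (5 + i)
      power = solve-∀
    choices-small c []       i len []          = []
    choices-small c (F ∷ Fs) i len (s ∷ small) =
      Small-pair 2≤X AND (Small-mono 2≤X z≤n z≤n s)
        (atLeast-small c Fs i (≤-trans (n≤1+n _) len) small)
      ∷ choices-small c Fs i (≤-trans (n≤1+n _) len) small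

-- Enumeration of tuples, and modifications entry by entry

tuples : ∀ {X : Set} m → List X → List (Vec X m)
tuples zero    xs = [] ∷ []
tuples (suc m) xs = List.cartesianProductWith _∷_ xs (tuples m xs)

length-tuples : ∀ {X : Set} m (xs : List X) → List.length (tuples m xs) ≡ List.length xs ^ m
length-tuples zero    xs = refl
length-tuples (suc m) xs = trans (product xs) (cong (List.length xs *_) (length-tuples m xs))
  where
  product : ∀ ys → List.length
    (List.cartesianProductWith _∷_ ys (tuples m xs)) ≡ List.length ys * List.length (tuples m xs)
  product []       = refl
  product (y ∷ ys) = trans (List.length-++ (List.map (y ∷_) (tuples m xs)))
    (cong₂ _+_ (List.length-map (y ∷_) (tuples m xs)) (product ys))

∈-tuples : ∀ {X : Set} {m xs} (u : Vec X m) → (∀ i → lookup u i ∈ˡ xs) → u ∈ˡ tuples m xs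
∈-tuples []      h = here refl
∈-tuples (x ∷ u) h = ∈-cartesianProductWith⁺ _∷_ (h zero) (∈-tuples u (h ∘ suc))

bools : List Bool
bools = true ∷ false ∷ []

∈-bools : ∀ b → b ∈ˡ bools
∈-bools true  = here refl
∈-bools false = there (here refl)

entry : ∀ {X : Set} {r n} → Vec (Vec X n) r → Fin r → Fin n → X
entry A i y = lookup (lookup A i) y

entry-read : ∀ {N r n} (v : Vec Bool N) (A : Positions N r n) i y → entry (read v A) i y ≡ lookup v
  (entry A i y)
entry-read v A i y = trans (cong (λ u → lookup u y) (Vec.lookup-map i (Vec.map (lookup v)) A))
  (Vec.lookup-map y (lookup v) (lookup A i))

entry-▷ : ∀ {r n} (A S : Structure r n) i y → entry (A ▷ S) i y ≡ entry A i y xor entry S i y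
entry-▷ A S i y = trans (cong (λ u → lookup u y) (Vec.lookup-zipWith _△_ i A S))
  (lookup-△ (lookup A i) (lookup S i) y)

-- Whether a bit of value b may be flipped; this treats the three kinds of modulator uniformly.
permits : Operation → Bool → Bool
permits del  b = b
permits add  b = not b
permits edit b = true

allowed⇔ : ∀ ⊗ {r n} (A S : Structure r n) →
  Allowed ⊗ A S ⇔ (∀ i y → entry S i y ≡ true → permits ⊗ (entry A i y) ≡ true)
allowed⇔ del A S = mk⇔
  (λ S⊆A i y eq → Equivalence.to ∈⇔lookup (S⊆A i (Equivalence.from ∈⇔lookup eq)))
  (λ h i {y} y∈ → Equivalence.from ∈⇔lookup (h i y (Equivalence.to ∈⇔lookup y∈)))
allowed⇔ add A S = mk⇔
  (λ S∩A≡⊥ i → to (lookup S i) (lookup A i) (S∩A≡⊥ i))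
  (λ h i → from (lookup S i) (lookup A i) (h i))
  where
  to : ∀ {n} (p q : Subset n) → p ∩ q ≡ Subset.⊥ → ∀ y → lookup p y ≡ true → not (lookup q y) ≡ true
  to (true ∷ p) (false ∷ q) eq zero    _ = refl
  to (b ∷ p)    (c ∷ q)     eq (suc y) h = to p q (Vec.∷-injectiveʳ eq) y h
  from : ∀ {n} (p q : Subset n) → (∀ y → lookup p y ≡ true → not (lookup q y) ≡ true) →
    p ∩ q ≡ Subset.⊥
  from []          []      h = refl
  from (false ∷ p) (c ∷ q) h = cong (false ∷_) (from p q (h ∘ suc))
  from (true ∷ p)  (c ∷ q) h = cong₂ _∷_ (trans (sym (not-involutive c)) (cong not (h zero refl)))
    (from p q (h ∘ suc))
allowed⇔ edit A S = mk⇔ (λ _ _ _ _ → refl) (λ _ → tt)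

-- Existential sentences: only the modifications of the witnesses matter

-- The set of witnesses marked by the bits. The tuple may repeat an element, which then belongs to
-- the set if any of its marks is set.
spread : ∀ {n m} → Vec (Fin n) m → Vec Bool m → Subset n
spread []      []       = Subset.⊥
spread (x ∷ ρ) (b ∷ bs) = (if b then Subset.⁅ x ⁆ else Subset.⊥) Subset.∪ spread ρ bs

∈-spread⁻ : ∀ {n m} (ρ : Vec (Fin n) m) bs {y} → y ∈ spread ρ bs →
  ∃[ j ] lookup ρ j ≡ y × lookup bs j ≡ true
∈-spread⁻ []      []       y∈ = contradiction y∈ ∉⊥
∈-spread⁻ (x ∷ ρ) (b ∷ bs) y∈ with x∈p∪q⁻ (if b then Subset.⁅ x ⁆ else Subset.⊥) (spread ρ bs) y∈
... | inj₂ y∈ᵗ = let j , eq , bit = ∈-spread⁻ ρ bs y∈ᵗ in suc j , eq , bit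
∈-spread⁻ (x ∷ ρ) (true  ∷ bs) y∈ | inj₁ y∈ʰ = zero , sym (x∈⁅y⁆⇒x≡y _ y∈ʰ) , refl
∈-spread⁻ (x ∷ ρ) (false ∷ bs) y∈ | inj₁ y∈ʰ = contradiction y∈ʰ ∉⊥

∈-spread⁺ : ∀ {n m} (ρ : Vec (Fin n) m) bs j → lookup bs j ≡ true → lookup ρ j ∈ spread ρ bs
∈-spread⁺ (x ∷ ρ) (true ∷ bs) zero    refl = x∈p∪q⁺ (inj₁ (x∈⁅x⁆ x))
∈-spread⁺ (x ∷ ρ) (b ∷ bs)    (suc j) eq   = x∈p∪q⁺ (inj₂ (∈-spread⁺ ρ bs j eq))

∣p∪q∣≤∣p∣+∣q∣ : ∀ {n} (p q : Subset n) → ∣ p Subset.∪ q ∣ ≤ ∣ p ∣ + ∣ q ∣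
∣p∪q∣≤∣p∣+∣q∣ []          []          = z≤n
∣p∪q∣≤∣p∣+∣q∣ (false ∷ p) (false ∷ q) = ∣p∪q∣≤∣p∣+∣q∣ p q
∣p∪q∣≤∣p∣+∣q∣ (false ∷ p) (true  ∷ q) = ≤-trans (s≤s (∣p∪q∣≤∣p∣+∣q∣ p q))
  (≤-reflexive (sym (+-suc ∣ p ∣ ∣ q ∣)))
∣p∪q∣≤∣p∣+∣q∣ (true  ∷ p) (false ∷ q) = s≤s (∣p∪q∣≤∣p∣+∣q∣ p q)
∣p∪q∣≤∣p∣+∣q∣ (true  ∷ p) (true  ∷ q) = s≤s
  (≤-trans (∣p∪q∣≤∣p∣+∣q∣ p q) (+-monoʳ-≤ ∣ p ∣ (n≤1+n ∣ q ∣)))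

∣spread∣≤ : ∀ {n m} (ρ : Vec (Fin n) m) bs → ∣ spread ρ bs ∣ ≤ m
∣spread∣≤ {n} []      []       = ≤-reflexive (∣⊥∣≡0 n)
∣spread∣≤ {n} (x ∷ ρ) (b ∷ bs) = ≤-trans
  (∣p∪q∣≤∣p∣+∣q∣ (if b then Subset.⁅ x ⁆ else Subset.⊥) (spread ρ bs))
  (+-mono-≤ (head b) (∣spread∣≤ ρ bs))
  where
  head : ∀ b → ∣ (if b then Subset.⁅ x ⁆ else Subset.⊥) ∣ ≤ 1
  head true  = ≤-reflexive (∣⁅x⁆∣≡1 x)
  head false = ≤-trans (≤-reflexive (∣⊥∣≡0 n)) z≤n

spreads : ∀ {r n m} → Vec (Fin n) m → Vec (Vec Bool m) r → Modulator r n
spreads ρ = Vec.map (spread ρ)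

‖spreads‖≤ : ∀ {r n m} (ρ : Vec (Fin n) m) (t : Vec (Vec Bool m) r) → ‖ spreads ρ t ‖ ≤ r * m
‖spreads‖≤ ρ []      = z≤n
‖spreads‖≤ ρ (bs ∷ t) = +-mono-≤ (∣spread∣≤ ρ bs) (‖spreads‖≤ ρ t)

-- Spreading it again cuts S down to the range of ρ: the result is contained in S, so it stays
-- allowed and costs no more, and it agrees with S on all witnesses.
restriction : ∀ {r n m} → Vec (Fin n) m → Modulator r n → Vec (Vec Bool m) r
restriction ρ = Vec.map (λ s → Vec.map (lookup s) ρ)

lookup-restriction : ∀ {r n m} (ρ : Vec (Fin n) m) (S : Modulator r n) i j →
                     lookup (lookup (restriction ρ S) i) j ≡ entry S i (lookup ρ j)
lookup-restriction ρ S i j = trans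
  (cong (λ u → lookup u j) (Vec.lookup-map i (λ s → Vec.map (lookup s) ρ) S))
  (Vec.lookup-map j (lookup (lookup S i)) ρ)

entry-spreads⁻ : ∀ {r n m} (ρ : Vec (Fin n) m) (t : Vec (Vec Bool m) r) i y →
  entry (spreads ρ t) i y ≡ true → ∃[ j ] lookup ρ j ≡ y × lookup (lookup t i) j ≡ true
entry-spreads⁻ ρ t i y eq = ∈-spread⁻ ρ (lookup t i)
  (Equivalence.from ∈⇔lookup
    (trans (cong (λ u → lookup u y) (sym (Vec.lookup-map i (spread ρ) t))) eq))

entry-spreads⁺ : ∀ {r n m} (ρ : Vec (Fin n) m) (t : Vec (Vec Bool m) r) i j →
  lookup (lookup t i) j ≡ true → entry (spreads ρ t) i (lookup ρ j) ≡ true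
entry-spreads⁺ ρ t i j eq = trans
  (cong (λ u → lookup u (lookup ρ j)) (Vec.lookup-map i (spread ρ) t))
  (Equivalence.to ∈⇔lookup (∈-spread⁺ ρ (lookup t i) j eq))

restricted⊆ : ∀ {r n m} (ρ : Vec (Fin n) m) (S : Modulator r n) i y →
  entry (spreads ρ (restriction ρ S)) i y ≡ true → entry S i y ≡ true
restricted⊆ ρ S i y eq with j , refl , bit ← entry-spreads⁻ ρ (restriction ρ S) i y eq =
  trans (sym (lookup-restriction ρ S i j)) bit

restricted-agrees : ∀ {r n m} (ρ : Vec (Fin n) m) (S : Modulator r n) i j →
  entry (spreads ρ (restriction ρ S)) i (lookup ρ j) ≡ entry S i (lookup ρ j)
restricted-agrees ρ S i j with entry S i (lookup ρ j) in eq
... | true  = entry-spreads⁺ ρ (restriction ρ S) i j (trans (lookup-restriction ρ S i j) eq)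
... | false = ¬-not λ h → case trans (sym eq) (restricted⊆ ρ S i _ h) of λ ()

‖‖-mono : ∀ {r n} (S T : Modulator r n) → (∀ i y → entry S i y ≡ true → entry T i y ≡ true) →
  ‖ S ‖ ≤ ‖ T ‖
‖‖-mono []      []      h = z≤n
‖‖-mono (s ∷ S) (t ∷ T) h = +-mono-≤
  (p⊆q⇒∣p∣≤∣q∣ {p = s} {q = t} λ y∈ → Equivalence.from ∈⇔lookup
    (h zero _ (Equivalence.to ∈⇔lookup y∈)))
  (‖‖-mono S T (h ∘ suc))

→-⇔ : ∀ {P P′ : Set} → P ⇔ P′ → (¬ P) ⇔ (¬ P′)
→-⇔ f = mk⇔ (_∘ Equivalence.from f) (_∘ Equivalence.to f)

×-⇔ : ∀ {P P′ Q Q′ : Set} → P ⇔ P′ → Q ⇔ Q′ → (P × Q) ⇔ (P′ × Q′)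
×-⇔ f g = mk⇔ (map (Equivalence.to f) (Equivalence.to g))
  (map (Equivalence.from f) (Equivalence.from g))

⊎-⇔ : ∀ {P P′ Q Q′ : Set} → P ⇔ P′ → Q ⇔ Q′ → (P ⊎ Q) ⇔ (P′ ⊎ Q′)
⊎-⇔ f g = mk⇔ (Sum.map (Equivalence.to f) (Equivalence.to g))
  (Sum.map (Equivalence.from f) (Equivalence.from g))

-- General enough for both uses: exchanging a modulator for its restriction under the same
-- assignment, and passing along an isomorphism.
satMatrix-cong : ∀ {r n n′ m} (A : Structure r n) (A′ : Structure r n′) (ρ : Vec (Fin n) m)
  (ρ′ : Vec (Fin n′) m) →
  (∀ i j → entry A i (lookup ρ j) ≡ entry A′ i (lookup ρ′ j)) →
  (∀ j j′ → lookup ρ j ≡ lookup ρ j′ ⇔ lookup ρ′ j ≡ lookup ρ′ j′) →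
  ∀ ψ → SatMatrix A ρ ψ ⇔ SatMatrix A′ ρ′ ψ
satMatrix-cong A A′ ρ ρ′ same eq = go
  where
  go : ∀ ψ → SatMatrix A ρ ψ ⇔ SatMatrix A′ ρ′ ψ
  go true′     = mk⇔ id id
  go false′    = mk⇔ id id
  go (rel i x) = ∈⇔lookup ⇔∘ mk⇔ (trans (sym (same i x))) (trans (same i x)) ⇔∘ ⇔-sym ∈⇔lookup
  go (x ≈′ y)  = eq x y
  go (¬′ ψ)    = →-⇔ (go ψ)
  go (ψ ∧′ χ)  = ×-⇔ (go ψ) (go χ)
  go (ψ ∨′ χ)  = ⊎-⇔ (go ψ) (go χ)

-- Search formulas for existential sentences

constant : ∀ {B N} → Bool → Formula B N
constant true  = ⊤′
constant false = ⊥′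

literal : ∀ {B N} → Bool → Fin N → Formula B N
literal true  i = var i
literal false i = not′ (var i)

literal-holds : ∀ {B N} b (i : Fin N) v → ⟦ literal {B} b i ⟧ v ≡ not b xor lookup v i
literal-holds true  i v = refl
literal-holds false i v = refl

rank : ∀ {r m} → Matrix r m → ℕ
rank true′     = 1
rank false′    = 1
rank (rel i x) = 1
rank (x ≈′ y)  = 1
rank (¬′ ψ)    = suc (rank ψ)
rank (ψ ∧′ χ)  = suc (rank ψ ⊔ rank χ)
rank (ψ ∨′ χ)  = suc (rank ψ ⊔ rank χ)

module _ {B : Basis} {N r n : ℕ} (A : Positions N r n) where

  -- Since S and ρ are known while the formula is built, a flip is realised by negating the literal
  -- and an equality becomes a constant.
  matrix-formula : ∀ {m} → Modulator r n → Vec (Fin n) m → Matrix r m → Formula B N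
  matrix-formula S ρ true′     = ⊤′
  matrix-formula S ρ false′    = ⊥′
  matrix-formula S ρ (rel i x) = literal (not (entry S i (lookup ρ x))) (entry A i (lookup ρ x))
  matrix-formula S ρ (x ≈′ y)  = constant (does (lookup ρ x Fin.≟ lookup ρ y))
  matrix-formula S ρ (¬′ ψ)    = not′ (matrix-formula S ρ ψ)
  matrix-formula S ρ (ψ ∧′ χ)  = matrix-formula S ρ ψ ∧″ matrix-formula S ρ χ
  matrix-formula S ρ (ψ ∨′ χ)  = matrix-formula S ρ ψ ∨″ matrix-formula S ρ χ

  matrix-correct : ∀ {m} S (ρ : Vec (Fin n) m) ψ v →
    Holds (matrix-formula S ρ ψ) v ⇔ SatMatrix (read v A ▷ S) ρ ψ
  matrix-correct S ρ true′     v = mk⇔ (λ _ → tt) (λ _ → refl)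
  matrix-correct S ρ false′    v = mk⇔ (λ ()) (λ ())
  matrix-correct S ρ (rel i x) v = mk⇔ (trans (sym eq)) (trans eq) ⇔∘ ⇔-sym ∈⇔lookup
    where
    y : Fin n
    y = lookup ρ x
    xor-comm : ∀ p q → not (not p) xor q ≡ q xor p
    xor-comm true  true  = refl
    xor-comm true  false = refl
    xor-comm false true  = refl
    xor-comm false false = refl
    eq : ⟦ literal {B} (not (entry S i y)) (entry A i y) ⟧ v ≡ entry (read v A ▷ S) i y
    eq = trans (literal-holds {B} (not (entry S i y)) (entry A i y) v)
      (trans (xor-comm (entry S i y) (lookup v (entry A i y)))
        (trans (cong (_xor entry S i y) (sym (entry-read v A i y)))
          (sym (entry-▷ (read v A) S i y))))
  matrix-correct S ρ (x ≈′ y)  v with lookup ρ x Fin.≟ lookup ρ y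
  ... | yes eq = mk⇔ (λ _ → eq) (λ _ → refl)
  ... | no ¬eq = mk⇔ (λ ()) (λ eq → contradiction eq ¬eq)
  matrix-correct S ρ (¬′ ψ)    v = mk⇔ (λ h → Equivalence.to not≡true h)
    (Equivalence.from not≡true) ⇔∘ →-⇔ (matrix-correct S ρ ψ v)
    where
    not≡true : ∀ {b} → not b ≡ true ⇔ (¬ b ≡ true)
    not≡true {true}  = mk⇔ (λ ()) (λ h → contradiction refl h)
    not≡true {false} = mk⇔ (λ _ ()) (λ _ → refl)
  matrix-correct S ρ (ψ ∧′ χ)  v = ∧″-holds (matrix-formula S ρ ψ) (matrix-formula S ρ χ) v ⇔∘ ×-⇔
    (matrix-correct S ρ ψ v) (matrix-correct S ρ χ v)
  matrix-correct S ρ (ψ ∨′ χ)  v = ∨″-holds (matrix-formula S ρ ψ) (matrix-formula S ρ χ) v ⇔∘ ⊎-⇔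
    (matrix-correct S ρ ψ v) (matrix-correct S ρ χ v)

  permit-formula : Operation → Fin N → Formula B N
  permit-formula del  i = var i
  permit-formula add  i = not′ (var i)
  permit-formula edit i = ⊤′

  permit-correct : ∀ ⊗ i v → ⟦ permit-formula ⊗ i ⟧ v ≡ permits ⊗ (lookup v i)
  permit-correct del  i v = refl
  permit-correct add  i v = refl
  permit-correct edit i v = refl

  allowed-formula : ∀ {m} → Operation → Vec (Fin n) m → Vec (Vec Bool m) r → Formula B N
  allowed-formula {m} ⊗ ρ t = ⋀ (List.allFin r) λ i → ⋀ (List.allFin m) λ j →
    if lookup (lookup t i) j then permit-formula ⊗ (entry A i (lookup ρ j)) else ⊤′

  allowed-correct : ∀ {m} ⊗ (ρ : Vec (Fin n) m) t v → Holds (allowed-formula ⊗ ρ t) v ⇔ Allowed ⊗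
    (read v A) (spreads ρ t)
  allowed-correct {m} ⊗ ρ t v = mk⇔ to from ⇔∘ ⇔-sym (allowed⇔ ⊗ (read v A) (spreads ρ t))
    where
    at : Fin r → Fin m → Formula B N
    at i j = if lookup (lookup t i) j then permit-formula ⊗ (entry A i (lookup ρ j)) else ⊤′
    permitted : ∀ i j → ⟦ permit-formula ⊗ (entry A i (lookup ρ j)) ⟧ v ≡ permits ⊗
      (entry (read v A) i (lookup ρ j))
    permitted i j = trans (permit-correct ⊗ _ v)
      (cong (permits ⊗) (sym (entry-read v A i (lookup ρ j))))
    to : Holds (allowed-formula ⊗ ρ t) v → ∀ i y → entry (spreads ρ t) i y ≡ true → permits ⊗
      (entry (read v A) i y) ≡ true
    to h i y eq with j , refl , bit ← entry-spreads⁻ ρ t i y eq =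
      trans (sym (permitted i j))
        (trans (cong (λ b → ⟦ if b then permit-formula ⊗ (entry A i (lookup ρ j)) else ⊤′ ⟧ v)
        (sym bit))
        (Equivalence.to (⋀-holds (List.allFin m) (at i) v)
          (Equivalence.to (⋀-holds (List.allFin r) (λ i → ⋀ (List.allFin m) (at i)) v) h
            (∈-allFin i)) (∈-allFin j)))
    from : (∀ i y → entry (spreads ρ t) i y ≡ true → permits ⊗ (entry (read v A) i y) ≡ true) →
      Holds (allowed-formula ⊗ ρ t) v
    from h = Equivalence.from (⋀-holds (List.allFin r) (λ i → ⋀ (List.allFin m) (at i)) v) λ {i} _ →
      Equivalence.from (⋀-holds (List.allFin m) (at i) v) λ {j} _ → at-holds i j
      where
      at-holds : ∀ i j → Holds (at i j) v
      at-holds i j with lookup (lookup t i) j in bit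
      ... | true  = trans (permitted i j) (h i (lookup ρ j) (entry-spreads⁺ ρ t i j bit))
      ... | false = refl

  -- The cost of t is a number known in advance and at most r m, so `atLeast` compares it with the
  -- budget.
  candidate : ∀ {m} → Operation → Matrix r m → List (Fin N) → Vec (Fin n) m → Vec (Vec Bool m) r →
    Formula B N
  candidate ⊗ ψ bs ρ t = allowed-formula ⊗ ρ t
    ∧″ atLeast ‖ spreads ρ t ‖ (List.map var (wires ‖ spreads ρ t ‖ 1 bs))
    ∧″ matrix-formula (spreads ρ t) ρ ψ

  search : ∀ {m} → Operation → Prenex r m → List (Fin N) → Vec (Fin n) m → Formula B N
  search {m} ⊗ (matrix ψ)  bs ρ = ⋁ (tuples r (tuples m bools)) (candidate ⊗ ψ bs ρ)
  search     ⊗ (quant _ φ) bs ρ = ⋁ (List.allFin n) (λ x → search ⊗ φ bs (x ∷ ρ))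

  candidate-correct : ∀ {m} ⊗ (ψ : Matrix r m) bs ρ t v → Holds (candidate ⊗ ψ bs ρ t) v ⇔
    (Allowed ⊗ (read v A) (spreads ρ t) × ‖ spreads ρ t ‖ ≤ value
      (List.map (lookup v) bs) × SatMatrix (read v A ▷ spreads ρ t) ρ ψ)
  candidate-correct ⊗ ψ bs ρ t v =
    ∧″-holds F (G ∧″ H) v ⇔∘ ×-⇔ (allowed-correct ⊗ ρ t v)
      (∧″-holds G H v ⇔∘ ×-⇔ cost-correct (matrix-correct (spreads ρ t) ρ ψ v))
    where
    c : ℕ
    c = ‖ spreads ρ t ‖
    F G H : Formula B N
    F = allowed-formula ⊗ ρ t
    G = atLeast c (List.map var (wires c 1 bs))
    H = matrix-formula (spreads ρ t) ρ ψ
    cost-correct : Holds G v ⇔ c ≤ value (List.map (lookup v) bs)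
    cost-correct = atLeast-holds c (List.map var (wires c 1 bs)) v ⇔∘
      subst (λ us → c ≤ ones us ⇔ c ≤ value (List.map (lookup v) bs))
        (sym (⟦map⟧ {B} var (wires c 1 bs) v)) (numeral-≥ v c bs)

  -- Existential quantifiers commute with the choice of the modulator, so all witnesses can be fixed
  -- before S; at the matrix S is exchanged for its restriction to them.
  search-correct : ∀ {m} ⊗ (φ : Prenex r m) → All (_≡ e) (pattern-of φ) → ∀ bs ρ v → Holds
    (search ⊗ φ bs ρ) v ⇔
    (∃[ S ] Allowed ⊗ (read v A) S × ‖ S ‖ ≤ value (List.map (lookup v) bs) × Sat
      (read v A ▷ S) ρ φ)
  search-correct {m} ⊗ (matrix ψ) [] bs ρ v = mk⇔
    (λ h → let t , _ , h′ = Equivalence.to (⋁-holds ts (candidate ⊗ ψ bs ρ) v) h in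
      spreads ρ t , Equivalence.to (candidate-correct ⊗ ψ bs ρ t v) h′)
    λ { (S , allowed , cost , sat) → Equivalence.from (⋁-holds ts (candidate ⊗ ψ bs ρ) v)
      (restriction ρ S , ∈-tuples _ (λ i → ∈-tuples _ (λ j → ∈-bools _)) ,
       Equivalence.from (candidate-correct ⊗ ψ bs ρ (restriction ρ S) v)
         ( Equivalence.from (allowed⇔ ⊗ _ _)
           (λ i y eq → Equivalence.to (allowed⇔ ⊗ _ _) allowed i y (restricted⊆ ρ S i y eq))
         , ≤-trans (‖‖-mono (spreads ρ (restriction ρ S)) S (restricted⊆ ρ S)) cost
         , Equivalence.from (satMatrix-cong _ _ ρ ρ
           (λ i j → trans (entry-▷ (read v A) _ i (lookup ρ j))
             (trans (cong (entry (read v A) i (lookup ρ j) xor_) (restricted-agrees ρ S i j))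
               (sym (entry-▷ (read v A) S i (lookup ρ j)))))
             (λ _ _ → mk⇔ id id) ψ) sat)) }
    where
    ts : List (Vec (Vec Bool m) r)
    ts = tuples r (tuples m bools)
  search-correct ⊗ (quant e φ) (refl ∷ es) bs ρ v = ⋁-holds (List.allFin n) _ v ⇔∘ mk⇔
    (λ { (x , _ , h) → let S , allowed , cost , sat = Equivalence.to (search-correct ⊗ φ es bs (x ∷ ρ) v) h in S , allowed , cost , x , sat })
    (λ { (S , allowed , cost , x , sat) → x , ∈-allFin x , Equivalence.from
      (search-correct ⊗ φ es bs (x ∷ ρ) v) (S , allowed , cost , sat) })

  module _ (n≤N : n ≤ N) where

    private
      X : ℕ
      X = 2 + N

    n≤X : n ≤ X ^ 1
    n≤X = ≤-trans n≤N (≤-trans (m≤n+m N 2) (≤-reflexive (sym (*-identityʳ X))))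

    length-allFin≤ : ∀ q → List.length (List.allFin q) ≤ X ^ q
    length-allFin≤ q = ≤-trans (≤-reflexive (length-allFin q))
      (≤-trans (<⇒≤ (n<2^n q)) (^-monoˡ-≤ q 2≤2+))

    literal-small : ∀ b (i : Fin N) → Small X 1 2 (literal {B} b i)
    literal-small true  i = Small-var 2≤2+ i
    literal-small false i = Small-not 2≤2+ (Small-var 2≤2+ {0} {0} i)

    constant-small : ∀ b → Small X 1 2 (constant {B} {N} b)
    constant-small true  = Small-const 2≤2+ AND
    constant-small false = Small-const 2≤2+ OR

    permit-small : ∀ ⊗ i → Small X 1 2 (permit-formula ⊗ i)
    permit-small del  i = literal-small true i
    permit-small add  i = literal-small false i
    permit-small edit i = constant-small true

    matrix-small : ∀ {m} S (ρ : Vec (Fin n) m) ψ → Small X (rank ψ) (3 * rank ψ)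
      (matrix-formula S ρ ψ)
    matrix-small S ρ true′     = Small-mono 2≤2+ ≤-refl (n≤1+n 2) (constant-small true)
    matrix-small S ρ false′    = Small-mono 2≤2+ ≤-refl (n≤1+n 2) (constant-small false)
    matrix-small S ρ (rel i x) = Small-mono 2≤2+ ≤-refl (n≤1+n 2) (literal-small _ _)
    matrix-small S ρ (x ≈′ y)  = Small-mono 2≤2+ ≤-refl (n≤1+n 2) (constant-small _)
    matrix-small S ρ (¬′ ψ)    = Small-mono 2≤2+ ≤-refl
      (≤-trans (n≤1+n _) (≤-reflexive (sym (*-suc 3 (rank ψ)))))
      (Small-not 2≤2+ (matrix-small S ρ ψ))
    matrix-small S ρ (ψ ∧′ χ)  = Small-mono 2≤2+ ≤-refl
      (≤-reflexive (sym (*-suc 3 (rank ψ ⊔ rank χ))))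
      (Small-pair 2≤2+ AND
        (Small-mono 2≤2+ (m≤m⊔n (rank ψ) (rank χ)) (*-monoʳ-≤ 3 (m≤m⊔n (rank ψ) (rank χ)))
        (matrix-small S ρ ψ))
                           (Small-mono 2≤2+ (m≤n⊔m (rank ψ) (rank χ))
                             (*-monoʳ-≤ 3 (m≤n⊔m (rank ψ) (rank χ))) (matrix-small S ρ χ)))
    matrix-small S ρ (ψ ∨′ χ)  = Small-mono 2≤2+ ≤-refl
      (≤-reflexive (sym (*-suc 3 (rank ψ ⊔ rank χ))))
      (Small-pair 2≤2+ OR (Small-mono 2≤2+ (m≤m⊔n (rank ψ) (rank χ))
        (*-monoʳ-≤ 3 (m≤m⊔n (rank ψ) (rank χ))) (matrix-small S ρ ψ))
                          (Small-mono 2≤2+ (m≤n⊔m (rank ψ) (rank χ))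
                            (*-monoʳ-≤ 3 (m≤n⊔m (rank ψ) (rank χ))) (matrix-small S ρ χ)))

    allowed-small : ∀ {m} ⊗ (ρ : Vec (Fin n) m) t → Small X 3 (2 + (r + (2 + (m + 2))))
      (allowed-formula ⊗ ρ t)
    allowed-small {m} ⊗ ρ t = Small-map 2≤2+ AND (List.allFin r) _ r (length-allFin≤ r) λ i →
      Small-map 2≤2+ AND (List.allFin m) _ m (length-allFin≤ m) λ j → at i j
      where
      at : ∀ i j → Small X 1 2
        (if lookup (lookup t i) j then permit-formula ⊗ (entry A i (lookup ρ j)) else ⊤′)
      at i j with lookup (lookup t i) j
      ... | true  = permit-small ⊗ _
      ... | false = constant-small true

    cost-small : ∀ {m} bs → List.length bs ≤ N → (ρ : Vec (Fin n) m) (t : Vec (Vec Bool m) r) →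
      let c = ‖ spreads ρ t ‖ ; q = r * m in
      Small X (suc (2 * q)) (2 + q * (6 + q)) (atLeast {B} c (List.map var (wires c 1 bs)))
    cost-small {m} bs len ρ t = Small-mono 2≤2+ (s≤s (*-monoʳ-≤ 2 c≤q))
      (+-monoʳ-≤ 2 (*-mono-≤ c≤q (≤-reflexive (+-suc 5 q))))
      (atLeast-small 2≤2+ c _ (suc q)
        (≤-trans (≤-reflexive (List.length-map var (wires c 1 bs)))
          (length-wires-bound c 1 bs c≤q len))
        (All.map⁺ (All.universal (Small-var 2≤2+) (wires c 1 bs))))
      where
      c q : ℕ
      c = ‖ spreads ρ t ‖
      q = r * m
      c≤q : c ≤ q
      c≤q = ‖spreads‖≤ ρ t

module _ {B : Basis} {r : ℕ} (⊗ : Operation) where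

  search-small : ∀ {m} (φ : Prenex r m) → ∃[ d ] ∃[ k ]
    (∀ {N n} (A : Positions N r n) bs ρ → n ≤ N → List.length bs ≤ N →
    Small (2 + N) d k (search {B} A ⊗ φ bs ρ))
  -- The exponent m r accounts for the 2^(m r) patterns of flipped bits; the bounds of the three
  -- conjuncts are added up to have a common one.
  search-small {m} (matrix ψ) = 3 + d , 2 + (m * r + (6 + k)) , λ {N} A bs ρ n≤N len →
    Small-map 2≤2+ OR (tuples r (tuples m bools)) (candidate A ⊗ ψ bs ρ) (m * r)
      (≤-trans (≤-reflexive
        (trans (length-tuples r (tuples m bools))
        (trans (cong (_^ r) (length-tuples m bools)) (^-*-assoc 2 m r))))
        (^-monoˡ-≤ (m * r) 2≤2+))
      λ t → Small-pair 2≤2+ AND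
        (Small-mono 2≤2+ (≤-trans (m≤m+n 3 _) (n≤1+n d)) (≤-trans (m≤m+n k₁ (k₂ + k₃)) (m≤n+m k 3))
          (allowed-small A n≤N ⊗ ρ t))
        (Small-pair 2≤2+ AND
          (Small-mono 2≤2+ (≤-trans (m≤m+n d₂ d₃) (m≤n+m (d₂ + d₃) 3))
            (≤-trans (m≤m+n k₂ k₃) (m≤n+m (k₂ + k₃) k₁)) (cost-small A n≤N bs len ρ t))
          (Small-mono 2≤2+ (≤-trans (m≤n+m d₃ d₂) (m≤n+m (d₂ + d₃) 3))
            (≤-trans (m≤n+m k₃ k₂) (m≤n+m (k₂ + k₃) k₁)) (matrix-small A n≤N (spreads ρ t) ρ ψ)))
    where
    d₂ d₃ d k₁ k₂ k₃ k : ℕ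
    d₂ = suc (2 * (r * m))
    d₃ = rank ψ
    d  = 3 + (d₂ + d₃)
    k₁ = 2 + (r + (2 + (m + 2)))
    k₂ = 2 + (r * m) * (6 + r * m)
    k₃ = 3 * rank ψ
    k  = k₁ + (k₂ + k₃)
  search-small (quant _ φ) with d , k , small ← search-small φ = suc d , 2 +
    (1 + k) , λ {N} {n} A bs ρ n≤N len →
    Small-map 2≤2+ OR (List.allFin n) (λ x → search A ⊗ φ bs (x ∷ ρ)) 1
      (≤-trans (≤-reflexive (length-allFin n)) (n≤X {B} A n≤N))
      λ x → small A bs (x ∷ ρ) n≤N len

existential-in-AC⁰ : ∀ ⊗ {r} (φ : Sentence r) → All (_≡ e) (pattern-of φ) → AC⁰ (Problem ⊗ φ)
existential-in-AC⁰ ⊗ φ es with d , k , small ← search-small ⊗ φ = solvable ⊗ φ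
  (λ A bs → search A ⊗ φ bs []) d k
  (λ A bs v → search-correct A ⊗ φ es bs [] v) (λ A bs → small A bs [])

≼-replicate : ∀ {p m} → p ≼ List.replicate m e → All (_≡ e) p
≼-replicate {m = zero}  []          = []
≼-replicate {m = suc m} (_ ∷ʳ p)    = ≼-replicate {m = m} p
≼-replicate {m = suc m} (refl ∷ p)  = refl ∷ ≼-replicate {m = m} p

-- Structures with the same colour counts are isomorphic

ones-∷ : ∀ b bs → ones (b ∷ bs) ≡ (if b then 1 else 0) + ones bs
ones-∷ true  bs = refl
ones-∷ false bs = refl

module Occurrences {X : Set} (_≟_ : DecidableEquality X) where

  occurrences : ∀ {n} → (Fin n → X) → X → ℕ
  occurrences f x = ones (List.tabulate (λ y → does (f y ≟ x)))

  occurrences-positive : ∀ {n} (g : Fin n → X) x → 1 ≤ occurrences g x → ∃[ j ] g j ≡ x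
  occurrences-positive {suc n} g x h with g zero ≟ x
  ... | yes eq = zero , eq
  ... | no _   = let j , eq = occurrences-positive (g ∘ suc) x h in suc j , eq

  indicator : X → X → ℕ
  indicator z x = if does (z ≟ x) then 1 else 0

  occurrences-remove : ∀ {n} (g : Fin (suc n) → X) j x →
    occurrences g x ≡ indicator (g j) x + occurrences (g ∘ Fin.punchIn j) x
  occurrences-remove g zero x = ones-∷ (does (g zero ≟ x)) _
  occurrences-remove {suc n} g (suc j) x = begin
    occurrences g x
      ≡⟨ ones-∷ (does (g zero ≟ x)) _ ⟩
    indicator (g zero) x + occurrences (g ∘ suc) x
      ≡⟨ cong (indicator (g zero) x +_) (occurrences-remove (g ∘ suc) j x) ⟩
    indicator (g zero) x + (indicator (g (suc j)) x + occurrences (g ∘ suc ∘ Fin.punchIn j) x)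
      ≡⟨ exchange (indicator (g zero) x) (indicator (g (suc j)) x) _ ⟩
    indicator (g (suc j)) x + (indicator (g zero) x + occurrences (g ∘ suc ∘ Fin.punchIn j) x)
      ≡⟨ cong (indicator (g (suc j)) x +_) (ones-∷ (does (g zero ≟ x)) _) ⟨
    indicator (g (suc j)) x + occurrences (g ∘ Fin.punchIn (suc j)) x ∎
    where
    open ≡-Reasoning
    exchange : ∀ p q r → p + (q + r) ≡ q + (p + r)
    exchange = solve-∀

  -- The first point is sent to some point of equal value; deleting both lowers the two counts of
  -- that value alike, and the permutation of the remaining points is extended by the chosen pair.
  matching : ∀ {n} (f g : Fin n → X) → (∀ x → occurrences f x ≡ occurrences g x) →
             Σ (Permutation n n) λ π → ∀ y → f y ≡ g (π ⟨$⟩ʳ y)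
  matching {zero}  f g same = Perm.id , λ ()
  matching {suc n} f g same = let j , gj≡f0 = found in insertion j gj≡f0
    where
    reflexive : ∀ x → indicator x x ≡ 1
    reflexive x with x ≟ x
    ... | yes _  = refl
    ... | no x≢x = contradiction refl x≢x
    found : ∃[ j ] g j ≡ f zero
    found = occurrences-positive g (f zero) (begin
      1                              ≡⟨ reflexive (f zero) ⟨
      indicator (f zero) (f zero)    ≤⟨ m≤m+n _ _ ⟩
      indicator (f zero) (f zero) + occurrences (f ∘ suc) (f zero)
        ≡⟨ occurrences-remove f zero (f zero) ⟨
      occurrences f (f zero)         ≡⟨ same (f zero) ⟩
      occurrences g (f zero)         ∎)
      where open ≤-Reasoning
    same′ : ∀ j → g j ≡ f zero → ∀ x → occurrences (f ∘ suc) x ≡ occurrences (g ∘ Fin.punchIn j) x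
    same′ j eq x = +-cancelˡ-≡ (indicator (f zero) x) _ _ (begin
      indicator (f zero) x + occurrences (f ∘ suc) x              ≡⟨ occurrences-remove f zero x ⟨
      occurrences f x                                             ≡⟨ same x ⟩
      occurrences g x                                             ≡⟨ occurrences-remove g j x ⟩
      indicator (g j) x + occurrences (g ∘ Fin.punchIn j) x
        ≡⟨ cong (λ z → indicator z x + occurrences (g ∘ Fin.punchIn j) x) eq ⟩
      indicator (f zero) x + occurrences (g ∘ Fin.punchIn j) x    ∎)
      where open ≡-Reasoning
    insertion : ∀ j → g j ≡ f zero → Σ (Permutation (suc n) (suc n)) λ π → ∀ y → f y ≡ g (π ⟨$⟩ʳ y)
    insertion j eq with π , agree ← matching (f ∘ suc) (g ∘ Fin.punchIn j) (same′ j eq) =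
      Perm.insert zero j π , λ
        { zero    → sym eq
        ; (suc y) → trans (agree y) (cong g (sym (Perm.insert-punchIn zero j π y))) }

color : ∀ {X : Set} {r n} → Vec (Vec X n) r → Fin n → Vec X r
color A y = Vec.map (λ u → lookup u y) A

_≟ᶜ_ : ∀ {r} → DecidableEquality (Vec Bool r)
_≟ᶜ_ = Vec.≡-dec Bool._≟_

count : ∀ {r n} → Structure r n → Vec Bool r → ℕ
count A = Occurrences.occurrences _≟ᶜ_ (color A)

-- The image of s under π, so membership is pulled back along the inverse.
permute : ∀ {n} → Permutation n n → Subset n → Subset n
permute π s = Vec.tabulate (λ y → lookup s (π ⟨$⟩ˡ y))

∣permute∣ : ∀ {n} (π : Permutation n n) s → ∣ permute π s ∣ ≡ ∣ s ∣
∣permute∣ π s = trans (cardinality (permute π s))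
  (trans (sum-cong-≗ λ y → cong (λ b → if b then 1 else 0)
    (Vec.lookup∘tabulate (λ y → lookup s (π ⟨$⟩ˡ y)) y))
    (trans (sym (sum-permute (λ y → if lookup s y then 1 else 0) (Perm.flip π)))
      (sym (cardinality s))))
  where
  cardinality : ∀ {n} (s : Subset n) → ∣ s ∣ ≡ Σ-sum (λ y → if lookup s y then 1 else 0)
  cardinality []          = refl
  cardinality (true ∷ s)  = cong suc (cardinality s)
  cardinality (false ∷ s) = cardinality s

permutes : ∀ {r n} → Permutation n n → Modulator r n → Modulator r n
permutes π = Vec.map (permute π)

‖permutes‖ : ∀ {r n} (π : Permutation n n) (S : Modulator r n) → ‖ permutes π S ‖ ≡ ‖ S ‖
‖permutes‖ π []      = refl
‖permutes‖ π (s ∷ S) = cong₂ _+_ (∣permute∣ π s) (‖permutes‖ π S)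

entry-permutes : ∀ {r n} (π : Permutation n n) (S : Modulator r n) i y → entry
  (permutes π S) i y ≡ entry S i (π ⟨$⟩ˡ y)
entry-permutes π S i y = trans (cong (λ u → lookup u y) (Vec.lookup-map i (permute π) S))
  (Vec.lookup∘tabulate (λ y → lookup (lookup S i) (π ⟨$⟩ˡ y)) y)

module _ {r n : ℕ} (A B : Structure r n) (π : Permutation n n)
  (iso : ∀ i y → entry A i y ≡ entry B i (π ⟨$⟩ʳ y)) where

  sat-iso : ∀ {m} (φ : Prenex r m) (ρ : Vec (Fin n) m) → Sat A ρ φ ⇔ Sat B (Vec.map (π ⟨$⟩ʳ_) ρ) φ
  sat-iso (matrix ψ) ρ = satMatrix-cong A B ρ _
    (λ i j → trans (iso i (lookup ρ j)) (cong (entry B i) (sym (Vec.lookup-map j (π ⟨$⟩ʳ_) ρ))))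
    (λ j j′ → mk⇔
      (λ eq → trans (Vec.lookup-map j _ ρ)
        (trans (cong (π ⟨$⟩ʳ_) eq) (sym (Vec.lookup-map j′ _ ρ))))
      (λ eq → Injection.injective (↔⇒↣ π)
        (trans (sym (Vec.lookup-map j _ ρ)) (trans eq (Vec.lookup-map j′ _ ρ)))))
    ψ
  sat-iso (quant a φ) ρ = mk⇔
    (λ sat x → subst (λ x → Sat B (x ∷ Vec.map (π ⟨$⟩ʳ_) ρ) φ) (Perm.inverseʳ π)
      (Equivalence.to (sat-iso φ ((π ⟨$⟩ˡ x) ∷ ρ)) (sat (π ⟨$⟩ˡ x))))
    (λ sat x → Equivalence.from (sat-iso φ (x ∷ ρ)) (sat (π ⟨$⟩ʳ x)))
  sat-iso (quant e φ) ρ = mk⇔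
    (λ { (x , sat) → π ⟨$⟩ʳ x , Equivalence.to (sat-iso φ (x ∷ ρ)) sat })
    (λ { (x , sat) → π ⟨$⟩ˡ x , Equivalence.from (sat-iso φ ((π ⟨$⟩ˡ x) ∷ ρ))
      (subst (λ x → Sat B (x ∷ Vec.map (π ⟨$⟩ʳ_) ρ) φ) (sym (Perm.inverseʳ π)) sat) })

module _ {r n : ℕ} (A B : Structure r n) (π : Permutation n n)
  (iso : ∀ i y → entry A i y ≡ entry B i (π ⟨$⟩ʳ y)) where

  yes-iso : ∀ ⊗ φ {k} → YesInstance ⊗ φ A k → YesInstance ⊗ φ B k
  yes-iso ⊗ φ (S , allowed , cost , sat) = permutes π S ,
    Equivalence.from (allowed⇔ ⊗ B (permutes π S)) (λ i y eq →
      trans (cong (permits ⊗)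
        (trans (cong (entry B i) (sym (Perm.inverseʳ π))) (sym (iso i (π ⟨$⟩ˡ y)))))
        (Equivalence.to (allowed⇔ ⊗ A S) allowed i (π ⟨$⟩ˡ y)
          (trans (sym (entry-permutes π S i y)) eq))) ,
    ≤-trans (≤-reflexive (‖permutes‖ π S)) cost ,
    Equivalence.to (sat-iso (A ▷ S) (B ▷ permutes π S) π iso′ φ []) sat
    where
    open ≡-Reasoning
    iso′ : ∀ i y → entry (A ▷ S) i y ≡ entry (B ▷ permutes π S) i (π ⟨$⟩ʳ y)
    iso′ i y = begin
      entry (A ▷ S) i y                                   ≡⟨ entry-▷ A S i y ⟩
      entry A i y xor entry S i y
        ≡⟨ cong₂ _xor_ (iso i y) (cong (entry S i) (sym (Perm.inverseˡ π))) ⟩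
      entry B i (π ⟨$⟩ʳ y) xor entry S i (π ⟨$⟩ˡ (π ⟨$⟩ʳ y))
        ≡⟨ cong (entry B i (π ⟨$⟩ʳ y) xor_) (entry-permutes π S i (π ⟨$⟩ʳ y)) ⟨
      entry B i (π ⟨$⟩ʳ y) xor entry (permutes π S) i (π ⟨$⟩ʳ y)
        ≡⟨ entry-▷ B (permutes π S) i (π ⟨$⟩ʳ y) ⟨
      entry (B ▷ permutes π S) i (π ⟨$⟩ʳ y)               ∎

yes-count-invariant : ∀ {r n} ⊗ φ (A B : Structure r n) {k} → (∀ χ → count A χ ≡ count B χ) →
                      YesInstance ⊗ φ A k → YesInstance ⊗ φ B k
yes-count-invariant ⊗ φ A B same
  with π , agree ← Occurrences.matching _≟ᶜ_ (color A) (color B) same =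
  yes-iso A B π (λ i y → trans (sym (Vec.lookup-map i (λ u → lookup u y) A))
    (trans (cong (λ χ → lookup χ i) (agree y))
      (Vec.lookup-map i (λ u → lookup u (π ⟨$⟩ʳ y)) B))) ⊗ φ

-- Decidability of satisfaction and of the modification problems

satMatrix? : ∀ {r n m} (A : Structure r n) (ρ : Vec (Fin n) m) ψ → Dec (SatMatrix A ρ ψ)
satMatrix? A ρ true′     = yes tt
satMatrix? A ρ false′    = no id
satMatrix? A ρ (rel i x) = lookup ρ x ∈? lookup A i
satMatrix? A ρ (x ≈′ y)  = lookup ρ x Fin.≟ lookup ρ y
satMatrix? A ρ (¬′ ψ)    = ¬? (satMatrix? A ρ ψ)
satMatrix? A ρ (ψ ∧′ χ)  = satMatrix? A ρ ψ ×-dec satMatrix? A ρ χ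
satMatrix? A ρ (ψ ∨′ χ)  = satMatrix? A ρ ψ ⊎-dec satMatrix? A ρ χ

sat? : ∀ {r n m} (A : Structure r n) (ρ : Vec (Fin n) m) φ → Dec (Sat A ρ φ)
sat? A ρ (matrix ψ)  = satMatrix? A ρ ψ
sat? A ρ (quant a φ) = Fin.all? (λ x → sat? A (x ∷ ρ) φ)
sat? A ρ (quant e φ) = Fin.any? (λ x → sat? A (x ∷ ρ) φ)

allowed? : ∀ ⊗ {r n} (A S : Structure r n) → Dec (Allowed ⊗ A S)
allowed? del  A S = Fin.all? (λ i → lookup S i ⊆? lookup A i)
allowed? add  A S = Fin.all? (λ i → Vec.≡-dec Bool._≟_ (lookup S i ∩ lookup A i) Subset.⊥)
allowed? edit A S = yes tt

anyStructure? : ∀ r {n} {P : Structure r n → Set} → (∀ S → Dec (P S)) → Dec (∃ P)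
anyStructure? zero    P? = map′ (λ p → [] , p) (λ { ([] , p) → p }) (P? [])
anyStructure? (suc r) P? = map′ (λ { (s , S , p) → (s ∷ S) , p }) (λ { ((s ∷ S) , p) → s , S , p })
  (anySubset? (λ s → anyStructure? r (λ S → P? (s ∷ S))))

yes? : ∀ {r n} ⊗ φ (A : Structure r n) k → Dec (YesInstance ⊗ φ A k)
yes? ⊗ φ A k = anyStructure? _ (λ S → allowed? ⊗ A S ×-dec (‖ S ‖ ≤? k) ×-dec sat? (A ▷ S) [] φ)

‖‖≤ : ∀ {r n} (S : Modulator r n) → ‖ S ‖ ≤ r * n
‖‖≤ []      = z≤n
‖‖≤ (s ∷ S) = +-mono-≤ (∣p∣≤n s) (‖‖≤ S)

-- Counting colours with threshold gates

lookup-∈ : ∀ {X Y : Set} (f g : X → Y) xs → Vec.map f (Vec.fromList xs) ≡ Vec.map g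
  (Vec.fromList xs) → ∀ {x} → x ∈ˡ xs → f x ≡ g x
lookup-∈ f g (x ∷ xs) eq (here refl) = Vec.∷-injectiveˡ eq
lookup-∈ f g (x ∷ xs) eq (there x∈)  = lookup-∈ f g xs (Vec.∷-injectiveʳ eq) x∈

Vec-ext : ∀ {X : Set} {n} {u v : Vec X n} → (∀ i → lookup u i ≡ lookup v i) → u ≡ v
Vec-ext {u = []}    {[]}    h = refl
Vec-ext {u = x ∷ u} {y ∷ v} h = cong₂ _∷_ (h zero) (Vec-ext (h ∘ suc))

colors : ∀ r → List (Vec Bool r)
colors r = tuples r bools

∈-colors : ∀ {r} (χ : Vec Bool r) → χ ∈ˡ colors r
∈-colors χ = ∈-tuples χ (λ i → ∈-bools (lookup χ i))

color-count : ℕ → ℕ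
color-count r = List.length (colors r)

nth-color : ∀ {r} → Fin (color-count r) → Vec Bool r
nth-color {r} = lookup (Vec.fromList (colors r))

profile : ∀ {r n} → Structure r n → Vec ℕ (color-count r)
profile {r} A = Vec.map (count A) (Vec.fromList (colors r))

yes-profile : ∀ {r n} ⊗ φ (A B : Structure r n) {k} → profile A ≡ profile B → YesInstance ⊗ φ A k →
  YesInstance ⊗ φ B k
yes-profile ⊗ φ A B eq = yes-count-invariant ⊗ φ A B
  (λ χ → lookup-∈ (count A) (count B) (colors _) eq (∈-colors χ))

count≤n : ∀ {r n} (A : Structure r n) χ → count A χ ≤ n
count≤n A χ = ≤-trans (List.length-filter _ (List.tabulate (λ y → does (color A y ≟ᶜ χ))))
  (≤-reflexive (List.length-tabulate (λ y → does (color A y ≟ᶜ χ))))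

module _ {N r n : ℕ} (A : Positions N r n) where

  color-formula : Vec Bool r → Fin n → Formula threshold N
  color-formula χ y = ⋀ (List.allFin r) λ i → literal (lookup χ i) (entry A i y)

  color-correct : ∀ χ y v → ⟦ color-formula χ y ⟧ v ≡ does (color (read v A) y ≟ᶜ χ)
  color-correct χ y v with color (read v A) y ≟ᶜ χ
  ... | yes eq = Equivalence.from (⋀-holds (List.allFin r) at v) λ {i} _ → matches i
    (trans (sym (bit i)) (cong (λ u → lookup u i) eq))
    where
    at : Fin r → Formula threshold N
    at i = literal (lookup χ i) (entry A i y)
    bit : ∀ i → lookup (color (read v A) y) i ≡ lookup v (entry A i y)
    bit i = trans (Vec.lookup-map i (λ u → lookup u y) (read v A)) (entry-read v A i y)
    matches : ∀ i → lookup v (entry A i y) ≡ lookup χ i → Holds (at i) v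
    matches i eq with lookup χ i
    ... | true  = eq
    ... | false = cong not eq
  ... | no ¬eq = ¬-not λ h → ¬eq
    (Vec-ext λ i → trans (bit i)
    (matches i (Equivalence.to (⋀-holds (List.allFin r) at v) h (∈-allFin i))))
    where
    at : Fin r → Formula threshold N
    at i = literal (lookup χ i) (entry A i y)
    bit : ∀ i → lookup (color (read v A) y) i ≡ lookup v (entry A i y)
    bit i = trans (Vec.lookup-map i (λ u → lookup u y) (read v A)) (entry-read v A i y)
    matches : ∀ i → Holds (at i) v → lookup v (entry A i y) ≡ lookup χ i
    matches i h with lookup χ i
    ... | true  = h
    ... | false = not-injective h

  count-formulas : Vec Bool r → List (Formula threshold N)
  count-formulas χ = List.map (color-formula χ) (List.allFin n)

  count-correct : ∀ χ v → ones (⟦ count-formulas χ ⟧* v) ≡ count (read v A) χ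
  count-correct χ v = cong ones (trans (⟦map⟧ (color-formula χ) (List.allFin n) v)
    (trans (List.map-cong (λ y → color-correct χ y v) (List.allFin n)) (List.map-tabulate id _)))

  exactly : ℕ → List (Formula threshold N) → Formula threshold N
  exactly t Fs = node (THR t) Fs ∧″ not′ (node (THR (suc t)) Fs)

  threshold-holds : ∀ t (Fs : List (Formula threshold N)) v → Holds (node (THR t) Fs) v ⇔ t ≤ ones
    (⟦ Fs ⟧* v)
  threshold-holds t Fs v = mk⇔ (λ h → ≤ᵇ⇒≤ t _ (Equivalence.from T-≡ h))
    (λ h → Equivalence.to T-≡ (≤⇒≤ᵇ h))

  exactly-holds : ∀ t Fs v → Holds (exactly t Fs) v ⇔ ones (⟦ Fs ⟧* v) ≡ t
  exactly-holds t Fs v = ∧″-holds (node (THR t) Fs) (not′ (node (THR (suc t)) Fs)) v ⇔∘ mk⇔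
    (λ (h , h′) → ≤-antisym
      (≮⇒≥ λ t< → case trans
      (sym (cong not (Equivalence.from (threshold-holds (suc t) Fs v) t<))) h′ of λ ())
                            (Equivalence.to (threshold-holds t Fs v) h))
    (λ { refl → Equivalence.from (threshold-holds t Fs v) ≤-refl ,
                cong not (¬-not (1+n≰n ∘ Equivalence.to (threshold-holds (suc t) Fs v))) })

  profile-formula : Vec ℕ (color-count r) → Formula threshold N
  profile-formula p = ⋀ (List.allFin (color-count r)) λ j → exactly (lookup p j)
    (count-formulas (nth-color j))

  profile-correct : ∀ p v → Holds (profile-formula p) v ⇔ profile (read v A) ≡ p
  profile-correct p v = ⋀-holds (List.allFin (color-count r)) at v ⇔∘ mk⇔
    (λ h → Vec-ext λ j → trans (count-at j)
      (Equivalence.to (exactly-holds (lookup p j) (count-formulas (nth-color j)) v)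
      (h (∈-allFin j))))
    (λ { refl {j} _ → Equivalence.from
      (exactly-holds (lookup p j) (count-formulas (nth-color j)) v) (sym (count-at j)) })
    where
    at : Fin (color-count r) → Formula threshold N
    at j = exactly (lookup p j) (count-formulas (nth-color j))
    count-at : ∀ j → lookup (profile (read v A)) j ≡ ones (⟦ count-formulas (nth-color j) ⟧* v)
    count-at j = trans (Vec.lookup-map j (count (read v A)) (Vec.fromList (colors r)))
      (sym (count-correct (nth-color j) v))

  module _ (⊗ : Operation) (φ : Sentence r) where

    -- An entry of the table built into the circuit. It depends on n, p and c and not on the input
    -- string, so it is decided during the construction; `yes-profile` then exchanges B for the
    -- actual input.
    Feasible : Vec ℕ (color-count r) → ℕ → Set
    Feasible p c = ∃[ B ] profile {r} {n} B ≡ p × YesInstance ⊗ φ B c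

    feasible? : ∀ p c → Dec (Feasible p c)
    feasible? p c = anyStructure? r (λ B → Vec.≡-dec _≟_ (profile B) p ×-dec yes? ⊗ φ B c)

    affordable : ℕ → List (Fin N) → Formula threshold N
    affordable c bs = node (THR c) (List.map var (wires c 1 bs))

    option : List (Fin N) → ∀ p c → Dec (Feasible p c) → Formula threshold N
    option bs p c (yes _) = profile-formula p ∧″ affordable c bs
    option bs p c (no _)  = ⊥′

    profiles : List (Vec ℕ (color-count r))
    profiles = tuples (color-count r) (List.upTo (suc n))

    -- The costs of a modulator are 0, …, r n.
    optimum : List (Fin N) → Vec ℕ (color-count r) → Formula threshold N
    optimum bs p = ⋁ (List.allFin (suc (r * n))) λ c → option bs p (Fin.toℕ c)
      (feasible? p (Fin.toℕ c))

    tally : List (Fin N) → Formula threshold N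
    tally bs = ⋁ profiles (optimum bs)

    affordable-correct : ∀ c bs v → Holds (affordable c bs) v ⇔ c ≤ value (List.map (lookup v) bs)
    affordable-correct c bs v = threshold-holds c (List.map var (wires c 1 bs)) v ⇔∘
      subst (λ us → c ≤ ones us ⇔ c ≤ value (List.map (lookup v) bs))
        (sym (⟦map⟧ {threshold} var (wires c 1 bs) v)) (numeral-≥ v c bs)

    tally-correct : ∀ bs v → Holds (tally bs) v ⇔ YesInstance ⊗ φ (read v A)
      (value (List.map (lookup v) bs))
    tally-correct bs v = mk⇔ to from
      where
      k : ℕ
      k = value (List.map (lookup v) bs)
      opt : Vec ℕ (color-count r) → Fin (suc (r * n)) → Formula threshold N
      opt p c = option bs p (Fin.toℕ c) (feasible? p (Fin.toℕ c))
      option-to : ∀ p c dec → Holds (option bs p c dec) v → YesInstance ⊗ φ (read v A) k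
      option-to p c (yes (B , profile-B , sat)) h =
        let h₁ , h₂ = Equivalence.to (∧″-holds (profile-formula p) (affordable c bs) v) h
            S , allowed , cost , sat′ = yes-profile ⊗ φ B (read v A)
              (trans profile-B (sym (Equivalence.to (profile-correct p v) h₁))) sat
        in S , allowed , ≤-trans cost (Equivalence.to (affordable-correct c bs v) h₂) , sat′
      to : Holds (tally bs) v → YesInstance ⊗ φ (read v A) k
      to h = let p , _ , h′ = Equivalence.to (⋁-holds profiles (optimum bs) v) h
                 c , _ , h″ = Equivalence.to (⋁-holds (List.allFin (suc (r * n))) (opt p) v) h′
             in option-to p (Fin.toℕ c) (feasible? p (Fin.toℕ c)) h″
      from : YesInstance ⊗ φ (read v A) k → Holds (tally bs) v
      from (S , allowed , cost , sat) = Equivalence.from (⋁-holds profiles (optimum bs) v)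
        (p , ∈-tuples p (λ j → subst (_∈ˡ List.upTo (suc n))
          (sym (Vec.lookup-map j (count (read v A)) (Vec.fromList (colors r))))
                                 (∈-upTo⁺ (s≤s (count≤n (read v A) (nth-color j))))) ,
         Equivalence.from (⋁-holds (List.allFin (suc (r * n))) (opt p) v)
           -- The table is entered at the cost of S and not at the budget, which may be
           -- exponentially large.
           (Fin.fromℕ< bound , ∈-allFin _ ,
           subst (λ c → Holds (option bs p c (feasible? p c)) v) (sym (Fin.toℕ-fromℕ< bound))
             (chosen (feasible? p ‖ S ‖))))
        where
        p : Vec ℕ (color-count r)
        p = profile (read v A)
        bound : ‖ S ‖ < suc (r * n)
        bound = s≤s (‖‖≤ S)
        chosen : ∀ dec → Holds (option bs p ‖ S ‖ dec) v
        chosen (yes _) = Equivalence.from (∧″-holds (profile-formula p) (affordable ‖ S ‖ bs) v)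
          (Equivalence.from (profile-correct p v) refl , Equivalence.from
            (affordable-correct ‖ S ‖ bs v) cost)
        chosen (no ¬f) = contradiction (read v A , refl , S , allowed , ≤-refl , sat) ¬f

    module _ (n≤N : n ≤ N) where

      private
        X q : ℕ
        X = 2 + N
        q = color-count r

      length-allFin≤X : List.length (List.allFin n) ≤ X ^ 1
      length-allFin≤X = ≤-trans (≤-reflexive (length-allFin n)) (n≤X {threshold} A n≤N)

      exactly-small : ∀ t χ → Small X 5 (12 + r) (exactly t (count-formulas χ))
      exactly-small t χ = Small-pair 2≤2+ AND
        (Small-mono 2≤2+ (n≤1+n 3) (≤-trans (n≤1+n _) (n≤1+n _)) (counted t))
        (Small-not 2≤2+ (counted (suc t)))
        where
        counted : ∀ t → Small X 3 (7 + r) (node (THR t) (count-formulas χ))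
        counted t = Small-mono 2≤2+ ≤-refl (≤-reflexive (cong (λ x → 5 + x) (+-comm r 2)))
          (Small-map 2≤2+ (THR t) (List.allFin n) (color-formula χ) 1 length-allFin≤X λ y →
          Small-map 2≤2+ AND (List.allFin r) _ r (length-allFin≤ {threshold} A n≤N r) λ i →
            literal-small A n≤N (lookup χ i) (entry A i y))

      profile-small : ∀ p → Small X 6 (2 + (q + (12 + r))) (profile-formula p)
      profile-small p = Small-map 2≤2+ AND (List.allFin q) _ q
        (length-allFin≤ {threshold} A n≤N q) λ j → exactly-small (lookup p j) (nth-color j)

      1+rn≤ : suc (r * n) ≤ X ^ suc r
      1+rn≤ = begin
        suc (r * n)
          ≤⟨ s≤s (≤-trans (m≤n+m (r * n) (r + n)) (≤-reflexive (+-assoc r n (r * n)))) ⟩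
        suc (r + (n + r * n)) ≡⟨ expand r n ⟩
        suc n * suc r
          ≤⟨ *-mono-≤ (s≤s (≤-trans n≤N (n≤1+n N))) (≤-trans (n<2^n r) (^-monoˡ-≤ r 2≤2+)) ⟩
        X ^ suc r            ∎
        where
        open ≤-Reasoning
        expand : ∀ r n → 1 + (r + (n + r * n)) ≡ (1 + n) * (1 + r)
        expand = solve-∀

      affordable-small : ∀ {c} bs → c ≤ r * n → List.length bs ≤ N → Small X 6 (4 + r)
        (affordable c bs)
      affordable-small {c} bs c≤ len = Small-mono 2≤2+ (s≤s z≤n)
        (≤-reflexive (cong (λ x → 4 + x) (+-identityʳ r)))
        (Small-map 2≤2+ {d = 0} {k = 0} (THR c) (wires c 1 bs) var (2 + r) (begin
          List.length (wires c 1 bs)   ≤⟨ length-wires c 1 bs ⟩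
          List.length bs * c
            ≤⟨ *-mono-≤ (≤-trans len (m≤n+m N 2)) (≤-trans c≤ (≤-trans (n≤1+n _) 1+rn≤)) ⟩
          X ^ (2 + r)                  ∎) (Small-var 2≤2+))
        where open ≤-Reasoning

      option-small : ∀ {c} bs p dec → c ≤ r * n → List.length bs ≤ N → Small X 7 (17 + (q + r))
        (option bs p c dec)
      option-small bs p (no _)  c≤ len = Small-mono 2≤2+ (s≤s z≤n) (s≤s (s≤s z≤n))
        (Small-const 2≤2+ OR)
      option-small bs p (yes _) c≤ len = Small-pair 2≤2+ {k = 14 + (q + r)} AND
        (Small-mono 2≤2+ ≤-refl (≤-reflexive (rearrange q r)) (profile-small p))
        (Small-mono 2≤2+ ≤-refl (+-mono-≤ (m≤m+n 4 10) (m≤n+m r q)) (affordable-small bs c≤ len))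
        where
        rearrange : ∀ q r → 2 + (q + (12 + r)) ≡ 14 + (q + r)
        rearrange = solve-∀

      tally-small : ∀ bs → List.length bs ≤ N → Small X 9
        (2 + (q + (2 + (suc r + (17 + (q + r)))))) (tally bs)
      tally-small bs len = Small-map 2≤2+ OR profiles (optimum bs) q
        (≤-trans (≤-reflexive
          (trans (length-tuples q (List.upTo (suc n))) (cong (_^ q) (List.length-upTo (suc n)))))
          (^-monoˡ-≤ q (s≤s (≤-trans n≤N (n≤1+n N)))))
        λ p → Small-map 2≤2+ OR (List.allFin (suc (r * n))) _ (suc r)
          (≤-trans (≤-reflexive (length-allFin (suc (r * n)))) 1+rn≤)
          λ c → option-small bs p (feasible? p (Fin.toℕ c)) (s≤s⁻¹ (Fin.toℕ<n c)) len

all-in-TC⁰ : ∀ ⊗ {r} (φ : Sentence r) → TC⁰ (Problem ⊗ φ)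
all-in-TC⁰ ⊗ φ = solvable ⊗ φ (λ A bs → tally A ⊗ φ bs) _ _
  (λ A bs v → tally-correct A ⊗ φ bs v) (λ A bs n≤N len → tally-small A ⊗ φ n≤N bs len)

theorem4p15 : (p : Pattern) (⊗ : Operation) →
    ((∃[ m ] p ≼ replicate m e) → RM ⊗ p ⊆ AC⁰)
    × ([ a ] ≼ p → (RM ⊗ p ⊈ AC⁰) × (RM ⊗ p ⊆ TC⁰))
theorem4p15 p ⊗ =
  (λ (m , p≼) → solvable-class λ { φ refl → existential-in-AC⁰ ⊗ φ (≼-replicate {m = m} p≼) }) ,
  λ a≼p → (λ RM⊆AC⁰ → not-in-AC⁰ ⊗ a≼p (RM⊆AC⁰ (1 , hard-sentence ⊗ a≼p , pattern-universal (hard-literal ⊗) a≼p , id , id))) ,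
    solvable-class λ φ _ → all-in-TC⁰ ⊗ φ
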